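{- For every $n\ge1$, the map $\mathcal{R}:\mathfrak{W}_n\to\mathfrak{W}_n$ is a bijection such that for every $w\in\mathfrak{W}_n$ we have $w\sim_{cid}\mathcal{R}(w)$ and $$(w\setminus s)^-\sim_{rid}\mathcal{R}(w)\setminus m,$$ where $s$ and $m$ are the smallest and largest letters of $w$. Moreover, the set of integers occurring in $\mathcal{R}(w)$ equals the set of integers occurring in $w$.
   Context: Partitions are Young diagrams in English notation, box $(i,j)$ in row $i$ from the top and column $j$ from the left. For $\lambda\subseteq\mu$, $\mathrm{Inc}(\mu/\lambda)$ is the set of fillings of $\mu/\lambda$ by positive integers strictly increasing along rows and down columns; $\mathrm{Inc}^{st}(\mu/\lambda)$ is the subset of those whose set of entries is $\{1,\dots,k\}$ for some $k$. $\sigma_n=(n,\dots,1)$; $M_n\in\mathrm{Inc}(\sigma_n)$ has entry $i+j-1$ in box $(i,j)$. Inner corner of $\mu/\lambda$: a box of $\lambda$ with no box of $\lambda$ immediately right of or below it; outer corner: a box not in $\mu$ whose box immediately above and box immediately left are each in $\mu$ or outside the positive quadrant. $\mathrm{jdt}_B(T)$ (for a set $B$ of inner corners): put dots in $B$; for $i=1,2,\dots$, simultaneously replace each dot having an $i$ immediately below or right of it by $i$ and each such $i$ by a dot; delete dots. $\mathrm{rjdt}_C(S)$ (for a set $C$ of outer corners, $k$ the largest entry): put dots in $C$; for $i=k,\dots,1$ simultaneously replace each dot having an $i$ immediately above or left of it by $i$ and each such $i$ by a dot; delete dots. For $T\in\mathrm{Inc}(\lambda)$ (largest entry $k$, $B_i$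 = boxes containing $i$) and $U\in\mathrm{Inc}(\mu/\lambda)$ (largest entry $k'$, $C_i$ = boxes containing $i$): $\mathrm{jdt}_T(U)=U_0$ where $U_k=U$, $U_{i-1}=\mathrm{jdt}_{B_i}(U_i)$; $\mathrm{rjdt}_U(T)=T_{k'+1}$ where $T_1=T$, $T_{i+1}=\mathrm{rjdt}_{C_i}(T_i)$; $\mathrm{infusion}(T,U)=(\mathrm{jdt}_T(U),\mathrm{rjdt}_U(T))$. A tableau $U\in\mathrm{Inc}(\mu/\lambda)$ rectifies to a straight-shape $T$ if $\mathrm{jdt}_S(U)=T$ for some $S\in\mathrm{Inc}(\lambda)$; $\mathrm{Rect}_T(\mu/\lambda)$ is the set of tableaux of shape $\mu/\lambda$ rectifying to $T$. $\mathfrak{W}_n$: words of length $n$ in positive integers; $\mathfrak{W}^{st}_n$: those whose set of letters is $\{1,\dots,k\}$ for some $k$. A word $w\in\mathfrak{W}_n$ is identified with the tableau of shape $\sigma_n/\sigma_{n-1}$ having $w_i$ in box $(n+1-i,i)$, and $(\mathcal{W}(w),\mathcal{M}(w))=\mathrm{infusion}(M_{n-1},w)$. Promotion: for a straight shape $\lambda$ and $W\in\mathrm{Inc}^{st}(\lambda)$ with largest entry $k$, delete the entry $1$ (in box $(1,1)$) and decrement all other entries by $1$, obtaining $W^-$; compute $\mathrm{jdt}_{\{(1,1)\}}(W^-)$, of some straight shape $\rho\subseteq\lambda$, and fill the vacated boxes $\lambda/\rho$ with $k$; the result is $\partial W\in\mathrm{Inc}^{st}(\lambda)$. For $n\ge2$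 the map $f(w)=\mathrm{infusion}(M_{n-1},w)$ is a bijection from $\mathfrak{W}^{st}_n$ onto $\bigcup_{\lambda}\mathrm{Inc}^{st}(\lambda)\times\mathrm{Rect}_{M_{n-1}}(\sigma_n/\lambda)$, and $\mathcal{R}(w):=f^{ -1}(\partial\mathcal{W}(w),\mathcal{M}(w))$ for $w\in\mathfrak{W}^{st}_n$. For general $w\in\mathfrak{W}_n$ with distinct letters $v_1<\dots<v_k$, let $\mathrm{st}(w)$ replace each $v_i$ by $i$, and let $\mathcal{R}(w)$ be $\mathcal{R}(\mathrm{st}(w))$ with each $i$ replaced by $v_i$. For $n=1$, $\mathcal{R}$ is the identity. For a word $x$, $\mathrm{lis}(x)$, $\mathrm{lds}(x)$ denote the lengths of longest strictly increasing/decreasing subsequences. $u\sim_{cid}w$ (same length $n$): for all $1\le i\le j\le n$, $\mathrm{lis}$ and $\mathrm{lds}$ of $u_i\cdots u_j$ and $w_i\cdots w_j$ agree. $u\sim_{rid}w$: for every integer interval $[a,b]$, the words obtained from $u$ and $w$ by deleting all letters not in $[a,b]$ have equal $\mathrm{lis}$ and equal $\mathrm{lds}$. For a word $x$ and letter $a$, $x\setminus a$ deletes all occurrences of $a$. If $s=v_1<v_2<\dots<v_k$ are the letters of $w$, $(w\setminus s)^-$ is obtained from $w\setminus s$ by replacing $v_i$ by $v_{i-1}$ for $2\le i\le k$. -}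

module Defs where

open import Data.Nat using (ℕ; zero; suc; _+_; _∸_; _≤_; _⊔_; _≡ᵇ_; _≤ᵇ_; _<ᵇ_)
open import Data.Bool using (Bool; true; false; _∧_; _∨_; not; if_then_else_)
open import Data.List using (List; []; _∷_; _++_; map; filterᵇ; foldr; foldl; length; upTo; reverse; concatMap; zip; take; drop)
open import Data.Bool.ListAction using (any; all)
open import Data.Product using (_×_; _,_; proj₁; proj₂)
open import Data.Maybe using (Maybe; just; nothing)

-- Boxes and tableaux.  A box is (row , column), 1-indexed (English
-- notation).  A (skew) tableau is a finite list of (box , entry) pairs;
-- its shape is the set of boxes occurring in it.

Box : Set
Box = ℕ × ℕ

Tab : Set
Tab = List (Box × ℕ)

boxEq : Box → Box → Bool
boxEq (a , b) (c , d) = (a ≡ᵇ c) ∧ (b ≡ᵇ d)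

pairEq : Box × ℕ → Box × ℕ → Bool
pairEq (b , e) (b' , e') = boxEq b b' ∧ (e ≡ᵇ e')

right below above left : Box → Box
right (r , c) = (r , suc c)
below (r , c) = (suc r , c)
above (r , c) = (r ∸ 1 , c)
left  (r , c) = (r , c ∸ 1)

hasEntry : Tab → Box → ℕ → Bool
hasEntry T b i = any (λ p → boxEq b (proj₁ p) ∧ (proj₂ p ≡ᵇ i)) T

boxes : Tab → List Box
boxes = map proj₁

inBoxes : Box → List Box → Bool
inBoxes b bs = any (boxEq b) bs

maxEntry : Tab → ℕ
maxEntry = foldr (λ p m → proj₂ p ⊔ m) 0

boxesWith : ℕ → Tab → List Box
boxesWith i T = boxes (filterᵇ (λ p → proj₂ p ≡ᵇ i) T)

oneTo : ℕ → List ℕ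
oneTo k = map suc (upTo k)

-- One simultaneous swap step of (reverse) jeu de taquin with dots,
-- for the value i.  `nb` gives the neighbours a dot looks at
-- (right/below for jdt, above/left for rjdt).

swapStep : (Box → Box) → (Box → Box) → ℕ → List Box × Tab → List Box × Tab
swapStep n1 n2 i (dots , T) = (stay ++ newDots , kept ++ map (λ d → (d , i)) moved)
  where
  adj : Box → Bool
  adj d = hasEntry T (n1 d) i ∨ hasEntry T (n2 d) i
  moved = filterᵇ adj dots
  stay  = filterᵇ (λ d → not (adj d)) dots
  nearDot : Box → Bool
  nearDot b = any (λ d → boxEq b (n1 d) ∨ boxEq b (n2 d)) dots
  becomes : Box × ℕ → Bool
  becomes p = (proj₂ p ≡ᵇ i) ∧ nearDot (proj₁ p)
  kept    = filterᵇ (λ p → not (becomes p)) T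
  newDots = boxes (filterᵇ becomes T)

jdtB : List Box → Tab → Tab
jdtB B T = proj₂ (foldl (λ st i → swapStep right below i st) (B , T) (oneTo (maxEntry T)))

rjdtC : List Box → Tab → Tab
rjdtC C S = proj₂ (foldl (λ st i → swapStep above left i st) (C , S) (reverse (oneTo (maxEntry S))))

jdtT : Tab → Tab → Tab
jdtT T U = foldl (λ V i → jdtB (boxesWith i T) V) U (reverse (oneTo (maxEntry T)))

rjdtU : Tab → Tab → Tab
rjdtU U T = foldl (λ S i → rjdtC (boxesWith i U) S) T (oneTo (maxEntry U))

infusion : Tab → Tab → Tab × Tab
infusion T U = (jdtT T U , rjdtU U T)

tabEqᵇ : Tab → Tab → Bool
tabEqᵇ T T' = all (λ p → any (pairEq p) T') T ∧ all (λ p → any (pairEq p) T) T'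

Mstair : ℕ → Tab
Mstair n = concatMap (λ i → map (λ j → ((i , j) , i + j ∸ 1)) (oneTo (n ∸ i))) (oneTo n)

-- word w of length n as tableau of shape σ_n/σ_{n-1}: w_i in box (n+1-i , i)
wordTab : List ℕ → Tab
wordTab w = map (λ p → ((length w ∸ proj₁ p , suc (proj₁ p)) , proj₂ p)) (zip (upTo (length w)) w)

fInf : List ℕ → Tab × Tab
fInf w = infusion (Mstair (length w)) (wordTab w)

promotion : Tab → Tab
promotion W = J ++ map (λ b → (b , k)) vacated
  where
  k  = maxEntry W
  Wm = map (λ p → (proj₁ p , proj₂ p ∸ 1)) (filterᵇ (λ p → not (boxEq (proj₁ p) (1 , 1))) W)
  J  = jdtB ((1 , 1) ∷ []) Wm
  vacated = filterᵇ (λ b → not (inBoxes b (boxes J))) (boxes W)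

maxL : List ℕ → ℕ
maxL = foldr _⊔_ 0

elemᵇ : ℕ → List ℕ → Bool
elemᵇ a = any (a ≡ᵇ_)

letters : List ℕ → List ℕ
letters w = filterᵇ (λ v → elemᵇ v w) (upTo (suc (maxL w)))

listEqᵇ : List ℕ → List ℕ → Bool
listEqᵇ [] [] = true
listEqᵇ (x ∷ xs) (y ∷ ys) = (x ≡ᵇ y) ∧ listEqᵇ xs ys
listEqᵇ _ _ = false

isStd : List ℕ → Bool
isStd w = listEqᵇ (letters w) (oneTo (length (letters w)))

idx : ℕ → List ℕ → ℕ
idx a [] = 0
idx a (x ∷ xs) = if a ≡ᵇ x then 0 else suc (idx a xs)

nthD : List ℕ → ℕ → ℕ
nthD [] _ = 0
nthD (x ∷ xs) zero = x
nthD (x ∷ xs) (suc i) = nthD xs i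

st : List ℕ → List ℕ
st w = map (λ a → suc (idx a (letters w))) w

destd : List ℕ → List ℕ → List ℕ
destd vs u = map (λ i → nthD vs (i ∸ 1)) u

allWords : ℕ → ℕ → List (List ℕ)
allWords m zero = [] ∷ []
allWords m (suc l) = concatMap (λ a → map (a ∷_) (allWords m l)) (oneTo m)

findFirst : {A : Set} → (A → Bool) → A → List A → A
findFirst p d [] = d
findFirst p d (x ∷ xs) = if p x then x else findFirst p d xs

-- R on standardized words (n ≥ 2): R(w) = f⁻¹(∂W(w) , M(w)).
-- f⁻¹ is computed by searching the (finite) set 𝔚^st_n of candidates;
-- since f is a bijection onto its image (as stated in the paper), the
-- search returns the unique preimage.
Rst : List ℕ → List ℕ
Rst w = findFirst matches w (filterᵇ isStd (allWords (length w) (length w)))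
  where
  target = (promotion (proj₁ (fInf w)) , proj₂ (fInf w))
  matches : List ℕ → Bool
  matches u = tabEqᵇ (proj₁ (fInf u)) (proj₁ target) ∧ tabEqᵇ (proj₂ (fInf u)) (proj₂ target)

R : List ℕ → List ℕ
R w = if length w ≤ᵇ 1 then w else destd (letters w) (Rst (st w))

subs : List ℕ → List (List ℕ)
subs [] = [] ∷ []
subs (x ∷ xs) = map (x ∷_) (subs xs) ++ subs xs

incᵇ decᵇ : List ℕ → Bool
incᵇ [] = true
incᵇ (x ∷ []) = true
incᵇ (x ∷ y ∷ ys) = (x <ᵇ y) ∧ incᵇ (y ∷ ys)
decᵇ [] = true
decᵇ (x ∷ []) = true
decᵇ (x ∷ y ∷ ys) = (y <ᵇ x) ∧ decᵇ (y ∷ ys)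

lis lds : List ℕ → ℕ
lis x = maxL (map length (filterᵇ incᵇ (subs x)))
lds x = maxL (map length (filterᵇ decᵇ (subs x)))

-- factor x_i ... x_j (1-indexed)
factor : ℕ → ℕ → List ℕ → List ℕ
factor i j x = take (suc j ∸ i) (drop (i ∸ 1) x)

open import Relation.Binary.PropositionalEquality using (_≡_)

_∼cid_ : List ℕ → List ℕ → Set
u ∼cid w = length u ≡ length w ×
  (∀ i j → 1 ≤ i → i ≤ j → j ≤ length u →
     lis (factor i j u) ≡ lis (factor i j w) × lds (factor i j u) ≡ lds (factor i j w))

restrict : ℕ → ℕ → List ℕ → List ℕ
restrict a b = filterᵇ (λ x → (a ≤ᵇ x) ∧ (x ≤ᵇ b))

-- letters are positive, so intervals [a,b] with a,b ∈ ℕ cover all cases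
_∼rid_ : List ℕ → List ℕ → Set
u ∼rid w = ∀ a b → lis (restrict a b u) ≡ lis (restrict a b w) × lds (restrict a b u) ≡ lds (restrict a b w)

deleteLetter : ℕ → List ℕ → List ℕ
deleteLetter a = filterᵇ (λ y → not (y ≡ᵇ a))

smallest largest : List ℕ → ℕ
smallest w = nthD (letters w) 0
largest  w = maxL w

prevOf : List ℕ → ℕ → ℕ
prevOf (v ∷ v' ∷ rest) x = if x ≡ᵇ v' then v else prevOf (v' ∷ rest) x
prevOf _ x = x

delMinShift : List ℕ → List ℕ
delMinShift w = map (prevOf (letters w)) (deleteLetter (smallest w) w)

open import Data.List.Relation.Unary.All using (All)

IsWord : ℕ → List ℕ → Set
IsWord n w = length w ≡ n × All (λ a → 1 ≤ a) w

{-# OPTIONS --safe #-}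
module Submission where

-- Let G i a be the shape occupied by M_i and the letters ≤ a of w after the levels > i of M_{n-1}
-- have been slid past w. These shapes form a growth diagram
-- whose squares obey a local rule that is an involution and commutes with transposition. The left
-- and top edges are M_{n-1} and w, the bottom and right edges are 𝒲(w) and ℳ(w).
--
-- Longest chains in the lower rows of the skew tableaux at two consecutive levels satisfy a
-- recursion that involves the shapes at the current column only (Λ-transport). In the full set of
-- rows it says that lis is invariant on every interval of letters, so that 𝒲(w) and the promotion
-- slide give ∼rid. Between two given rows it computes, in the last column, lis of every factor of
-- w from ℳ(w) alone, which gives ∼cid. For lds one transposes.
--
-- The 0-Hecke product of the rows of the level tableau is the same in all columns. Hence every
-- diagram with right edge ℳ(w) has left edge M_{n-1}, and (∂𝒲(w) , ℳ(w)) comes from a word.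
-- Injectivity of R holds because the local rule can be reversed; surjectivity because the orbits
-- of R are finite.

open import Defs
open import Data.Nat
open import Data.Nat.Properties
open import Data.Bool using (Bool; T?; true; false; _∧_; _∨_; not; if_then_else_)
open import Data.Bool.Properties using (not-involutive; T-≡; ∧-zeroʳ)
open import Data.Bool.ListAction using (any; all)
open import Data.List using (List; []; _∷_; _++_; map; filterᵇ; foldl; length; upTo; applyUpTo; reverse; zip; take; drop; lookup)
open import Data.List.Properties
  using (foldl-∷ʳ; upTo-∷ʳ; unfold-reverse; map-++; reverse-++; length-applyUpTo; take-map; drop-map; reverse-map;
         length-map; take++drop≡id; length-drop; length-take; length-reverse; reverse-involutive; ++-identityʳ)
open import Data.List.Membership.Propositional using (_∈_; find; lose)
open import Data.List.Membership.Propositional.Properties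
  using (∈-map⁺; ∈-map⁻; ∈-++⁺ˡ; ∈-++⁺ʳ; ∈-++⁻; ∈-upTo⁺; ∈-upTo⁻; ∈-concatMap⁺; ∈-concatMap⁻)
open import Data.List.Relation.Unary.Any using (here; there)
import Data.List.Relation.Unary.Any as Any
open import Data.List.Relation.Unary.All using (All; []; _∷_)
open import Data.List.Relation.Unary.AllPairs using (AllPairs; []; _∷_)
open import Data.List.Relation.Binary.Sublist.Propositional using (_⊆_; []; _∷_; _∷ʳ_)
import Data.List.Relation.Unary.Any.Properties as AnyP
import Data.List.Relation.Unary.All as All
import Data.List.Relation.Unary.All.Properties as AllP
import Data.List.Relation.Unary.AllPairs.Properties as AllPairsP
import Data.List.Relation.Binary.Sublist.Heterogeneous.Properties as Sublist
open import Data.Product using (_×_; _,_; proj₁; proj₂; ∃)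
open import Data.Sum using (_⊎_; inj₁; inj₂)
open import Data.Empty using (⊥; ⊥-elim)
open import Data.Fin using (Fin; toℕ; fromℕ<)
import Data.Fin as Fin
import Data.Fin.Properties as FinP
open import Function using (_∘_; case_of_)
open import Function.Bundles using (Equivalence; _⇔_; mk⇔)
open import Relation.Binary.Definitions using (tri<; tri≈; tri>)
open import Relation.Binary.PropositionalEquality hiding (J)
open import Relation.Nullary using (¬_; yes; no)
import Relation.Nullary

-- Rectification of increasing tableaux by jeu de taquin is not unique in general: a diagram filled
-- from the bottom edge ∂𝒲(w) and the right edge ℳ(w) could a priori have another left edge than
-- M_{n-1} and so belong to no word. The 0-Hecke product decides the matter because the staircase is
-- filled as densely as strips from the empty shape allow: row `s`, counted from 0, can gain a box
-- between levels `v` and `v + 1` only if `s ≤ v`, and M gains one at all these places. A missing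
-- gain therefore shows up on a suitable sequence of bits.
--
-- The recursion for chains needs a boundary value in the lowest row that is used. With all rows it
-- is zero. For a factor of w the cut moves with the level: row `j` of σ_{p+j} has length p for
-- every j, so the lowest row always starts in the same column, and the chains inside it are
-- differences of row lengths. At j = 0 the cut is a single row, whose length is read off ℳ(w); each
-- further level adds a row, until level m gives the factor.

true≢false : true ≡ false → ⊥
true≢false ()

absurd : {A : Set} {b : Bool} → b ≡ true → b ≡ false → A
absurd p q = ⊥-elim (true≢false (trans (sym p) q))

bool-cases : (b : Bool) → b ≡ true ⊎ b ≡ false
bool-cases true  = inj₁ refl
bool-cases false = inj₂ refl

∧-true : {a b : Bool} → a ∧ b ≡ true → a ≡ true × b ≡ true
∧-true {true} {true} _ = refl , refl

∧-intro : {a b : Bool} → a ≡ true → b ≡ true → a ∧ b ≡ true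
∧-intro refl refl = refl

∨-true : {a b : Bool} → a ∨ b ≡ true → a ≡ true ⊎ b ≡ true
∨-true {true}  _ = inj₁ refl
∨-true {false} p = inj₂ p

∨-introˡ : {a b : Bool} → a ≡ true → a ∨ b ≡ true
∨-introˡ refl = refl

∨-introʳ : {a b : Bool} → b ≡ true → a ∨ b ≡ true
∨-introʳ {true}  refl = refl
∨-introʳ {false} refl = refl

not-true : {a : Bool} → not a ≡ true → a ≡ false
not-true {false} _ = refl

¬true⇒false : {a : Bool} → ¬ (a ≡ true) → a ≡ false
¬true⇒false {true}  h = ⊥-elim (h refl)
¬true⇒false {false} h = refl

-- Growth diagrams

-- A shape contains row 0 and column 0, so that no box of a skew shape lies there
-- and the boundary of the quadrant needs no special treatment.

Shape : Set
Shape = ℕ → ℕ → Bool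

at : Shape → Box → Bool
at S (r , c) = S r c

data Adj : Box → Box → Set where
  toRight : ∀ {r c} → Adj (r , c) (r , suc c)
  toLeft  : ∀ {r c} → Adj (r , suc c) (r , c)
  toBelow : ∀ {r c} → Adj (r , c) (suc r , c)
  toAbove : ∀ {r c} → Adj (suc r , c) (r , c)

Adj-sym : ∀ {b b'} → Adj b b' → Adj b' b
Adj-sym toRight = toLeft
Adj-sym toLeft  = toRight
Adj-sym toBelow = toAbove
Adj-sym toAbove = toBelow

record Partition (S : Shape) : Set where
  field
    row0   : ∀ c → S 0 c ≡ true
    col0   : ∀ r → S r 0 ≡ true
    upward : ∀ r c → S (suc r) c ≡ true → S r c ≡ true
    leftward : ∀ r c → S r (suc c) ≡ true → S r c ≡ true

open Partition

_⊆ˢ_ : Shape → Shape → Set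
S ⊆ˢ S' = ∀ b → at S b ≡ true → at S' b ≡ true

_≐_ : Shape → Shape → Set
S ≐ S' = ∀ r c → S r c ≡ S' r c

Diff : Shape → Shape → Box → Set
Diff β γ b = at γ b ≡ true × at β b ≡ false

record Strip (β α : Shape) : Set where
  field
    sub  : β ⊆ˢ α
    rook : ∀ {b b'} → Adj b b' → Diff β α b → Diff β α b' → ⊥

open Strip

-- The local rule of the growth diagrams: inside the union γ/β of two consecutive strips, the
-- boxes of components with at least two boxes keep their order and isolated boxes change place.
record Square (β α γ δ : Shape) : Set where
  field
    βα : Strip β α
    αγ : Strip α γ
    βδ : Strip β δ
    δγ : Strip δ γ
    linked : ∀ {b b'} → Adj b b' → Diff β γ b → Diff β γ b' → at δ b ≡ at α b
    isolated : ∀ {b} → Diff β γ b → (∀ b' → Adj b b' → ¬ Diff β γ b') → at δ b ≡ not (at α b)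

open Square

Square-sym : ∀ {β α γ δ} → Square β α γ δ → Square β δ γ α
Square-sym q = record
  { βα = βδ q ; αγ = δγ q ; βδ = βα q ; δγ = αγ q
  ; linked = λ a d d' → sym (linked q a d d')
  ; isolated = λ d h → trans (sym (not-involutive _)) (cong not (sym (isolated q d h))) }

transpose : Shape → Shape
transpose S r c = S c r

swapBox : Box → Box
swapBox (r , c) = (c , r)

Adj-swap : ∀ {b b'} → Adj b b' → Adj (swapBox b) (swapBox b')
Adj-swap toRight = toBelow
Adj-swap toLeft  = toAbove
Adj-swap toBelow = toRight
Adj-swap toAbove = toLeft

Partition-transpose : ∀ {S} → Partition S → Partition (transpose S)
Partition-transpose p = record
  { row0 = col0 p ; col0 = row0 p
  ; upward = λ r c → leftward p c r ; leftward = λ r c → upward p c r }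

Strip-transpose : ∀ {β α} → Strip β α → Strip (transpose β) (transpose α)
Strip-transpose s = record
  { sub = λ { (r , c) → sub s (c , r) }
  ; rook = λ { {r , c} {r' , c'} a d d' → rook s (Adj-swap a) d d' } }

Square-transpose : ∀ {β α γ δ} → Square β α γ δ →
  Square (transpose β) (transpose α) (transpose γ) (transpose δ)
Square-transpose q = record
  { βα = Strip-transpose (βα q) ; αγ = Strip-transpose (αγ q)
  ; βδ = Strip-transpose (βδ q) ; δγ = Strip-transpose (δγ q)
  ; linked = λ { {r , c} {r' , c'} a d d' → linked q (Adj-swap a) d d' }
  ; isolated = λ { {r , c} d h → isolated q d (λ { (r' , c') a d' → h (c' , r') (Adj-swap a) d' }) } }

diffᵇ : Shape → Shape → Shape
diffᵇ β γ r c = γ r c ∧ not (β r c)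

diffᵇ-sound : ∀ β γ b → at (diffᵇ β γ) b ≡ true → Diff β γ b
diffᵇ-sound β γ (r , c) h with ∧-true {γ r c} h
... | p , q = p , not-true q

diffᵇ-complete : ∀ β γ b → Diff β γ b → at (diffᵇ β γ) b ≡ true
diffᵇ-complete β γ (r , c) (p , q) rewrite p | q = refl

-- Index 0 has no predecessor, so `hasNeighbour` sees no box beyond the edge of the quadrant.
before : (ℕ → Bool) → ℕ → Bool
before f zero    = false
before f (suc n) = f n

hasNeighbour : Shape → Shape
hasNeighbour D r c = D r (suc c) ∨ D (suc r) c ∨ before (λ r' → D r' c) r ∨ before (D r) c

hasNeighbour-sound : ∀ D b → at (hasNeighbour D) b ≡ true → ∃ λ b' → Adj b b' × at D b' ≡ true
hasNeighbour-sound D (r , c) h with ∨-true {D r (suc c)} h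
... | inj₁ p = _ , toRight , p
... | inj₂ h₁ with ∨-true {D (suc r) c} h₁
...   | inj₁ p = _ , toBelow , p
...   | inj₂ h₂ with ∨-true {before (λ r' → D r' c) r} h₂
hasNeighbour-sound D (suc r , c) h | inj₂ h₁ | inj₂ h₂ | inj₁ p = _ , toAbove , p
hasNeighbour-sound D (r , suc c) h | inj₂ h₁ | inj₂ h₂ | inj₂ p = _ , toLeft , p

hasNeighbour-complete : ∀ D {b b'} → Adj b b' → at D b' ≡ true → at (hasNeighbour D) b ≡ true
hasNeighbour-complete D {r , c} toRight p = ∨-introˡ p
hasNeighbour-complete D {r , c} toBelow p = ∨-introʳ {D r (suc c)} (∨-introˡ p)
hasNeighbour-complete D {suc r , c} toAbove p =
  ∨-introʳ {D (suc r) (suc c)} (∨-introʳ {D (suc (suc r)) c} (∨-introˡ p))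
hasNeighbour-complete D {r , suc c} toLeft p =
  ∨-introʳ {D r (suc (suc c))} (∨-introʳ {D (suc r) (suc c)} (∨-introʳ {before (λ r' → D r' (suc c)) r} p))

neighbour? : ∀ β γ b → (∃ λ b' → Adj b b' × Diff β γ b') ⊎ (∀ b' → Adj b b' → ¬ Diff β γ b')
neighbour? β γ b with bool-cases (at (hasNeighbour (diffᵇ β γ)) b)
... | inj₁ h with hasNeighbour-sound (diffᵇ β γ) b h
...   | b' , a , d = inj₁ (b' , a , diffᵇ-sound β γ b' d)
neighbour? β γ b | inj₂ h =
  inj₂ λ b' a d → absurd (hasNeighbour-complete (diffᵇ β γ) a (diffᵇ-complete β γ b' d)) h

-- `Square` is a relation; this is the solution for δ, the only one by `Square-unique`.
switch : Shape → Shape → Shape → Shape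
switch β α γ r c =
  β r c ∨ (γ r c ∧ (if hasNeighbour (diffᵇ β γ) r c then α r c else not (α r c)))

switch-diff : ∀ β α γ b → Diff β γ b → at (switch β α γ) b ≡
  (if at (hasNeighbour (diffᵇ β γ)) b then at α b else not (at α b))
switch-diff β α γ (r , c) (p , q) rewrite p | q = refl

switch-old : ∀ β α γ b → at β b ≡ true → at (switch β α γ) b ≡ true
switch-old β α γ (r , c) p rewrite p = refl

Diff-widenˡ : ∀ {β α γ b} → Strip α γ → Diff β α b → Diff β γ b
Diff-widenˡ {b = b} s (p , q) = sub s b p , q

Diff-widenʳ : ∀ {β α γ b} → Strip β α → Diff α γ b → Diff β γ b
Diff-widenʳ {β} {b = b} s (p , q) = p , ¬true⇒false (λ h → absurd (sub s b h) q)

module Switch {β α γ : Shape} (pβ : Partition β) (pα : Partition α) (pγ : Partition γ)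
              (s₁ : Strip β α) (s₂ : Strip α γ) where

  private δ = switch β α γ

  switch-linked : ∀ {b b'} → Adj b b' → Diff β γ b → Diff β γ b' → at δ b ≡ at α b
  switch-linked {b} {b'} a d d' =
    trans (switch-diff β α γ b d)
          (cong (λ x → if x then at α b else not (at α b))
                (hasNeighbour-complete (diffᵇ β γ) a (diffᵇ-complete β γ b' d')))

  switch-isolated : ∀ {b} → Diff β γ b → (∀ b' → Adj b b' → ¬ Diff β γ b') → at δ b ≡ not (at α b)
  switch-isolated {b} d h with bool-cases (at (hasNeighbour (diffᵇ β γ)) b)
  ... | inj₁ p with hasNeighbour-sound (diffᵇ β γ) b p
  ...   | b' , a , d' = ⊥-elim (h b' a (diffᵇ-sound β γ b' d'))
  switch-isolated {b} d h | inj₂ p =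
    trans (switch-diff β α γ b d) (cong (λ x → if x then at α b else not (at α b)) p)

  switch-⊆ : δ ⊆ˢ γ
  switch-⊆ b h with bool-cases (at β b)
  ... | inj₁ p = sub s₂ b (sub s₁ b p)
  switch-⊆ (r , c) h | inj₂ p rewrite p = proj₁ (∧-true {γ r c} h)

  -- Two adjacent boxes of γ/β are both linked, so δ copies α on both and inherits from α that it is
  -- closed under moving up or left.
  switch-step : ∀ {b b'} → Adj b' b → at δ b' ≡ true → (at β b' ≡ true → at β b ≡ true) →
    (at α b' ≡ true → at α b ≡ true) → (at γ b' ≡ true → at γ b ≡ true) → at δ b ≡ true
  switch-step {b} {b'} a h hβ hα hγ with bool-cases (at β b)
  ... | inj₁ p = switch-old β α γ b p
  ... | inj₂ p = trans (switch-linked (Adj-sym a) d d') (hα (trans (sym (switch-linked a d' d)) h))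
    where
    g' = switch-⊆ b' h
    d = hγ g' , p
    d' = g' , ¬true⇒false (λ q → absurd (hβ q) p)

  switch-partition : Partition δ
  switch-partition = record
    { row0 = λ c → switch-old β α γ (0 , c) (row0 pβ c)
    ; col0 = λ r → switch-old β α γ (r , 0) (col0 pβ r)
    ; upward = λ r c h → switch-step {r , c} {suc r , c} toAbove h (upward pβ r c) (upward pα r c) (upward pγ r c)
    ; leftward = λ r c h → switch-step {r , c} {r , suc c} toLeft h (leftward pβ r c) (leftward pα r c) (leftward pγ r c) }

  switch-strip₁ : Strip β δ
  switch-strip₁ = record
    { sub = switch-old β α γ
    ; rook = λ { {b} {b'} a (p , q) (p' , q') →
        let d = switch-⊆ b p , q ; d' = switch-⊆ b' p' , q' in
        rook s₁ a (trans (sym (switch-linked a d d')) p , q)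
                  (trans (sym (switch-linked (Adj-sym a) d' d)) p' , q') } }

  switch-strip₂ : Strip δ γ
  switch-strip₂ = record
    { sub = switch-⊆
    ; rook = λ { {b} {b'} a (p , q) (p' , q') →
        let d = p , ¬true⇒false (λ h → absurd (switch-old β α γ b h) q)
            d' = p' , ¬true⇒false (λ h → absurd (switch-old β α γ b' h) q') in
        rook s₂ a (p , trans (sym (switch-linked a d d')) q)
                  (p' , trans (sym (switch-linked (Adj-sym a) d' d)) q') } }

  switch-square : Square β α γ δ
  switch-square = record
    { βα = s₁ ; αγ = s₂ ; βδ = switch-strip₁ ; δγ = switch-strip₂
    ; linked = switch-linked ; isolated = switch-isolated }

Diff-cong : ∀ {β β' γ γ'} → β ≐ β' → γ ≐ γ' → ∀ {b} → Diff β γ b → Diff β' γ' b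
Diff-cong e f {r , c} (p , q) = trans (sym (f r c)) p , trans (sym (e r c)) q

≐-sym : ∀ {S S'} → S ≐ S' → S' ≐ S
≐-sym e r c = sym (e r c)

≐-trans : ∀ {S S' S''} → S ≐ S' → S' ≐ S'' → S ≐ S''
≐-trans e f r c = trans (e r c) (f r c)

≐-at : ∀ {S S'} → S ≐ S' → ∀ b → at S b ≡ at S' b
≐-at e (r , c) = e r c

Strip-cong : ∀ {β β' α α'} → β ≐ β' → α ≐ α' → Strip β α → Strip β' α'
Strip-cong e f s = record
  { sub = λ b h → trans (sym (≐-at f b)) (sub s b (trans (≐-at e b) h))
  ; rook = λ a d d' → rook s a (Diff-cong (≐-sym e) (≐-sym f) d) (Diff-cong (≐-sym e) (≐-sym f) d') }

Square-cong : ∀ {β β' α α' γ γ' δ δ'} → β ≐ β' → α ≐ α' → γ ≐ γ' → δ ≐ δ' →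
  Square β α γ δ → Square β' α' γ' δ'
Square-cong e f g h q = record
  { βα = Strip-cong e f (βα q) ; αγ = Strip-cong f g (αγ q)
  ; βδ = Strip-cong e h (βδ q) ; δγ = Strip-cong h g (δγ q)
  ; linked = λ {b} a d d' → trans (sym (≐-at h b))
      (trans (linked q a (Diff-cong (≐-sym e) (≐-sym g) d) (Diff-cong (≐-sym e) (≐-sym g) d')) (≐-at f b))
  ; isolated = λ {b} d n → trans (sym (≐-at h b))
      (trans (isolated q (Diff-cong (≐-sym e) (≐-sym g) d) (λ b' a d' → n b' a (Diff-cong e g d')))
             (cong not (≐-at f b))) }

Square-unique : ∀ {β α γ δ δ'} → Square β α γ δ → Square β α γ δ' → δ ≐ δ'
Square-unique {β} {α} {γ} {δ} {δ'} q q' r c with bool-cases (β r c) | bool-cases (γ r c)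
... | inj₁ p | _ = trans (sub (βδ q) (r , c) p) (sym (sub (βδ q') (r , c) p))
... | inj₂ p | inj₂ g =
  trans (¬true⇒false (λ h → absurd (sub (δγ q) (r , c) h) g))
        (sym (¬true⇒false (λ h → absurd (sub (δγ q') (r , c) h) g)))
... | inj₂ p | inj₁ g with neighbour? β γ (r , c)
...   | inj₁ (b' , a , d) = trans (linked q a (g , p) d) (sym (linked q' a (g , p) d))
...   | inj₂ h = trans (isolated q (g , p) h) (sym (isolated q' (g , p) h))

-- No letter is lost when it passes a level. A box of γ/α that is isolated in γ/β lies in δ itself.
-- Otherwise its neighbour lies in α, because γ/α has no two adjacent boxes, and being linked it
-- lies in δ.
Square-nonempty : ∀ {β α γ δ} → Square β α γ δ → ∃ (Diff α γ) → ∃ (Diff β δ)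
Square-nonempty {β} {α} {γ} {δ} q (b , p , p') with neighbour? β γ b
... | inj₂ h = b , trans (isolated q d h) (cong not p') , proj₂ d
  where d = Diff-widenʳ {β} {α} {γ} {b} (βα q) (p , p')
... | inj₁ (b' , a , d'@(g , e)) = b' , trans (linked q (Adj-sym a) d' d) α-b' , e
  where
  d = Diff-widenʳ {β} {α} {γ} {b} (βα q) (p , p')
  α-b' : at α b' ≡ true
  α-b' with bool-cases (at α b')
  ... | inj₁ x = x
  ... | inj₂ x = ⊥-elim (rook (αγ q) a (p , p') (g , x))

-- Boxes are numbered from 1, so that Bounded n S means that S lies in the staircase (n , … , 1).
Bounded : ℕ → Shape → Set
Bounded n S = ∀ r c → S (suc r) (suc c) ≡ true → suc (r + c) ≤ n

record Growth (n m k : ℕ) (G : ℕ → ℕ → Shape) : Set where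
  field
    part : ∀ {i a} → i ≤ m → a ≤ k → Partition (G i a)
    bdd  : ∀ {i a} → i ≤ m → a ≤ k → Bounded n (G i a)
    letter : ∀ {i a} → i ≤ m → a < k → Strip (G i a) (G i (suc a))
    level  : ∀ {i a} → i < m → a ≤ k → Strip (G i a) (G (suc i) a)
    sq   : ∀ {i a} → i < m → a < k → Square (G i a) (G (suc i) a) (G (suc i) (suc a)) (G i (suc a))

Growth-transpose : ∀ {n m k G} → Growth n m k G → Growth n m k (λ i a → transpose (G i a))
Growth-transpose {n} g = record
  { part = λ p q → Partition-transpose (Growth.part g p q)
  ; bdd = λ p q r c h → subst (λ z → suc z ≤ n) (+-comm c r) (Growth.bdd g p q c r h)
  ; letter = λ p q → Strip-transpose (Growth.letter g p q)
  ; level = λ p q → Strip-transpose (Growth.level g p q)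
  ; sq = λ p q → Square-transpose (Growth.sq g p q) }

-- Filling a diagram from two of its edges

build : (X Y : ℕ → Shape) → ℕ → ℕ → Shape
build X Y zero a = X a
build X Y (suc j) zero = Y (suc j)
build X Y (suc j) (suc a) = switch (build X Y (suc j) a) (build X Y j a) (build X Y j (suc a))

module Build (X Y : ℕ → Shape) (m k : ℕ)
             (pX : ∀ {a} → a ≤ k → Partition (X a)) (sX : ∀ {a} → a < k → Strip (X a) (X (suc a)))
             (pY : ∀ {j} → suc j ≤ m → Partition (Y (suc j)))
             (sY : ∀ {j} → j < m → Strip (Y (suc j)) (build X Y j 0)) where

  mutual
    build-part : ∀ {j a} → j ≤ m → a ≤ k → Partition (build X Y j a)
    build-part {zero} _ q = pX q
    build-part {suc j} {zero} p q = pY p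
    build-part {suc j} {suc a} p q =
      Switch.switch-partition (build-part {suc j} {a} p (<⇒≤ q)) (build-part {j} {a} (<⇒≤ p) (<⇒≤ q))
        (build-part {j} {suc a} (<⇒≤ p) q) (build-left {j} {a} p (<⇒≤ q)) (build-up {j} {a} (<⇒≤ p) q)

    build-left : ∀ {j a} → j < m → a ≤ k → Strip (build X Y (suc j) a) (build X Y j a)
    build-left {j} {zero} p q = sY p
    build-left {j} {suc a} p q =
      Switch.switch-strip₂ (build-part {suc j} {a} p (<⇒≤ q)) (build-part {j} {a} (<⇒≤ p) (<⇒≤ q))
        (build-part {j} {suc a} (<⇒≤ p) q) (build-left {j} {a} p (<⇒≤ q)) (build-up {j} {a} (<⇒≤ p) q)

    build-up : ∀ {j a} → j ≤ m → a < k → Strip (build X Y j a) (build X Y j (suc a))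
    build-up {zero} p q = sX q
    build-up {suc j} {a} p q =
      Switch.switch-strip₁ (build-part {suc j} {a} p (<⇒≤ q)) (build-part {j} {a} (<⇒≤ p) (<⇒≤ q))
        (build-part {j} {suc a} (<⇒≤ p) q) (build-left {j} {a} p (<⇒≤ q)) (build-up {j} {a} (<⇒≤ p) q)

  build-square : ∀ {j a} → j < m → a < k →
    Square (build X Y (suc j) a) (build X Y j a) (build X Y j (suc a)) (build X Y (suc j) (suc a))
  build-square {j} {a} p q =
    Switch.switch-square (build-part {suc j} {a} p (<⇒≤ q)) (build-part {j} {a} (<⇒≤ p) (<⇒≤ q))
      (build-part {j} {suc a} (<⇒≤ p) q) (build-left {j} {a} p (<⇒≤ q)) (build-up {j} {a} (<⇒≤ p) q)

  build-⊆ : ∀ {j a} → j ≤ m → a ≤ k → build X Y j a ⊆ˢ X k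
  build-⊆ {zero} {a} p q b h = go (k ∸ a) a (m+[n∸m]≡n q) h
    where
    go : ∀ d a → a + d ≡ k → at (X a) b ≡ true → at (X k) b ≡ true
    go zero a e h = subst (λ z → at (X z) b ≡ true) (trans (sym (+-identityʳ a)) e) h
    go (suc d) a e h = go d (suc a) (trans (sym (+-suc a d)) e)
      (sub (sX (subst (suc a ≤_) e (subst (suc a ≤_) (sym (+-suc a d)) (s≤s (m≤m+n a d))))) b h)
  build-⊆ {suc j} {a} p q b h = build-⊆ {j} {a} (<⇒≤ p) q b (sub (build-left {j} {a} p q) b h)

  build-bdd : ∀ {n} → Bounded n (X k) → ∀ {j a} → j ≤ m → a ≤ k → Bounded n (build X Y j a)
  build-bdd b {j} {a} p q r c h = b r c (build-⊆ {j} {a} p q (suc r , suc c) h)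

  private
    ∸-suc : ∀ {i m'} → i < m' → m' ∸ i ≡ suc (m' ∸ suc i)
    ∸-suc h = +-∸-assoc 1 h

  -- `build` counts `j` downwards from the given edge `X`, whereas the levels of a diagram count
  -- upwards; hence `m ∸ i`.
  growth-from-top : ∀ {n} → Bounded n (X k) → Growth n m k (λ i a → build X Y (m ∸ i) a)
  growth-from-top b = record
    { part = λ {i} {a} p q → build-part {m ∸ i} {a} (m∸n≤m m i) q
    ; bdd = λ {i} {a} p q → build-bdd b {m ∸ i} {a} (m∸n≤m m i) q
    ; letter = λ {i} {a} p q → build-up {m ∸ i} {a} (m∸n≤m m i) q
    ; level = λ {i} {a} p q → subst (λ j → Strip (build X Y j a) (build X Y (m ∸ suc i) a)) (sym (∸-suc p))
        (build-left {m ∸ suc i} {a} (≤-trans (≤-reflexive (sym (∸-suc p))) (m∸n≤m m i)) q)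
    ; sq = λ {i} {a} p q → subst (λ j → Square (build X Y j a) (build X Y (m ∸ suc i) a)
                                   (build X Y (m ∸ suc i) (suc a)) (build X Y j (suc a))) (sym (∸-suc p))
        (build-square {m ∸ suc i} {a} (≤-trans (≤-reflexive (sym (∸-suc p))) (m∸n≤m m i)) q) }

  -- The same array with its two directions exchanged: `X` is now the right edge and `Y` the bottom
  -- one. `Square-sym` makes up for the exchange of α and δ.
  growth-from-right : ∀ {n} → Bounded n (X k) → Growth n k m (λ i a → build X Y (m ∸ a) i)
  growth-from-right b = record
    { part = λ {i} {a} p q → build-part {m ∸ a} {i} (m∸n≤m m a) p
    ; bdd = λ {i} {a} p q → build-bdd b {m ∸ a} {i} (m∸n≤m m a) p
    ; letter = λ {i} {a} p q → subst (λ j → Strip (build X Y j i) (build X Y (m ∸ suc a) i)) (sym (∸-suc q))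
        (build-left {m ∸ suc a} {i} (≤-trans (≤-reflexive (sym (∸-suc q))) (m∸n≤m m a)) p)
    ; level = λ {i} {a} p q → build-up {m ∸ a} {i} (m∸n≤m m a) p
    ; sq = λ {i} {a} p q → subst (λ j → Square (build X Y j i) (build X Y j (suc i))
                                   (build X Y (m ∸ suc a) (suc i)) (build X Y (m ∸ suc a) i)) (sym (∸-suc q))
        (Square-sym (build-square {m ∸ suc a} {i} (≤-trans (≤-reflexive (sym (∸-suc q))) (m∸n≤m m a)) p)) }

-- Row lengths

-- The index s stands for row s + 1.

record Lens (S : Shape) (ℓ : ℕ → ℕ) : Set where
  field
    sound    : ∀ s c → c ≤ ℓ s → S (suc s) c ≡ true
    complete : ∀ s c → S (suc s) c ≡ true → c ≤ ℓ s

  outside : ∀ s c → ℓ s < c → S (suc s) c ≡ false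
  outside s c h = ¬true⇒false (λ p → <⇒≱ h (complete s c p))

lenUpTo : Shape → ℕ → ℕ → ℕ
lenUpTo S zero s = 0
lenUpTo S (suc c) s = if S (suc s) (suc c) then suc c else lenUpTo S c s

leftwards : ∀ {S} → Partition S → ∀ r {c d} → c ≤ d → S r d ≡ true → S r c ≡ true
leftwards p r {c} {d} c≤d h with m≤n⇒m<n∨m≡n c≤d
... | inj₂ refl = h
leftwards p r {c} {suc d} _ h | inj₁ (s≤s c≤d) = leftwards p r c≤d (leftward p r d h)

lenUpTo-sound : ∀ {S} → Partition S → ∀ N s c → c ≤ lenUpTo S N s → S (suc s) c ≡ true
lenUpTo-sound p zero s zero h = col0 p (suc s)
lenUpTo-sound {S} p (suc N) s c h with S (suc s) (suc N) in e
... | true  = leftwards p (suc s) h e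
... | false = lenUpTo-sound p N s c h

lenUpTo-complete : ∀ S N s c → S (suc s) c ≡ true → c ≤ N → c ≤ lenUpTo S N s
lenUpTo-complete S zero s c h c≤ = c≤
lenUpTo-complete S (suc N) s c h c≤ with S (suc s) (suc N) in e
... | true  = c≤
... | false with m≤n⇒m<n∨m≡n c≤
...   | inj₁ (s≤s q) = lenUpTo-complete S N s c h q
...   | inj₂ refl = absurd h e

Lens-of : ∀ {n S} → Partition S → Bounded n S → Lens S (lenUpTo S n)
Lens-of {n} {S} p b = record
  { sound = lenUpTo-sound p n
  ; complete = λ { s zero h → z≤n
                 ; s (suc c) h → lenUpTo-complete S n s (suc c) h (≤-trans (s≤s (m≤n+m c s)) (b s c h)) } }

Lens-zero : ∀ {n S ℓ} → Bounded n S → Lens S ℓ → ∀ s → n ≤ s → ℓ s ≡ 0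
Lens-zero {n} {S} {ℓ} b l s n≤s = go (ℓ s) refl
  where
  go : ∀ x → ℓ s ≡ x → ℓ s ≡ 0
  go zero e = e
  go (suc x) e = ⊥-elim (<⇒≱ (b s x (Lens.sound l s (suc x) (≤-reflexive (sym e))))
                             (≤-trans n≤s (m≤m+n s x)))

Lens-cong : ∀ {S S' ℓ ℓ'} → S ≐ S' → Lens S ℓ → Lens S' ℓ' → ∀ s → ℓ s ≡ ℓ' s
Lens-cong {ℓ = ℓ} {ℓ'} e l l' s = ≤-antisym
  (Lens.complete l' s (ℓ s) (trans (sym (e (suc s) (ℓ s))) (Lens.sound l s (ℓ s) ≤-refl)))
  (Lens.complete l s (ℓ' s) (trans (e (suc s) (ℓ' s)) (Lens.sound l' s (ℓ' s) ≤-refl)))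

-- The consequences of the local rule in terms of row lengths. With β, α on levels `i`, `i + 1`
-- before a letter and δ, γ after it, `entering` and `leaving` follow the letter from level `i + 1`
-- to level `i`: it enters row `s` from the row below, or leaves it to the row above. Both happen
-- inside a vertical pair of boxes of γ/β, whence the equalities of lengths. In `passing` such a
-- pair is given, and the letter has to be in its upper row at level `i`.
record RowSquare (β α γ δ : ℕ → ℕ) : Set where
  field
    stepβα : ∀ s → α s ≡ β s ⊎ α s ≡ suc (β s)
    stepαγ : ∀ s → γ s ≡ α s ⊎ γ s ≡ suc (α s)
    stepβδ : ∀ s → δ s ≡ β s ⊎ δ s ≡ suc (β s)
    stepδγ : ∀ s → γ s ≡ δ s ⊎ γ s ≡ suc (δ s)
    interβα : ∀ s → α (suc s) ≤ β s
    interαγ : ∀ s → γ (suc s) ≤ α s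
    interβδ : ∀ s → δ (suc s) ≤ β s
    interδγ : ∀ s → γ (suc s) ≤ δ s
    entering : ∀ s → δ s ≡ suc (β s) → γ s ≡ α s → α s ≡ suc (β s) × γ (suc s) ≡ α s
    leaving  : ∀ s → γ s ≡ suc (α s) → δ s ≡ β s →
      ∃ λ s' → s ≡ suc s' × α s' ≡ suc (β s') × γ s ≡ α s' × δ s' ≡ α s'
    passing  : ∀ s → α s ≡ suc (β s) → γ (suc s) ≡ α s → δ s ≡ suc (β s)

module _ {β α : Shape} {b a : ℕ → ℕ} (pβ : Partition β) (p : Partition α) (lβ : Lens β b) (lα : Lens α a) (st : Strip β α) where

  strip-step : ∀ s → a s ≡ b s ⊎ a s ≡ suc (b s)
  strip-step s with m≤n⇒m<n∨m≡n b≤a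
    where b≤a = Lens.complete lα s (b s) (sub st (suc s , b s) (Lens.sound lβ s (b s) ≤-refl))
  ... | inj₂ e = inj₁ (sym e)
  ... | inj₁ lt with m≤n⇒m<n∨m≡n lt
  ...   | inj₂ e = inj₂ (sym e)
  ...   | inj₁ lt' = ⊥-elim (rook st {suc s , suc (b s)} {suc s , suc (suc (b s))} toRight
    (Lens.sound lα s _ lt , Lens.outside lβ s _ ≤-refl)
    (Lens.sound lα s _ lt' , Lens.outside lβ s _ (n≤1+n _)))

  -- Otherwise the boxes of rows `s` and `s + 1` in column `a (suc s)` would both be new, and they
  -- are adjacent.
  strip-inter : ∀ s → a (suc s) ≤ b s
  strip-inter s with a (suc s) ≤? b s
  ... | yes q = q
  ... | no q = ⊥-elim (rook st {suc s , a (suc s)} {suc (suc s) , a (suc s)} toBelow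
    (upward p (suc s) _ in-α , notβ) (in-α , ¬true⇒false (λ h → q (Lens.complete lβ s _ (upward pβ (suc s) _ h)))))
    where
    in-α = Lens.sound lα (suc s) (a (suc s)) ≤-refl
    notβ = Lens.outside lβ s _ (≰⇒> q)

module _ {β α γ δ : Shape} {b a g d : ℕ → ℕ} (pβ : Partition β) (pα : Partition α) (pγ : Partition γ)
         (pδ : Partition δ) (lβ : Lens β b) (lα : Lens α a) (lγ : Lens γ g) (lδ : Lens δ d)
         (q : Square β α γ δ) where

  private
    box : ∀ s c → c ≤ g s → b s < c → Diff β γ (suc s , c)
    box s c h h' = Lens.sound lγ s c h , Lens.outside lβ s c h'

    δ-in : ∀ s c → δ (suc s) c ≡ true → b s < c → d s ≡ b s ⊎ d s ≡ suc (b s) → d s ≡ suc (b s)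
    δ-in s c h lt (inj₂ e) = e
    δ-in s c h lt (inj₁ e) = ⊥-elim (<⇒≱ lt (subst (c ≤_) e (Lens.complete lδ s c h)))

  square-rows : RowSquare b a g d
  square-rows = record
    { stepβα = strip-step pβ pα lβ lα (βα q) ; stepαγ = strip-step pα pγ lα lγ (αγ q)
    ; stepβδ = strip-step pβ pδ lβ lδ (βδ q) ; stepδγ = strip-step pδ pγ lδ lγ (δγ q)
    ; interβα = strip-inter pβ pα lβ lα (βα q) ; interαγ = strip-inter pα pγ lα lγ (αγ q)
    ; interβδ = strip-inter pβ pδ lβ lδ (βδ q) ; interδγ = strip-inter pδ pγ lδ lγ (δγ q)
    ; entering = entering ; leaving = leaving ; passing = passing }
    where
    -- The last box `x` of row `s` of δ lies in α as well, so it is not isolated in γ/β. Neighbours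
    -- to the right, to the left and above are excluded, so the box below it is in γ.
    entering : ∀ s → d s ≡ suc (b s) → g s ≡ a s → a s ≡ suc (b s) × g (suc s) ≡ a s
    entering s e e' with strip-step pβ pα lβ lα (βα q) s | strip-step pδ pγ lδ lγ (δγ q) s
    ... | inj₁ f | inj₁ f' = ⊥-elim (1+n≢n (trans (sym e) (trans (sym f') (trans e' f))))
    ... | inj₁ f | inj₂ f' = ⊥-elim (<⇒≢ (m<n⇒m<1+n (n<1+n (b s))) (trans (sym f) (trans (sym e') (trans f' (cong suc e)))))
    ... | inj₂ f | _ = f , ≤-antisym (strip-inter pα pγ lα lγ (αγ q) s) below-long
      where
      x = (suc s , suc (b s))
      dx : Diff β γ x
      dx = box s _ (≤-reflexive (sym (trans e' f))) ≤-refl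
      x∈α = Lens.sound lα s (suc (b s)) (≤-reflexive (sym f))
      x∈δ = Lens.sound lδ s (suc (b s)) (≤-reflexive (sym e))
      below-long : a s ≤ g (suc s)
      below-long with neighbour? β γ x
      ... | inj₂ h = absurd x∈δ (trans (isolated q dx h) (cong not x∈α))
      ... | inj₁ (_ , toBelow , (h , _)) = subst (_≤ g (suc s)) (sym f) (Lens.complete lγ (suc s) _ h)
      ... | inj₁ (_ , toRight , (h , _)) =
        ⊥-elim (<⇒≱ ≤-refl (subst (suc (suc (b s)) ≤_) (trans e' f) (Lens.complete lγ s _ h)))
      ... | inj₁ (_ , toLeft , (_ , h)) = absurd (Lens.sound lβ s (b s) ≤-refl) h
      ... | inj₁ (_ , toAbove , (_ , h)) =
        ⊥-elim (rook (βα q) {x} {s , suc (b s)} toAbove (x∈α , proj₂ dx) (upward pα s _ x∈α , h))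

    -- The new box of row `s` of γ is not in δ, hence not isolated. Neighbours to the right and
    -- below are excluded, and one on the left would lie in δ, against `d s ≡ b s`. So the neighbour
    -- is above.
    leaving : ∀ s → g s ≡ suc (a s) → d s ≡ b s →
      ∃ λ s' → s ≡ suc s' × a s' ≡ suc (b s') × g s ≡ a s' × d s' ≡ a s'
    leaving s e e' with neighbour? β γ (suc s , suc (a s))
    ... | inj₂ h = ⊥-elim (<⇒≱ (s≤s b≤a) (subst (suc (a s) ≤_) e' (Lens.complete lδ s _ x∈δ)))
      where
      b≤a = Lens.complete lα s (b s) (sub (βα q) (suc s , b s) (Lens.sound lβ s (b s) ≤-refl))
      x∈δ = trans (isolated q (box s _ (≤-reflexive (sym e)) (s≤s b≤a)) h) (cong not (Lens.outside lα s _ ≤-refl))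
    ... | inj₁ (_ , toRight , (h , _)) =
      ⊥-elim (<⇒≱ ≤-refl (subst (suc (suc (a s)) ≤_) e (Lens.complete lγ s _ h)))
    ... | inj₁ (_ , toBelow , (h , _)) = ⊥-elim (rook (αγ q) {suc s , suc (a s)} {suc (suc s) , suc (a s)} toBelow
      (Lens.sound lγ s _ (≤-reflexive (sym e)) , Lens.outside lα s _ ≤-refl)
      (h , ¬true⇒false (λ h' → absurd (upward pα _ _ h') (Lens.outside lα s _ ≤-refl))))
    ... | inj₁ (_ , toLeft , d₂@(h , h')) =
      ⊥-elim (<⇒≱ b<a (subst (a s ≤_) e' (Lens.complete lδ s _ y∈δ)))
      where
      b<a : b s < a s
      b<a = ≰⇒> (λ r → absurd (Lens.sound lβ s (a s) r) h')
      y∈δ : δ (suc s) (a s) ≡ true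
      y∈δ = trans (linked q {suc s , a s} {suc s , suc (a s)} toRight d₂
                    (box s _ (≤-reflexive (sym e)) (m<n⇒m<1+n b<a))) (Lens.sound lα s (a s) ≤-refl)
    leaving zero e e' | inj₁ (_ , toAbove , (_ , h)) = absurd (row0 pβ _) h
    leaving (suc s') e e' | inj₁ (_ , toAbove , d₂@(h , h')) =
      s' , refl , trans a≡ (cong suc (sym b≡)) , trans e (sym a≡) , trans d≡ (sym (trans a≡ (cong suc (sym b≡))))
      where
      s = suc s'
      c = suc (a s)
      x∉β : β (suc s) c ≡ false
      x∉β = ¬true⇒false (λ r → absurd (upward pβ _ _ r) h')
      x∈γ = Lens.sound lγ s c (≤-reflexive (sym e))
      y∈α : α (suc s') c ≡ true
      y∈α with bool-cases (α (suc s') c)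
      ... | inj₁ r = r
      ... | inj₂ r = ⊥-elim (rook (αγ q) {suc s , c} {suc s' , c} toAbove
        (x∈γ , Lens.outside lα s _ ≤-refl) (h , r))
      b<c : b s' < c
      b<c = ≰⇒> (λ r → absurd (Lens.sound lβ s' c r) h')
      c≤a = Lens.complete lα s' c y∈α
      a≤ : a s' ≤ suc (b s')
      a≤ with strip-step pβ pα lβ lα (βα q) s'
      ... | inj₁ r = ≤-trans (≤-reflexive r) (n≤1+n _)
      ... | inj₂ r = ≤-reflexive r
      a≡ : a s' ≡ c
      a≡ = ≤-antisym (≤-trans a≤ b<c) c≤a
      b≡ : b s' ≡ a s
      b≡ = ≤-antisym (s≤s⁻¹ b<c) (s≤s⁻¹ (≤-trans c≤a a≤))
      y∈δ : δ (suc s') c ≡ true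
      y∈δ = trans (linked q {suc s' , c} {suc s , c} toBelow d₂ (x∈γ , x∉β)) y∈α
      d≡ : d s' ≡ suc (b s')
      d≡ = δ-in s' c y∈δ b<c (strip-step pβ pδ lβ lδ (βδ q) s')

    passing : ∀ s → a s ≡ suc (b s) → g (suc s) ≡ a s → d s ≡ suc (b s)
    passing s e e' = δ-in s (a s)
      (trans (linked q {suc s , a s} {suc (suc s) , a s} toBelow
               (sub (αγ q) (suc s , a s) x∈α , x∉β)
               (Lens.sound lγ (suc s) _ (≤-reflexive (sym e')) , ¬true⇒false (λ h → absurd (upward pβ _ _ h) x∉β)))
             x∈α)
      (≤-reflexive (sym e)) (strip-step pβ pδ lβ lδ (βδ q) s)
      where
      x∈α = Lens.sound lα s (a s) ≤-refl
      x∉β = Lens.outside lβ s (a s) (≤-reflexive (sym e))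

-- Longest chains

accumulate : (L y : ℕ → ℕ) → ℕ → ℕ → ℕ
accumulate L y zero s = 0
accumulate L y (suc d) s = (L s + y s) ⊔ accumulate L y d (suc s)

-- Λ C g t s is the length of a longest chain of the skew tableau whose letters ≤ u fill the rows
-- up to g u, using letters ≤ t and rows s , … , C ∸ 1 and moving up and strictly right.
Λ : ℕ → (ℕ → ℕ → ℕ) → ℕ → ℕ → ℕ
Λ C g zero s = 0
Λ C g (suc t) s = accumulate (Λ C g t) (λ r → g (suc t) r ∸ g t r) (C ∸ s) s

Λ-suc : ∀ C g t s → s < C →
  Λ C g (suc t) s ≡ (Λ C g t s + (g (suc t) s ∸ g t s)) ⊔ Λ C g (suc t) (suc s)
Λ-suc C g t s s<C =
  cong (λ d → accumulate (Λ C g t) (λ r → g (suc t) r ∸ g t r) d s) (+-∸-assoc 1 s<C)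

Λ-cut : ∀ C g t s → C ≤ s → Λ C g t s ≡ 0
Λ-cut C g zero s h = refl
Λ-cut C g (suc t) s h rewrite m≤n⇒m∸n≡0 h = refl

Λ-decreasing : ∀ C g t s → Λ C g t (suc s) ≤ Λ C g t s
Λ-decreasing C g zero s = z≤n
Λ-decreasing C g (suc t) s with s <? C
... | yes h = ≤-trans (m≤n⊔m _ _) (≤-reflexive (sym (Λ-suc C g t s h)))
... | no h = ≤-trans (≤-reflexive (Λ-cut C g (suc t) (suc s) (m≤n⇒m≤1+n (≮⇒≥ h)))) z≤n

Λ-cong : ∀ C g h t → (∀ u s → u ≤ t → s < C → g u s ≡ h u s) → ∀ s → Λ C g t s ≡ Λ C h t s
Λ-cong C g h zero e s = refl
Λ-cong C g h (suc t) e s = go (C ∸ s) s ≤-refl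
  where
  go : ∀ d s → d ≤ C ∸ s → accumulate (Λ C g t) (λ r → g (suc t) r ∸ g t r) d s
     ≡ accumulate (Λ C h t) (λ r → h (suc t) r ∸ h t r) d s
  go zero s _ = refl
  go (suc d) s d< = cong₂ _⊔_
    (cong₂ _+_ (Λ-cong C g h t (λ u s' u≤ → e u s' (m≤n⇒m≤1+n u≤)) s)
               (cong₂ _∸_ (e (suc t) s ≤-refl s<C) (e t s (n≤1+n t) s<C)))
    (go d (suc s) (s≤s⁻¹ (≤-trans d< (≤-reflexive (+-∸-assoc 1 s<C)))))
    where
    s<C : s < C
    s<C = m∸n≢0⇒n<m (λ z → <⇒≱ d< (≤-trans (≤-reflexive z) z≤n))

Λ-zero-rows : ∀ C g S → (∀ t s → S ≤ s → g t s ≡ 0) → ∀ t s → S ≤ s → Λ C g t s ≡ 0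
Λ-zero-rows C g S z zero s h = refl
Λ-zero-rows C g S z (suc t) s h = go (C ∸ s) s h
  where
  go : ∀ d s → S ≤ s → accumulate (Λ C g t) (λ r → g (suc t) r ∸ g t r) d s ≡ 0
  go zero s h = refl
  go (suc d) s h rewrite Λ-zero-rows C g S z t s h | z (suc t) s h | z t s h = go d (suc s) (m≤n⇒m≤1+n h)

-- Within a single row the longest chain consists of all boxes that have been added.
Λ-last-row : ∀ C g t → (∀ u → u < t → g u C ≤ g (suc u) C) → Λ (suc C) g t C ≡ g t C ∸ g 0 C
Λ-last-row C g zero h = sym (n∸n≡0 (g 0 C))
Λ-last-row C g (suc t) h = trans (Λ-suc (suc C) g t C ≤-refl)
  (trans (cong₂ _⊔_ (cong (_+ (g (suc t) C ∸ g t C)) (Λ-last-row C g t (λ u u< → h u (m<n⇒m<1+n u<))))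
                    (Λ-cut (suc C) g (suc t) (suc C) ≤-refl))
    (trans (⊔-identityʳ _) (telescope (h t ≤-refl) (mono t (λ u u< → h u (m<n⇒m<1+n u<))))))
  where
  mono : ∀ t → (∀ u → u < t → g u C ≤ g (suc u) C) → g 0 C ≤ g t C
  mono zero h = ≤-refl
  mono (suc t) h = ≤-trans (mono t (λ u u< → h u (m<n⇒m<1+n u<))) (h t ≤-refl)
  telescope : ∀ {a b c} → b ≤ c → a ≤ b → (b ∸ a) + (c ∸ b) ≡ c ∸ a
  telescope {a} {b} {c} b≤c a≤b = trans (+-comm (b ∸ a) (c ∸ b))
    (trans (sym (+-∸-assoc (c ∸ b) a≤b)) (cong (_∸ a) (m∸n+n≡m b≤c)))

-- K and L are longest chain lengths, in rows s and below, at two consecutive levels of a growth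
-- diagram; β and α are the row lengths of its shapes there.
Transport : (K L β α : ℕ → ℕ) → Set
Transport K L β α = L 0 ≡ K 0 × (∀ s → L (suc s) ≡ K (suc s) ⊔ (K s ∸ (β s ∸ α (suc s))))

step-diff : ∀ {x y} → x ≡ y ⊎ x ≡ suc y → y + (x ∸ y) ≡ x × (x ∸ y ≡ 0 ⊎ x ∸ y ≡ 1)
step-diff {y = y} (inj₁ refl) = trans (cong (y +_) (n∸n≡0 y)) (+-identityʳ y) , inj₁ (n∸n≡0 y)
step-diff {y = y} (inj₂ refl) = m+[n∸m]≡n (n≤1+n y) , inj₂ (m+n∸n≡m 1 y)

-- The unprimed functions belong to a letter bound `t`, the primed ones to `t + 1`. The lower level
-- counts chains in rows up to `C₀`, the upper one in rows up to `C₀ + 1`. What the relation says in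
-- the lowest row is assumed in `boundary`; `rows` carries it upwards, one row at a time.
module TransportStep {β α γ δ : ℕ → ℕ} (q : RowSquare β α γ δ) (C₀ : ℕ) (K L K' L' : ℕ → ℕ)
  (K-dec : ∀ s → K (suc s) ≤ K s)
  (K'-rec : ∀ s → s ≤ C₀ → K' s ≡ (K s + (δ s ∸ β s)) ⊔ K' (suc s))
  (L'-rec : ∀ s → s ≤ suc C₀ → L' s ≡ (L s + (γ s ∸ α s)) ⊔ L' (suc s))
  (K'-cut : ∀ s → suc C₀ ≤ s → K' s ≡ 0) (L'-cut : ∀ s → suc (suc C₀) ≤ s → L' s ≡ 0)
  (boundary : L' (suc C₀) ≡ K' C₀ ∸ (δ C₀ ∸ γ (suc C₀)))
  (rec : Transport K L β α) where

  open RowSquare q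

  private
    y z c c' : ℕ → ℕ
    y s = γ s ∸ α s
    z s = δ s ∸ β s
    c s = β s ∸ α (suc s)
    c' s = δ s ∸ γ (suc s)

    -- Both sides count the columns from the end of row `s + 1` of α to the end of row `s` of δ.
    c-rel : ∀ s → c' s + y (suc s) ≡ c s + z s
    c-rel s = +-cancelʳ-≡ (α (suc s)) _ _ (begin
      c' s + y (suc s) + α (suc s)   ≡⟨ +-assoc (c' s) _ _ ⟩
      c' s + (y (suc s) + α (suc s)) ≡⟨ cong (c' s +_) (trans (+-comm (y (suc s)) _) (proj₁ (step-diff (stepαγ (suc s))))) ⟩
      c' s + γ (suc s)               ≡⟨ m∸n+n≡m (interδγ s) ⟩
      δ s                            ≡⟨ sym (proj₁ (step-diff (stepβδ s))) ⟩
      β s + z s                      ≡⟨ cong (_+ z s) (sym (m∸n+n≡m (interβα s))) ⟩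
      c s + α (suc s) + z s          ≡⟨ +-assoc (c s) _ _ ⟩
      c s + (α (suc s) + z s)        ≡⟨ cong (c s +_) (+-comm (α (suc s)) _) ⟩
      c s + (z s + α (suc s))        ≡⟨ sym (+-assoc (c s) _ _) ⟩
      c s + z s + α (suc s) ∎)
      where open ≡-Reasoning

    y01 : ∀ s → (γ s ≡ α s × y s ≡ 0) ⊎ (γ s ≡ suc (α s) × y s ≡ 1)
    y01 s with stepαγ s
    ... | inj₁ e = inj₁ (e , trans (cong (_∸ α s) e) (n∸n≡0 (α s)))
    ... | inj₂ e = inj₂ (e , trans (cong (_∸ α s) e) (m+n∸n≡m 1 (α s)))

    z01 : ∀ s → (δ s ≡ β s × z s ≡ 0) ⊎ (δ s ≡ suc (β s) × z s ≡ 1)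
    z01 s with stepβδ s
    ... | inj₁ e = inj₁ (e , trans (cong (_∸ β s) e) (n∸n≡0 (β s)))
    ... | inj₂ e = inj₂ (e , trans (cong (_∸ β s) e) (m+n∸n≡m 1 (β s)))

    K'-keeps : ∀ s → s ≤ C₀ → K s + z s ≤ K' s
    K'-keeps s h = ≤-trans (m≤m⊔n _ _) (≤-reflexive (sym (K'-rec s h)))

    K'-up : ∀ s → s ≤ C₀ → K' (suc s) ≤ K' s
    K'-up s h = ≤-trans (m≤n⊔m _ _) (≤-reflexive (sym (K'-rec s h)))

    L'-keeps : ∀ s → s ≤ suc C₀ → L s + y s ≤ L' s
    L'-keeps s h = ≤-trans (m≤m⊔n _ _) (≤-reflexive (sym (L'-rec s h)))

    L'-up : ∀ s → s ≤ suc C₀ → L' (suc s) ≤ L' s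
    L'-up s h = ≤-trans (m≤n⊔m _ _) (≤-reflexive (sym (L'-rec s h)))

    K≤L : ∀ s → K s ≤ L s
    K≤L zero = ≤-reflexive (sym (proj₁ rec))
    K≤L (suc s) = ≤-trans (m≤m⊔n _ _) (≤-reflexive (sym (proj₂ rec s)))

    Row : ℕ → Set
    Row s = L' (suc s) ≡ K' (suc s) ⊔ (K' s ∸ c' s)

    K'≤L' : ∀ s → s ≤ C₀ → Row s → K' s ≤ L' s
    K'≤L' s h p = ≤-trans (≤-reflexive (K'-rec s h)) (⊔-lub kz (≤-trans x (L'-up s (m≤n⇒m≤1+n h))))
      where
      x : K' (suc s) ≤ L' (suc s)
      x = ≤-trans (m≤m⊔n _ _) (≤-reflexive (sym p))
      kz : K s + z s ≤ L' s
      kz with z01 s | y01 s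
      ... | inj₁ (_ , z0) | _ = ≤-trans (≤-reflexive (trans (cong (K s +_) z0) (+-identityʳ _)))
              (≤-trans (K≤L s) (≤-trans (m≤m+n _ _) (L'-keeps s (m≤n⇒m≤1+n h))))
      ... | inj₂ (_ , z1) | inj₂ (_ , y1) =
              ≤-trans (+-mono-≤ (K≤L s) (≤-reflexive (trans z1 (sym y1)))) (L'-keeps s (m≤n⇒m≤1+n h))
      -- The letter is in row `s` at the lower level only. Then `c' s` vanishes, and the relation
      -- `p` already gives `K' s ≤ L' (suc s)`.
      ... | inj₂ (eδ , _) | inj₁ (eγ , _) with entering s eδ eγ
      ...   | eα , eγ' = ≤-trans (K'-keeps s h) (≤-trans (≤-reflexive (sym (cong (K' s ∸_) c'0)))
              (≤-trans (m≤n⊔m _ _) (≤-trans (≤-reflexive (sym p)) (L'-up s (m≤n⇒m≤1+n h)))))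
        where
        c'0 : c' s ≡ 0
        c'0 = trans (cong₂ _∸_ (trans eδ (sym eα)) eγ') (n∸n≡0 (α s))

    rest≤ : ∀ s → s ≤ C₀ → Row s → L' (suc s) ≤ K' s
    rest≤ s h p = ≤-trans (≤-reflexive p) (⊔-lub (K'-up s h) (m∸n≤m _ (c' s)))

    row-step : ∀ s → suc s ≤ C₀ → Row (suc s) → Row s
    row-step s h p = ≤-antisym upper lower
      where
      h' = ≤-trans (n≤1+n s) h
      hL : suc s ≤ suc C₀
      hL = m≤n⇒m≤1+n h
      T = K' (suc s) ⊔ (K' s ∸ c' s)
      ky : K (suc s) + y (suc s) ≤ T
      ky with y01 (suc s) | z01 (suc s)
      ... | inj₁ (_ , y0) | _ = ≤-trans (≤-reflexive (trans (cong (K (suc s) +_) y0) (+-identityʳ _)))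
             (≤-trans (m≤m+n _ _) (≤-trans (K'-keeps (suc s) h) (m≤m⊔n _ _)))
      ... | inj₂ (_ , y1) | inj₂ (_ , z1) = ≤-trans (≤-reflexive (cong (K (suc s) +_) (trans y1 (sym z1))))
             (≤-trans (K'-keeps (suc s) h) (m≤m⊔n _ _))
      -- At the upper level the letter lies in row `s + 1`, at the lower one in row `s`. There
      -- `z s ≡ 1` and `c' s ≡ 0`, so `K' s` covers the term.
      ... | inj₂ (eγ , y1) | inj₁ (eδ , _) with leaving (suc s) eγ eδ
      ...   | _ , refl , eα , eγ' , eδ' = ≤-trans (≤-reflexive (cong (K (suc s) +_) (trans y1 (sym z1))))
              (≤-trans (+-monoˡ-≤ (z s) (K-dec s)) (≤-trans (K'-keeps s h')
                (≤-trans (≤-reflexive (sym (cong (K' s ∸_) c'0))) (m≤n⊔m _ _))))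
        where
        c'0 : c' s ≡ 0
        c'0 = trans (cong₂ _∸_ eδ' eγ') (n∸n≡0 (α s))
        z1 : z s ≡ 1
        z1 = trans (cong (_∸ β s) (trans eδ' eα)) (m+n∸n≡m 1 (β s))
      -- Subtraction is truncated. If `K s ≤ c s`, the first summand is 0 and `ky` suffices;
      -- otherwise `c-rel` turns the sum into `K s + z s` less `c' s`.
      cy : (K s ∸ c s) + y (suc s) ≤ T
      cy with ≤-total (K s) (c s)
      ... | inj₁ le = ≤-trans (+-monoˡ-≤ (y (suc s)) (≤-trans (≤-reflexive (m≤n⇒m∸n≡0 le)) z≤n)) ky
      ... | inj₂ ge = ≤-trans (m+n≤o⇒m≤o∸n _ (≤-trans (≤-reflexive shuffle) (K'-keeps s h'))) (m≤n⊔m _ _)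
        where
        shuffle : (K s ∸ c s) + y (suc s) + c' s ≡ K s + z s
        shuffle = trans (+-assoc (K s ∸ c s) _ _) (trans (cong ((K s ∸ c s) +_) (trans (+-comm (y (suc s)) _) (c-rel s)))
                    (trans (sym (+-assoc (K s ∸ c s) _ _)) (cong (_+ z s) (m∸n+n≡m ge))))
      upper : L' (suc s) ≤ T
      upper = ≤-trans (≤-reflexive (L'-rec (suc s) hL))
        (⊔-lub (≤-trans (≤-reflexive (trans (cong (_+ y (suc s)) (proj₂ rec s)) (+-distribʳ-⊔ (y (suc s)) (K (suc s)) (K s ∸ c s)))) (⊔-lub ky cy))
               (≤-trans (rest≤ (suc s) h p) (m≤m⊔n _ _)))
      kz : (K s + z s) ∸ c' s ≤ L' (suc s)
      kz with ≤-total (K s) (c s)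
      ... | inj₁ le = ≤-trans (m≤n+o⇒m∸n≤o _ (c' s) (≤-trans (+-monoˡ-≤ (z s) le) (≤-reflexive (sym (c-rel s)))))
              (≤-trans (m≤n+m _ (L (suc s))) (L'-keeps (suc s) hL))
      ... | inj₂ ge = ≤-trans (m≤n+o⇒m∸n≤o _ (c' s) (≤-reflexive shuffle))
              (≤-trans (+-monoˡ-≤ (y (suc s)) (≤-trans (m≤n⊔m (K (suc s)) _) (≤-reflexive (sym (proj₂ rec s))))) (L'-keeps (suc s) hL))
        where
        shuffle : K s + z s ≡ c' s + ((K s ∸ c s) + y (suc s))
        shuffle = trans (cong (_+ z s) (sym (m∸n+n≡m ge))) (trans (+-assoc (K s ∸ c s) _ _)
          (trans (cong ((K s ∸ c s) +_) (trans (sym (c-rel s)) (+-comm (c' s) _)))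
            (trans (sym (+-assoc (K s ∸ c s) _ _)) (+-comm _ (c' s)))))
      lower : T ≤ L' (suc s)
      lower = ⊔-lub (K'≤L' (suc s) h p)
        (≤-trans (≤-reflexive (trans (cong (_∸ c' s) (K'-rec s h')) (∸-distribʳ-⊔ (c' s) _ _)))
          (⊔-lub kz (≤-trans (m∸n≤m _ (c' s)) (K'≤L' (suc s) h p))))

    rows : ∀ d s → s + d ≡ C₀ → Row s
    rows zero s e = trans (cong (λ x → L' (suc x)) s≡) (trans boundary
      (trans (cong (λ x → K' x ∸ c' x) (sym s≡))
        (sym (cong (_⊔ (K' s ∸ c' s)) (K'-cut (suc s) (≤-reflexive (cong suc (sym s≡))))))))
      where s≡ = trans (sym (+-identityʳ s)) e
    rows (suc d) s e = row-step s (≤-trans (m≤m+n (suc s) d) (≤-reflexive e'))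
                                  (rows d (suc s) e')
      where e' = trans (sym (+-suc s d)) e

  transported : Transport K' L' δ γ
  transported = first , row
    where
    row : ∀ s → Row s
    row s with s ≤? C₀
    ... | yes h = rows (C₀ ∸ s) s (m+[n∸m]≡n h)
    ... | no h rewrite K'-cut s (≰⇒> h) | K'-cut (suc s) (≤-trans (≰⇒> h) (n≤1+n s)) =
      trans (L'-cut (suc s) (s≤s (≰⇒> h))) (sym (0∸n≡0 (c' s)))
    first : L' 0 ≡ K' 0
    first = ≤-antisym
      (≤-trans (≤-reflexive (L'-rec 0 z≤n)) (⊔-lub ky (rest≤ 0 z≤n (row 0))))
      (K'≤L' 0 z≤n (row 0))
      where
      ky : L 0 + y 0 ≤ K' 0
      ky with y01 0 | z01 0
      ... | inj₁ (_ , y0) | _ = ≤-trans (≤-reflexive (trans (cong (L 0 +_) y0) (+-identityʳ _)))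
             (≤-trans (≤-reflexive (proj₁ rec)) (≤-trans (m≤m+n _ _) (K'-keeps 0 z≤n)))
      ... | inj₂ (_ , y1) | inj₂ (_ , z1) =
             ≤-trans (≤-reflexive (cong₂ _+_ (proj₁ rec) (trans y1 (sym z1)))) (K'-keeps 0 z≤n)
      -- No letter can move up out of the top row. This is why the lengths in row 0 agree on both
      -- levels.
      ... | inj₂ (eγ , _) | inj₁ (eδ , _) with leaving 0 eγ eδ
      ...   | _ , () , _

Λ-transport : ∀ (b h : ℕ → ℕ → ℕ) k C₀ →
  (∀ t → t < k → RowSquare (b t) (h t) (h (suc t)) (b (suc t))) →
  (∀ t → t ≤ k → Λ (suc (suc C₀)) h t (suc C₀) ≡ Λ (suc C₀) b t C₀ ∸ (b t C₀ ∸ h t (suc C₀))) →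
  ∀ t → t ≤ k → Transport (Λ (suc C₀) b t) (Λ (suc (suc C₀)) h t) (b t) (h t)
Λ-transport b h k C₀ sq bd zero _ = refl , λ s → sym (0∸n≡0 (b 0 s ∸ h 0 (suc s)))
Λ-transport b h k C₀ sq bd (suc t) t<k = TransportStep.transported (sq t t<k) C₀ _ _ _ _
  (Λ-decreasing (suc C₀) b t)
  (λ s s≤ → Λ-suc (suc C₀) b t s (s≤s s≤)) (λ s s≤ → Λ-suc (suc (suc C₀)) h t s (s≤s s≤))
  (Λ-cut (suc C₀) b (suc t)) (Λ-cut (suc (suc C₀)) h (suc t))
  (bd (suc t) t<k) (Λ-transport b h k C₀ sq bd t (<⇒≤ t<k))

-- The 0-Hecke monoid

-- The 0-Hecke monoid acts on sequences of bits: the generator v sorts positions v and v + 1.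

Bits : Set
Bits = ℕ → Bool

sortAt : ℕ → Bits → Bits
sortAt zero x zero = x 0 ∨ x 1
sortAt zero x (suc zero) = x 0 ∧ x 1
sortAt zero x (suc (suc i)) = x (suc (suc i))
sortAt (suc v) x zero = x 0
sortAt (suc v) x (suc i) = sortAt v (x ∘ suc) i

sortAt-ext : ∀ v {x y : Bits} → x ≗ y → sortAt v x ≗ sortAt v y
sortAt-ext zero e zero = cong₂ _∨_ (e 0) (e 1)
sortAt-ext zero e (suc zero) = cong₂ _∧_ (e 0) (e 1)
sortAt-ext zero e (suc (suc i)) = e (suc (suc i))
sortAt-ext (suc v) e zero = e 0
sortAt-ext (suc v) e (suc i) = sortAt-ext v (e ∘ suc) i

sortAt-idem : ∀ v x → sortAt v (sortAt v x) ≗ sortAt v x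
sortAt-idem zero x zero with x 0 | x 1
... | true  | true  = refl
... | true  | false = refl
... | false | true  = refl
... | false | false = refl
sortAt-idem zero x (suc zero) with x 0 | x 1
... | true  | true  = refl
... | true  | false = refl
... | false | true  = refl
... | false | false = refl
sortAt-idem zero x (suc (suc i)) = refl
sortAt-idem (suc v) x zero = refl
sortAt-idem (suc v) x (suc i) = sortAt-idem v (x ∘ suc) i

sortAt-comm : ∀ u v x → suc u < v → sortAt u (sortAt v x) ≗ sortAt v (sortAt u x)
sortAt-comm zero (suc (suc v)) x _ zero = refl
sortAt-comm zero (suc (suc v)) x _ (suc zero) = refl
sortAt-comm zero (suc (suc v)) x _ (suc (suc i)) = refl
sortAt-comm (suc u) (suc v) x (s≤s h) zero = refl
sortAt-comm (suc u) (suc v) x (s≤s h) (suc i) = sortAt-comm u v (x ∘ suc) h i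
sortAt-comm zero (suc zero) x (s≤s ()) i

sortAt-braid : ∀ v x → sortAt v (sortAt (suc v) (sortAt v x)) ≗ sortAt (suc v) (sortAt v (sortAt (suc v) x))
sortAt-braid zero x zero with x 0 | x 1 | x 2
... | true  | true  | true  = refl
... | true  | true  | false = refl
... | true  | false | true  = refl
... | true  | false | false = refl
... | false | true  | true  = refl
... | false | true  | false = refl
... | false | false | true  = refl
... | false | false | false = refl
sortAt-braid zero x (suc zero) with x 0 | x 1 | x 2
... | true  | true  | true  = refl
... | true  | true  | false = refl
... | true  | false | true  = refl
... | true  | false | false = refl
... | false | true  | true  = refl
... | false | true  | false = refl
... | false | false | true  = refl
... | false | false | false = refl
sortAt-braid zero x (suc (suc zero)) with x 0 | x 1 | x 2
... | true  | true  | true  = refl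
... | true  | true  | false = refl
... | true  | false | true  = refl
... | true  | false | false = refl
... | false | true  | true  = refl
... | false | true  | false = refl
... | false | false | true  = refl
... | false | false | false = refl
sortAt-braid zero x (suc (suc (suc i))) = refl
sortAt-braid (suc v) x zero = refl
sortAt-braid (suc v) x (suc i) = sortAt-braid v (x ∘ suc) i

sortAt-or : ∀ v x → sortAt v x v ≡ x v ∨ x (suc v)
sortAt-or zero x = refl
sortAt-or (suc v) x = sortAt-or v (x ∘ suc)

sortAt-and : ∀ v x → sortAt v x (suc v) ≡ x v ∧ x (suc v)
sortAt-and zero x = refl
sortAt-and (suc v) x = sortAt-and v (x ∘ suc)

sortAt-other : ∀ v x i → i ≢ v → i ≢ suc v → sortAt v x i ≡ x i
sortAt-other zero x zero p q = ⊥-elim (p refl)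
sortAt-other zero x (suc zero) p q = ⊥-elim (q refl)
sortAt-other zero x (suc (suc i)) p q = refl
sortAt-other (suc v) x zero p q = refl
sortAt-other (suc v) x (suc i) p q = sortAt-other v (x ∘ suc) i (p ∘ cong suc) (q ∘ cong suc)

sortAt-sorted : ∀ v x → x v ≡ true → x (suc v) ≡ true → sortAt v x ≗ x
sortAt-sorted zero x p q zero rewrite p = refl
sortAt-sorted zero x p q (suc zero) rewrite p = refl
sortAt-sorted zero x p q (suc (suc i)) = refl
sortAt-sorted (suc v) x p q zero = refl
sortAt-sorted (suc v) x p q (suc i) = sortAt-sorted v (x ∘ suc) p q i

infixr 4 _⨾_
_⨾_ : {x y z : Bits} → x ≗ y → y ≗ z → x ≗ z
(p ⨾ q) i = trans (p i) (q i)

≗-sym : {x y : Bits} → x ≗ y → y ≗ x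
≗-sym p i = sym (p i)

sortIf : Bool → ℕ → Bits → Bits
sortIf b v x = if b then sortAt v x else x

-- A row of an increasing tableau with letter set `P`, read from left to right; the leftmost letter
-- acts first.
word : (ℕ → Bool) → ℕ → ℕ → Bits → Bits
word P lo zero x = x
word P lo (suc d) x = word P (suc lo) d (sortIf (P lo) lo x)

sortIf-ext : ∀ b v {x y : Bits} → x ≗ y → sortIf b v x ≗ sortIf b v y
sortIf-ext true v e = sortAt-ext v e
sortIf-ext false v e = e

sortIf-comm : ∀ b u v x → suc u < v ⊎ suc v < u → sortIf b u (sortAt v x) ≗ sortAt v (sortIf b u x)
sortIf-comm true u v x (inj₁ h) = sortAt-comm u v x h
sortIf-comm true u v x (inj₂ h) = ≗-sym (sortAt-comm v u x h)
sortIf-comm false u v x _ _ = refl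

word-ext : ∀ P lo d {x y : Bits} → x ≗ y → word P lo d x ≗ word P lo d y
word-ext P lo zero e = e
word-ext P lo (suc d) e = word-ext P (suc lo) d (sortIf-ext (P lo) lo e)

word-comm-above : ∀ P lo d z x → suc z < lo → word P lo d (sortAt z x) ≗ sortAt z (word P lo d x)
word-comm-above P lo zero z x h _ = refl
word-comm-above P lo (suc d) z x h =
  word-ext P (suc lo) d (sortIf-comm (P lo) lo z x (inj₂ h)) ⨾
  word-comm-above P (suc lo) d z _ (m<n⇒m<1+n h)

word-comm-below : ∀ P lo d z x → lo + d < z → word P lo d (sortAt z x) ≗ sortAt z (word P lo d x)
word-comm-below P lo zero z x h _ = refl
word-comm-below P lo (suc d) z x h =
  word-ext P (suc lo) d (sortIf-comm (P lo) lo z x (inj₁ (≤-<-trans (m≤m+n (suc lo) d) h'))) ⨾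
  word-comm-below P (suc lo) d z _ h'
  where h' = subst (_< z) (+-suc lo d) h

word-comm-sortIf : ∀ P lo d b z x → suc z < lo → word P lo d (sortIf b z x) ≗ sortIf b z (word P lo d x)
word-comm-sortIf P lo d true z x h = word-comm-above P lo d z x h
word-comm-sortIf P lo d false z x h _ = refl

word-comm-word : ∀ P Q lo d lo' e x → lo + d < lo' →
  word P lo d (word Q lo' e x) ≗ word Q lo' e (word P lo d x)
word-comm-word P Q lo zero lo' e x h _ = refl
word-comm-word P Q lo (suc d) lo' e x h =
  word-ext P (suc lo) d (≗-sym (word-comm-sortIf Q lo' e (P lo) lo x (≤-<-trans (m≤m+n (suc lo) d) h'))) ⨾
  word-comm-word P Q (suc lo) d lo' e _ h'
  where h' = subst (_< lo') (+-suc lo d) h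

word-append : ∀ P lo d e x → word P lo (d + e) x ≡ word P (lo + d) e (word P lo d x)
word-append P lo zero e x = cong (λ l → word P l e x) (sym (+-identityʳ lo))
word-append P lo (suc d) e x = trans (word-append P (suc lo) d e (sortIf (P lo) lo x))
  (cong (λ l → word P l e (word P lo (suc d) x)) (sym (+-suc lo d)))

word-snoc : ∀ P d x → word P 0 (suc d) x ≡ sortIf (P d) d (word P 0 d x)
word-snoc P d x = trans (cong (λ m → word P 0 m x) (+-comm 1 d)) (word-append P 0 d 1 x)

word-cong : ∀ P Q lo d x → (∀ v → lo ≤ v → v < lo + d → P v ≡ Q v) → word P lo d x ≡ word Q lo d x
word-cong P Q lo zero x h = refl
word-cong P Q lo (suc d) x h = trans
  (cong (λ b → word P (suc lo) d (sortIf b lo x)) (h lo ≤-refl (m<m+n lo (s≤s z≤n))))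
  (word-cong P Q (suc lo) d _ (λ v p q → h v (<⇒≤ p) (subst (v <_) (sym (+-suc lo d)) q)))

-- A and B are the letter sets of a lower and an upper row; Z consists of the letters of B that
-- are blocked from below, so that they may be repeated in A or dropped from B.
module TwoRows (N : ℕ) (A B : ℕ → Bool) (Z : ℕ → Set)
  (Z⇒A : ∀ {v} → v < N → Z v → A v ≡ true) (Z⇒B : ∀ {v} → Z v → B v ≡ true)
  (Z-up : ∀ {v} → suc v < N → Z v → A (suc v) ≡ true → Z (suc v))
  (Z-down : ∀ {v} → suc v < N → Z (suc v) → B v ≡ true → Z v) where

  private
    W : (ℕ → Bool) → ℕ → ℕ → Bits → Bits
    W = word

    -- Carries the surplus generator `z` to its copy in `B`. If `A` lacks `suc z`, then `z` commutes
    -- past the rest of `A` and merges with that copy. If not, `suc z` is in `Z` too, and the braid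
    -- relation replaces the surplus `z` by a surplus `suc z`.
    absorb-above : ∀ d z x → suc z + d ≡ N → Z z →
      W B z (suc d) (W A (suc z) d (sortAt z x)) ≗ W B z (suc d) (W A (suc z) d x)
    absorb-above zero z x e h rewrite Z⇒B h = sortAt-idem z x
    absorb-above (suc d) z x e h rewrite Z⇒B h with bool-cases (A (suc z))
    ... | inj₂ f rewrite f =
      word-ext B (suc z) (suc d)
        (sortAt-ext z (word-comm-above A (suc (suc z)) d z x ≤-refl) ⨾ sortAt-idem z _)
    ... | inj₁ f rewrite f | Z⇒B (Z-up (subst (suc z <_) e (m<m+n (suc z) (s≤s z≤n))) h f) =
      word-ext B (2 + z) d (sortAt-ext (suc z) (≗-sym (word-comm-above A (2 + z) d z _ ≤-refl) ⨾
          word-ext A (2 + z) d (sortAt-braid z x))) ⨾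
      IH (sortAt z (sortAt (suc z) x)) ⨾
      word-ext B (2 + z) d (sortAt-ext (suc z) (word-comm-above A (2 + z) d z _ ≤-refl))
      where
      h' = Z-up (subst (suc z <_) e (m<m+n (suc z) (s≤s z≤n))) h f
      IH : ∀ y → W B (2 + z) d (sortAt (suc z) (W A (2 + z) d (sortAt (suc z) y)))
               ≗ W B (2 + z) d (sortAt (suc z) (W A (2 + z) d y))
      IH y with absorb-above d (suc z) y (trans (sym (cong suc (+-suc z d))) e) h'
      ... | r rewrite Z⇒B h' = r

    -- Mirror image of `absorb-above`: the surplus `z` acts last and is carried down to a copy in
    -- `A` along consecutive letters of `B`.
    absorb-below : ∀ z x → z < N → Z z →
      sortAt z (W B 0 z (W A 0 (suc z) x)) ≗ W B 0 z (W A 0 (suc z) x)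
    absorb-below zero x l h rewrite Z⇒A l h = sortAt-idem 0 x
    absorb-below (suc z) x l h
      rewrite word-snoc A (suc z) x | Z⇒A l h | word-snoc B z (sortAt (suc z) (W A 0 (suc z) x))
      with bool-cases (B z)
    ... | inj₂ f rewrite f =
      sortAt-ext (suc z) (word-comm-below B 0 z (suc z) _ ≤-refl) ⨾ sortAt-idem (suc z) _ ⨾
      ≗-sym (word-comm-below B 0 z (suc z) _ ≤-refl)
    ... | inj₁ f rewrite f =
      sortAt-ext (suc z) (sortAt-ext z (word-comm-below B 0 z (suc z) _ ≤-refl)) ⨾
      ≗-sym (sortAt-braid z _) ⨾
      sortAt-ext z (sortAt-ext (suc z) (absorb-below z x (<⇒≤ l) (Z-down l h f))) ⨾
      sortAt-ext z (≗-sym (word-comm-below B 0 z (suc z) _ ≤-refl))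

  module _ (T : ℕ → Bool) (T⇒A : ∀ v → v < N → T v ≡ true → A v ≡ true)
           (dropped : ∀ v → v < N → A v ≡ true → T v ≡ false → Z v × (∀ u → v ≡ suc u → B u ≡ false)) where

    private
      -- Since `B` lacks the letter before `z`, its smaller letters commute with `z` and with the
      -- letters of `A` above it. They are moved out of the way, and `absorb-above` applies.
      absorb : ∀ d z x → suc z + d ≡ N → Z z → (∀ u → z ≡ suc u → B u ≡ false) →
        W B 0 N (W A (suc z) d (sortAt z x)) ≗ W B 0 N (W A (suc z) d x)
      absorb d zero x e h g i = trans (cong (λ m → W B 0 m (W A 1 d (sortAt 0 x)) i) (sym e))
        (trans (absorb-above d 0 x e h i) (cong (λ m → W B 0 m (W A 1 d x) i) e))
      absorb d (suc z) x e h g = split (W A (2 + z) d (sortAt (suc z) x)) ⨾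
          word-ext B (suc z) (suc d) (swap (sortAt (suc z) x) ⨾
             word-ext A (2 + z) d (word-comm-below B 0 z (suc z) x ≤-refl)) ⨾
          absorb-above d (suc z) _ e h ⨾
          ≗-sym (split (W A (2 + z) d x) ⨾ word-ext B (suc z) (suc d) (swap x))
        where
        split : ∀ y → W B 0 N y ≗ W B (suc z) (suc d) (W B 0 z y)
        split y i = trans (cong (λ m → W B 0 m y i) (trans (sym e) (cong suc (sym (+-suc z d)))))
          (trans (cong (λ w → w i) (word-append B 0 (suc z) (suc d) y))
            (cong (λ w → W B (suc z) (suc d) w i) (trans (word-snoc B z y) (cong (λ b → sortIf b z (W B 0 z y)) (g z refl)))))
        swap : ∀ y → W B 0 z (W A (2 + z) d y) ≗ W A (2 + z) d (W B 0 z y)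
        swap y = word-comm-word B A 0 z (2 + z) d y (n≤1+n _)

      lower-from : ∀ d lo x → lo + d ≡ N → W B 0 N (W T lo d x) ≗ W B 0 N (W A lo d x)
      lower-from zero lo x e _ = refl
      lower-from (suc d) lo x e with bool-cases (T lo) | bool-cases (A lo)
      ... | inj₁ t | inj₁ a rewrite t | a = lower-from d (suc lo) _ (trans (sym (+-suc lo d)) e)
      ... | inj₁ t | inj₂ a = absurd (T⇒A lo (subst (lo <_) e (m<m+n lo (s≤s z≤n))) t) a
      ... | inj₂ t | inj₂ a rewrite t | a = lower-from d (suc lo) _ (trans (sym (+-suc lo d)) e)
      ... | inj₂ t | inj₁ a with dropped lo (subst (lo <_) e (m<m+n lo (s≤s z≤n))) a t
      ...   | h , g rewrite t | a = lower-from d (suc lo) x e' ⨾ ≗-sym (absorb d lo x e' h g)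
        where e' = trans (sym (+-suc lo d)) e

    shrink-lower : ∀ x → W B 0 N (W T 0 N x) ≗ W B 0 N (W A 0 N x)
    shrink-lower x = lower-from N 0 x refl

  module _ (T : ℕ → Bool) (T⇒B : ∀ v → v < N → T v ≡ true → B v ≡ true)
           (dropped : ∀ v → v < N → B v ≡ true → T v ≡ false → Z v × (suc v < N → A (suc v) ≡ false)) where

    private
      absorb : ∀ z x → z < N → Z z → (suc z < N → A (suc z) ≡ false) →
        sortAt z (W B 0 z (W A 0 N x)) ≗ W B 0 z (W A 0 N x)
      absorb z x l h g with m≤n⇒m<n∨m≡n l
      ... | inj₂ refl = absorb-below z x l h
      ... | inj₁ l' = sortAt-ext z move ⨾
          ≗-sym (word-comm-above A (2 + z) d z _ ≤-refl) ⨾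
          word-ext A (2 + z) d (absorb-below z x l h) ⨾ ≗-sym move
        where
        d = N ∸ suc (suc z)
        split : W A 0 N x ≗ W A (2 + z) d (W A 0 (suc z) x)
        split i = trans (cong (λ m → W A 0 m x i) (sym (m+[n∸m]≡n l')))
          (trans (cong (λ w → w i) (word-append A 0 (2 + z) d x))
            (cong (λ w → W A (2 + z) d w i) (trans (word-snoc A (suc z) x)
              (cong (λ b → sortIf b (suc z) (W A 0 (suc z) x)) (g l')))))
        move : W B 0 z (W A 0 N x) ≗ W A (2 + z) d (W B 0 z (W A 0 (suc z) x))
        move = word-ext B 0 z split ⨾ word-comm-word B A 0 z (2 + z) d _ (n≤1+n _)

      upper-to : ∀ d x → d ≤ N → W T 0 d (W A 0 N x) ≗ W B 0 d (W A 0 N x)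
      upper-to zero x l _ = refl
      upper-to (suc d) x l i rewrite word-snoc T d (W A 0 N x) | word-snoc B d (W A 0 N x)
        with bool-cases (T d) | bool-cases (B d)
      ... | inj₁ t | inj₁ b rewrite t | b = sortAt-ext d (upper-to d x (<⇒≤ l)) i
      ... | inj₁ t | inj₂ b = absurd (T⇒B d l t) b
      ... | inj₂ t | inj₂ b rewrite t | b = upper-to d x (<⇒≤ l) i
      ... | inj₂ t | inj₁ b with dropped d l b t
      ...   | h , g rewrite t | b = (upper-to d x (<⇒≤ l) ⨾ ≗-sym (absorb d x l h g)) i

    shrink-upper : ∀ x → W T 0 N (W A 0 N x) ≗ W B 0 N (W A 0 N x)
    shrink-upper x = upper-to N x ≤-refl

<ᵇ-true : ∀ {m n} → m < n → (m <ᵇ n) ≡ true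
<ᵇ-true h = Equivalence.to T-≡ (<⇒<ᵇ h)

<ᵇ-true⁻ : ∀ {m n} → (m <ᵇ n) ≡ true → m < n
<ᵇ-true⁻ {m} {n} h = <ᵇ⇒< m n (Equivalence.from T-≡ h)

<ᵇ-false : ∀ {m n} → n ≤ m → (m <ᵇ n) ≡ false
<ᵇ-false h = ¬true⇒false (λ p → <⇒≱ (<ᵇ-true⁻ p) h)

<ᵇ-false⁻ : ∀ {m n} → (m <ᵇ n) ≡ false → n ≤ m
<ᵇ-false⁻ h = ≮⇒≥ (λ p → absurd (<ᵇ-true p) h)

-- The letter set of row `s` of the level tableau, with letters counted from 0.
gains : (ℕ → ℕ → ℕ) → ℕ → ℕ → Bool
gains g s v = g v s <ᵇ g (suc v) s

-- The row reading word of a tableau: the bottom row acts first, the top row last.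
rowsProduct : (ℕ → ℕ → Bool) → ℕ → ℕ → Bits → Bits
rowsProduct A N zero x = x
rowsProduct A N (suc S) x = rowsProduct A N S (word (A S) 0 N x)

rowsProduct-ext : ∀ A N S {x y : Bits} → x ≗ y → rowsProduct A N S x ≗ rowsProduct A N S y
rowsProduct-ext A N zero e = e
rowsProduct-ext A N (suc S) e = rowsProduct-ext A N S (word-ext (A S) 0 N e)

rowsProduct-cong : ∀ A B N S x → (∀ s v → v < N → A s v ≡ B s v) → rowsProduct A N S x ≡ rowsProduct B N S x
rowsProduct-cong A B N zero x h = refl
rowsProduct-cong A B N (suc S) x h = trans (rowsProduct-cong A B N S _ h)
  (cong (rowsProduct B N S) (word-cong (A S) (B S) 0 N x (λ v _ v< → h S v v<)))

module HeckeInvariance (N : ℕ) (g g' : ℕ → ℕ → ℕ)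
  (sq : ∀ v → v < N → RowSquare (g v) (g (suc v)) (g' (suc v)) (g' v)) where

  open RowSquare

  private
    -- `A` and `A'` are the rows of the level tableau in two consecutive columns, `T₀` the letters
    -- that stay in their row.
    A A' T₀ : ℕ → ℕ → Bool
    A = gains g
    A' = gains g'
    T₀ s v = A s v ∧ A' s v

    gain : ∀ {m n} → n ≡ m ⊎ n ≡ suc m → (m <ᵇ n) ≡ true → n ≡ suc m
    gain (inj₂ e) h = e
    gain {m} (inj₁ refl) h = ⊥-elim (<-irrefl refl (<ᵇ-true⁻ {m} {m} h))

    nogain : ∀ {m n} → n ≡ m ⊎ n ≡ suc m → (m <ᵇ n) ≡ false → n ≡ m
    nogain (inj₁ e) h = e
    nogain {m} (inj₂ refl) h = ⊥-elim (<⇒≱ ≤-refl (<ᵇ-false⁻ {m} {suc m} h))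

    leaves : ∀ s v (l : v < N) → A' s v ≡ true → A s v ≡ false →
      g' (suc v) s ≡ suc (g (suc v) s) × g' v s ≡ g v s
    leaves s v l a' a with nogain (stepβα (sq v l) s) a | gain (stepδγ (sq v l) s) a'
    ... | e | e' with stepαγ (sq v l) s | stepβδ (sq v l) s
    ...   | inj₂ f | inj₁ f' = f , f'
    ...   | inj₁ f | inj₁ f' = ⊥-elim (1+n≢n (trans (sym e') (trans f (trans e (sym f')))))
    ...   | inj₁ f | inj₂ f' = ⊥-elim (<⇒≢ (m<n⇒m<1+n (n<1+n (g v s)))
              (trans (sym (trans f e)) (trans e' (cong suc f'))))
    ...   | inj₂ f | inj₂ f' = ⊥-elim (1+n≢n (trans (sym (trans e' (cong suc f'))) (trans f (cong suc e))))

    enters : ∀ s v (l : v < N) → A s v ≡ true → A' s v ≡ false →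
      g' v s ≡ suc (g v s) × g' (suc v) s ≡ g (suc v) s
    enters s v l a a' with gain (stepβα (sq v l) s) a | nogain (stepδγ (sq v l) s) a'
    ... | e | e' with stepαγ (sq v l) s | stepβδ (sq v l) s
    ...   | inj₁ f | inj₂ f' = f' , f
    ...   | inj₁ f | inj₁ f' = ⊥-elim (1+n≢n (trans (sym e) (trans (sym f) (trans e' f'))))
    ...   | inj₂ f | inj₁ f' = ⊥-elim (<⇒≢ (m<n⇒m<1+n (n<1+n (g v s)))
              (trans (sym f') (trans (sym e') (trans f (cong suc e)))))
    ...   | inj₂ f | inj₂ f' = ⊥-elim (1+n≢n (trans (sym (trans f (cong suc e))) (trans e' f')))

    module Pair (s : ℕ) where

      -- In the old column, level `v + 1` ends row `s` directly above the place where it ends row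
      -- `s + 1` in the new column.
      Z : ℕ → Set
      Z v = A s v ≡ true × g (suc v) s ≡ g' (suc v) (suc s)

      Z⇒A : ∀ {v} → v < N → Z v → A' (suc s) v ≡ true
      Z⇒A {v} l (b , e) = <ᵇ-true (≤-trans (s≤s (interβδ (sq v l) s))
        (≤-reflexive (trans (sym (gain (stepβα (sq v l) s) b)) e)))

      Z-up : ∀ {v} → suc v < N → Z v → A' (suc s) (suc v) ≡ true → Z (suc v)
      Z-up {v} l (b , e) a with gain (stepδγ (sq (suc v) l) (suc s)) a | stepβα (sq (suc v) l) s
      ... | f | inj₂ h = <ᵇ-true (≤-reflexive (sym h)) , trans h (trans (cong suc e) (sym f))
      ... | f | inj₁ h = ⊥-elim (<⇒≱ ≤-refl (≤-trans (≤-reflexive (sym (trans f (cong suc (sym e)))))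
              (≤-trans (interαγ (sq (suc v) l) s) (≤-reflexive h))))

      Z-down : ∀ {v} → suc v < N → Z (suc v) → A s v ≡ true → Z v
      Z-down {v} l z@(b , e) b' = b' , suc-injective (trans (sym (gain (stepβα (sq (suc v) l) s) b))
        (trans e (gain (stepδγ (sq (suc v) l) (suc s)) (Z⇒A l z))))

      open TwoRows N (A' (suc s)) (A s) Z Z⇒A proj₁ Z-up Z-down

      dropLower : ∀ v → v < N → A' (suc s) v ≡ true → T₀ (suc s) v ≡ false →
        Z v × (∀ u → v ≡ suc u → A s u ≡ false)
      dropLower v l a t with bool-cases (A (suc s) v)
      ... | inj₁ h = absurd (∧-intro h a) t
      ... | inj₂ h with leaves (suc s) v l a h
      ...   | e , e' with leaving (sq v l) (suc s) e e'
      ...     | _ , refl , eα , eγ , eδ = (<ᵇ-true (≤-reflexive (sym eα)) , sym eγ) , prev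
        where
        low : g v s ≡ g v (suc s)
        low = suc-injective (trans (sym eα) (trans (sym eγ) (trans (gain (stepδγ (sq v l) (suc s)) a) (cong suc e'))))
        prev : ∀ u → v ≡ suc u → A s u ≡ false
        prev u refl = <ᵇ-false (≤-trans (≤-reflexive low) (interβα (sq u (<⇒≤ l)) s))

      dropUpper : ∀ v → v < N → A s v ≡ true → T₀ s v ≡ false →
        Z v × (suc v < N → A' (suc s) (suc v) ≡ false)
      dropUpper v l a t with bool-cases (A' s v)
      ... | inj₁ h = absurd (∧-intro a h) t
      ... | inj₂ h with enters s v l a h
      ...   | e , e' with entering (sq v l) s e e'
      ...     | eα , eγ = z , next
        where
        z : Z v
        z = a , sym eγ
        next : suc v < N → A' (suc s) (suc v) ≡ false
        next l' = ¬true⇒false (λ p → let (b , f) = Z-up l' z p in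
          1+n≢n (trans (sym (passing (sq (suc v) l') s (gain (stepβα (sq (suc v) l') s) b) (sym f))) e'))

      -- Both sides equal the product in which the upper row is still `A s` and the lower one
      -- already `A' (suc s)`.
      two-rows : ∀ x → word (A s) 0 N (word (T₀ (suc s)) 0 N x) ≗ word (T₀ s) 0 N (word (A' (suc s)) 0 N x)
      two-rows x = shrink-lower (T₀ (suc s)) (λ v _ t → proj₂ (∧-true {A (suc s) v} t)) dropLower x ⨾
        ≗-sym (shrink-upper (T₀ s) (λ v _ t → proj₁ (∧-true {A s v} t)) dropUpper x)

    top-row : ∀ v → v < N → T₀ 0 v ≡ A' 0 v
    top-row v l with bool-cases (A' 0 v) | bool-cases (A 0 v)
    ... | inj₂ h | _ rewrite h = ∧-zeroʳ _
    ... | inj₁ h | inj₁ h' rewrite h | h' = refl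
    ... | inj₁ h | inj₂ h' with leaves 0 v l h h'
    ...   | e , e' with leaving (sq v l) 0 e e'
    ...     | _ , () , _

    -- Old rows are replaced by new ones from the bottom upwards. In between, row `S` holds only the
    -- letters that stay in it.
    sweep : ∀ S x → rowsProduct A N S (word (T₀ S) 0 N x) ≗ rowsProduct A' N (suc S) x
    sweep zero x i = cong (λ w → w i) (word-cong (T₀ 0) (A' 0) 0 N x (λ v _ l → top-row v l))
    sweep (suc S) x = rowsProduct-ext A N S (Pair.two-rows S x) ⨾ sweep S (word (A' (suc S)) 0 N x)

  word-empty : ∀ P d lo x → (∀ v → v < lo + d → P v ≡ false) → word P lo d x ≡ x
  word-empty P zero lo x h = refl
  word-empty P (suc d) lo x h rewrite h lo (m<m+n lo (s≤s z≤n)) =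
    word-empty P d (suc lo) x (λ v l → h v (subst (v <_) (sym (+-suc lo d)) l))

  invariant : ∀ S → (∀ v → v ≤ N → g v S ≡ 0) → (∀ v → v ≤ N → g' v S ≡ 0) →
    ∀ x → rowsProduct A N S x ≗ rowsProduct A' N S x
  invariant S z z' x i = trans (cong (λ w → rowsProduct A N S w i) (sym (word-empty (T₀ S) N 0 x
        (λ v l → cong (_∧ A' S v) (<ᵇ-false (≤-reflexive (trans (z (suc v) l) (sym (z v (<⇒≤ l))))))))))
    (trans (sweep S x i) (cong (λ w → rowsProduct A' N S w i) (word-empty (A' S) N 0 x
        (λ v l → <ᵇ-false (≤-reflexive (trans (z' (suc v) l) (sym (z' v (<⇒≤ l)))))))))

-- The rightmost of the ones that start in positions s + 1 , … , N has to be moved by each of the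
-- rows s , … , 0 if the ones are to arrive in positions 0 , … , N ∸ s ∸ 1.
module Detection (N₁ s : ℕ) (s≤N₁ : s ≤ N₁) (B : ℕ → ℕ → Bool)
  (B-low : ∀ r v → v < suc N₁ → B r v ≡ true → r ≤ v) where

  private
    N = suc N₁
    p = N ∸ s

    x₀ : Bits
    x₀ i = (s <ᵇ i) ∧ (i <ᵇ suc N)

    x₀-one : ∀ {i} → s < i → i ≤ N → x₀ i ≡ true
    x₀-one a b = ∧-intro (<ᵇ-true a) (<ᵇ-true (s≤s b))

    full : ℕ → ℕ → Bool
    full r v = r <ᵇ suc v

    word-still : ∀ P lo d → lo + d ≤ N → (∀ v → lo ≤ v → v < lo + d → P v ≡ true → s < v) → word P lo d x₀ ≗ x₀
    word-still P lo zero l h _ = refl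
    word-still P lo (suc d) l h =
      word-ext P (suc lo) d first ⨾
      word-still P (suc lo) d (subst (_≤ N) (+-suc lo d) l)
        (λ v a b → h v (<⇒≤ a) (subst (v <_) (sym (+-suc lo d)) b))
      where
      first : sortIf (P lo) lo x₀ ≗ x₀
      first with bool-cases (P lo)
      ... | inj₂ f rewrite f = λ _ → refl
      ... | inj₁ t rewrite t = sortAt-sorted lo x₀ (x₀-one s<lo (<⇒≤ lo<N)) (x₀-one (m<n⇒m<1+n s<lo) lo<N)
        where
        s<lo = h lo ≤-refl (m<m+n lo (s≤s z≤n)) t
        lo<N = ≤-trans (m<m+n lo (s≤s z≤n)) l

    -- A row below `s` has generators `v > s` only, and these act on two positions that both hold
    -- ones.
    still : ∀ A → (∀ r v → v < N → A r v ≡ true → r ≤ v) → ∀ d →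
      rowsProduct A N (suc s + d) x₀ ≗ rowsProduct A N (suc s) x₀
    still A h zero i = cong (λ r → rowsProduct A N (suc r) x₀ i) (+-identityʳ s)
    still A h (suc d) i rewrite +-suc s d =
      (rowsProduct-ext A N (suc (s + d))
        (word-still (A (suc (s + d))) 0 N ≤-refl (λ v _ l t → ≤-trans (s≤s (m≤m+n s d)) (h _ v l t)))
      ⨾ still A h d) i

    keeps : ∀ P lo d i x → x (suc i) ≡ true → (∀ v → lo ≤ v → v < lo + d → P v ≡ true → v ≢ i) →
      word P lo d x (suc i) ≡ true
    keeps P lo zero i x h _ = h
    keeps P lo (suc d) i x h n = keeps P (suc lo) d i _ kept
        (λ v a b → n v (<⇒≤ a) (subst (v <_) (sym (+-suc lo d)) b))
      where
      kept : sortIf (P lo) lo x (suc i) ≡ true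
      kept with bool-cases (P lo)
      ... | inj₂ f rewrite f = h
      ... | inj₁ t rewrite t with lo ≟ suc i
      ...   | yes refl = trans (sortAt-or lo x) (∨-introˡ h)
      ...   | no ne = trans (sortAt-other lo x (suc i) (ne ∘ sym)
                (λ e → n lo ≤-refl (m<m+n lo (s≤s z≤n)) t (sym (suc-injective e)))) h

    stays : ∀ P lo d i x → x i ≡ true → i ≤ lo → word P lo d x i ≡ true
    stays P lo zero i x h _ = h
    stays P lo (suc d) i x h l = stays P (suc lo) d i _ kept (m≤n⇒m≤1+n l)
      where
      kept : sortIf (P lo) lo x i ≡ true
      kept with P lo
      ... | false = h
      ... | true with i ≟ lo
      ...   | yes refl = trans (sortAt-or lo x) (∨-introˡ h)
      ...   | no ne = trans (sortAt-other lo x i ne (λ e → <⇒≱ (≤-reflexive (sym e)) l)) h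

    -- The generators of a row act in increasing order, so a one that has gone from `i + 1` to `i`
    -- is untouched by the later ones: a row moves it by at most one place.
    moves : ∀ P i x → x (suc i) ≡ true → i < N → word P 0 N x i ≡ true ⊎ word P 0 N x (suc i) ≡ true
    moves P i x h l with bool-cases (P i)
    ... | inj₂ f = inj₂ (keeps P 0 N i x h (λ { v _ _ t refl → absurd t f }))
    ... | inj₁ t = inj₁ (trans (cong (λ w → w i) (trans (cong (λ m → word P 0 m x) (sym (m+[n∸m]≡n l)))
                       (word-append P 0 (suc i) (N ∸ suc i) x)))
        (stays P (suc i) (N ∸ suc i) i _ (trans (cong (λ w → w i) (trans (word-snoc P i x) (cong (λ b → sortIf b i (word P 0 i x)) t)))
          (trans (sortAt-or i _) (∨-introʳ {word P 0 i x i} (keeps P 0 i i x h (λ v _ a _ → <⇒≢ a))))) (n≤1+n i)))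

    Reaches : Bits → ℕ → Set
    Reaches x i = ∃ λ j → i ≤ j × j ≤ N × x j ≡ true

    reach-row : ∀ P x i → Reaches x (suc i) → Reaches (word P 0 N x) i
    reach-row P x i (suc j , s≤s i≤j , j≤ , h) with moves P j x h j≤
    ... | inj₁ t = j , i≤j , <⇒≤ j≤ , t
    ... | inj₂ t = suc j , m≤n⇒m≤1+n i≤j , j≤ , t

    reach-rows : ∀ S x i → Reaches x (S + i) → Reaches (rowsProduct B N S x) i
    reach-rows zero x i h = h
    reach-rows (suc S) x i h = reach-rows S _ i (reach-row (B S) x (S + i) h)

    module Full (r : ℕ) (r≤s : r ≤ s) where

      t = r + p

      t≤N : t ≤ N
      t≤N = ≤-trans (+-monoˡ-≤ p r≤s) (≤-reflexive (m+[n∸m]≡n (m≤n⇒m≤1+n s≤N₁)))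

      -- The block of ones moves left because a zero travels right: generator `lo` takes it from
      -- `lo` to `lo + 1`, until it reaches the end `t` of the block.
      hole : ∀ d lo x → (∀ i → t < i → x i ≡ false) → r ≤ lo → lo + d ≡ t → x lo ≡ false →
        (∀ i → t ≤ i → word (full r) lo d x i ≡ false)
      hole zero lo x h l e z i t≤i with m≤n⇒m<n∨m≡n t≤i
      ... | inj₁ lt = h i lt
      ... | inj₂ refl = trans (cong x (trans (sym e) (+-identityʳ lo))) z
      hole (suc d) lo x h l e z rewrite <ᵇ-true {r} {suc lo} (s≤s l) = hole d (suc lo) (sortAt lo x)
        (λ i lt → trans (sortAt-other lo x i (λ { refl → <⇒≱ lt (≤-trans (n≤1+n _) lo<t) }) (λ { refl → <⇒≱ lt lo<t })) (h i lt))
        (m≤n⇒m≤1+n l) e' (trans (sortAt-and lo x) (cong (_∧ x (suc lo)) z))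
        where
        e' = trans (sym (+-suc lo d)) e
        lo<t : lo < t
        lo<t = subst (lo <_) e (m<m+n lo (s≤s z≤n))

      beyond : ∀ P d lo x → t ≤ lo → (∀ i → t ≤ i → x i ≡ false) → ∀ i → t ≤ i → word P lo d x i ≡ false
      beyond P zero lo x l h = h
      beyond P (suc d) lo x l h = beyond P d (suc lo) _ (m≤n⇒m≤1+n l) h'
        where
        h' : ∀ i → t ≤ i → sortIf (P lo) lo x i ≡ false
        h' i ti with P lo
        ... | false = h i ti
        ... | true with i ≟ lo | i ≟ suc lo
        ...   | yes refl | _ = trans (sortAt-or lo x) (cong₂ _∨_ (h lo l) (h (suc lo) (m≤n⇒m≤1+n l)))
        ...   | no _ | yes refl = trans (sortAt-and lo x) (cong (_∧ x (suc lo)) (h lo l))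
        ...   | no a | no b = trans (sortAt-other lo x i a b) (h i ti)

      untouched : ∀ d lo x i → i < r → word (full r) lo d x i ≡ x i
      untouched zero lo x i l = refl
      untouched (suc d) lo x i l = trans (untouched d (suc lo) _ i l) first
        where
        first : sortIf (full r lo) lo x i ≡ x i
        first with bool-cases (full r lo)
        ... | inj₂ f rewrite f = refl
        ... | inj₁ q rewrite q = sortAt-other lo x i
              (λ { refl → <⇒≱ l (s≤s⁻¹ (<ᵇ-true⁻ {r} {suc lo} q)) }) (λ { refl → <⇒≱ (<-trans (n<1+n lo) l) (s≤s⁻¹ (<ᵇ-true⁻ {r} {suc lo} q)) })

      full-row : ∀ x → (∀ i → t < i → x i ≡ false) → (∀ i → i ≤ r → x i ≡ false) →
        (∀ i → t ≤ i → word (full r) 0 N x i ≡ false) × (∀ i → i < r → word (full r) 0 N x i ≡ false)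
      full-row x h z = (λ i ti → trans (cong (λ w → w i) split) (beyond (full r) (N ∸ t) t _ ≤-refl up-to-t i ti))
                     , (λ i l → trans (untouched N 0 x i l) (z i (<⇒≤ l)))
        where
        split : word (full r) 0 N x ≡ word (full r) t (N ∸ t) (word (full r) 0 t x)
        split = trans (cong (λ m → word (full r) 0 m x) (sym (m+[n∸m]≡n t≤N))) (word-append (full r) 0 t (N ∸ t) x)
        h₁ : ∀ i → r ≤ i → word (full r) 0 r x i ≡ x i
        h₁ i ri = cong (λ w → w i) (skip r 0 x ≤-refl)
          where
          skip : ∀ d lo x → lo + d ≤ r → word (full r) lo d x ≡ x
          skip zero lo x l = refl
          skip (suc d) lo x l rewrite <ᵇ-false {r} {suc lo} (≤-trans (m<m+n lo (s≤s z≤n)) l) =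
            skip d (suc lo) x (subst (_≤ r) (+-suc lo d) l)
        up-to-t : ∀ i → t ≤ i → word (full r) 0 t x i ≡ false
        up-to-t i ti = trans (cong (λ w → w i) (word-append (full r) 0 r p x))
          (hole p r _ (λ i lt → trans (h₁ i (≤-trans (m≤m+n r p) (<⇒≤ lt))) (h i lt)) ≤-refl refl
            (trans (h₁ r ≤-refl) (z r ≤-refl)) i ti)

    full-rows : ∀ S → S ≤ suc s → ∀ x → (∀ i → S + p ≤ i → x i ≡ false) → (∀ i → i < S → x i ≡ false) →
      ∀ i → p ≤ i → rowsProduct full N S x i ≡ false
    full-rows zero l x h z = h
    full-rows (suc S) (s≤s l) x h z = full-rows S (m≤n⇒m≤1+n l) _ (proj₁ step) (proj₂ step)
      where step = Full.full-row S l x (λ i lt → h i lt) (λ i le → z i (s≤s le))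

  detect : ∀ d → (∀ x → rowsProduct B N (suc s + d) x ≗ rowsProduct full N (suc s + d) x) → B s N₁ ≡ true
  detect d same with bool-cases (B s N₁)
  ... | inj₁ t = t
  -- If row `s` lacks `N₁`, the one in position `N = s + p` survives that row in place, and the `s`
  -- rows above leave a one in position `p` or later, where the staircase leaves zeros.
  ... | inj₂ f with reach-rows s (word (B s) 0 N x₀) p
         (N , ≤-reflexive (m+[n∸m]≡n (m≤n⇒m≤1+n s≤N₁)) , ≤-refl ,
          keeps (B s) 0 N N₁ x₀ (x₀-one (s≤s s≤N₁) ≤-refl) (λ { v _ _ t refl → absurd t f }))
  ...   | j , p≤j , _ , h = absurd h (trans
          (≗-sym (still B B-low d) j) (trans (same x₀ j) (trans
            (still full (λ r v _ q → s≤s⁻¹ (<ᵇ-true⁻ {r} {suc v} q)) d j)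
            (full-rows (suc s) ≤-refl x₀ high low j p≤j))))
    where
    high : ∀ i → suc s + p ≤ i → x₀ i ≡ false
    high i l = trans (cong ((s <ᵇ i) ∧_) (<ᵇ-false {i} {suc N} (≤-trans (≤-reflexive (cong suc (sym (m+[n∸m]≡n (m≤n⇒m≤1+n s≤N₁))))) l)))
                     (∧-zeroʳ _)
    low : ∀ i → i < suc s → x₀ i ≡ false
    low i l = cong (_∧ (i <ᵇ suc N)) (<ᵇ-false {s} {i} (s≤s⁻¹ l))

-- Staircases

stairs : ℕ → Shape
stairs i zero c = true
stairs i (suc r) zero = true
stairs i (suc r) (suc c) = (r + c) <ᵇ i

Lens-stairs : ∀ i → Lens (stairs i) (i ∸_)
Lens-stairs i = record
  { sound = λ { s zero h → refl
              ; s (suc c) h → <ᵇ-true (≤-trans (≤-reflexive (trans (sym (+-suc s c)) (+-comm s (suc c)))) (m≤n∸o⇒m+o≤n' s (suc c) h (s≤s z≤n))) }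
  ; complete = λ { s zero h → z≤n
                 ; s (suc c) h → m+n≤o⇒m≤o∸n (suc c) (≤-trans (≤-reflexive (cong suc (+-comm c s))) (<ᵇ-true⁻ {s + c} {i} h)) } }
  where
  m≤n∸o⇒m+o≤n' : ∀ s c → c ≤ i ∸ s → 1 ≤ c → c + s ≤ i
  m≤n∸o⇒m+o≤n' s c h p = ≤-trans (+-monoˡ-≤ s h) (≤-reflexive (m∸n+n≡m (<⇒≤ (m∸n≢0⇒n<m {i} {s} (λ z → <⇒≱ p (≤-trans h (≤-reflexive z)))))))

Lens-determine : ∀ {S S' ℓ ℓ'} → Partition S → Partition S' → Lens S ℓ → Lens S' ℓ' → (∀ s → ℓ s ≡ ℓ' s) → S ≐ S'
Lens-determine p p' l l' e zero c = trans (row0 p c) (sym (row0 p' c))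
Lens-determine {S} {S'} {ℓ} {ℓ'} p p' l l' e (suc r) c with bool-cases (S (suc r) c)
... | inj₁ h = trans h (sym (Lens.sound l' r c (subst (c ≤_) (e r) (Lens.complete l r c h))))
... | inj₂ h = trans h (sym (¬true⇒false (λ h' → absurd (Lens.sound l r c (subst (c ≤_) (sym (e r)) (Lens.complete l' r c h'))) h)))

stairs-partition : ∀ i → Partition (stairs i)
stairs-partition i = record
  { row0 = λ _ → refl ; col0 = λ { zero → refl ; (suc r) → refl }
  ; upward = λ { zero c h → refl ; (suc r) zero h → refl
               ; (suc r) (suc c) h → <ᵇ-true {r + c} {i} (<-trans (n<1+n (r + c)) (<ᵇ-true⁻ {suc (r + c)} {i} h)) }
  ; leftward = λ { zero c h → refl ; (suc r) zero h → refl
                 ; (suc r) (suc c) h → <ᵇ-true {r + c} {i} (<-trans (≤-reflexive (sym (+-suc r c))) (<ᵇ-true⁻ {r + suc c} {i} h)) } }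

module Rows {n m k : ℕ} {G : ℕ → ℕ → Shape} (g : Growth n m k G) where

  open Growth g public

  len : ℕ → ℕ → ℕ → ℕ
  len i a s = lenUpTo (G i a) n s

  lens : ∀ {i a} → i ≤ m → a ≤ k → Lens (G i a) (len i a)
  lens p q = Lens-of (part p q) (bdd p q)

  len-zero : ∀ {i a} → i ≤ m → a ≤ k → ∀ s → n ≤ s → len i a s ≡ 0
  len-zero p q = Lens-zero (bdd p q) (lens p q)

  rowSquare : ∀ {i a} → i < m → a < k → RowSquare (len i a) (len (suc i) a) (len (suc i) (suc a)) (len i (suc a))
  rowSquare p q = square-rows (part (<⇒≤ p) (<⇒≤ q)) (part p (<⇒≤ q)) (part p q) (part (<⇒≤ p) q)
    (lens (<⇒≤ p) (<⇒≤ q)) (lens p (<⇒≤ q)) (lens p q) (lens (<⇒≤ p) q) (sq p q)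

  hecke : ∀ N S → N ≤ m → n ≤ S → ∀ a → a ≤ k → ∀ x →
    rowsProduct (gains (λ v → len v 0)) N S x ≗ rowsProduct (gains (λ v → len v a)) N S x
  hecke N S N≤ n≤ zero q x i = refl
  hecke N S N≤ n≤ (suc a) q x = hecke N S N≤ n≤ a (<⇒≤ q) x ⨾
    HeckeInvariance.invariant N (λ v → len v a) (λ v → len v (suc a))
      (λ v v< → rowSquare (≤-trans v< N≤) q) S
      (λ v v≤ → len-zero (≤-trans v≤ N≤) (<⇒≤ q) S n≤)
      (λ v v≤ → len-zero (≤-trans v≤ N≤) q S n≤) x

  len-stairs : ∀ {i a} → i ≤ m → a ≤ k → G i a ≐ stairs i → ∀ s → len i a s ≡ i ∸ s
  len-stairs {i} p q e = Lens-cong e (lens p q) (Lens-stairs i)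

gains-stairs : ∀ r v → (v ∸ r <ᵇ suc v ∸ r) ≡ (r <ᵇ suc v)
gains-stairs r v with r ≤? v
... | yes h = trans (<ᵇ-true (≤-reflexive (sym (+-∸-assoc 1 h)))) (sym (<ᵇ-true (s≤s h)))
... | no h = trans (<ᵇ-false (≤-trans (≤-reflexive (m≤n⇒m∸n≡0 (≰⇒> h))) z≤n)) (sym (<ᵇ-false (≰⇒> h)))

-- The row products at the two left edges agree because those at the right edges do, and the
-- staircase can be read off its row products.
module UniqueRectification {n m k k' : ℕ} {G G' : ℕ → ℕ → Shape} (g : Growth n m k G) (g' : Growth n m k' G')
  (left : ∀ i → i ≤ m → G i 0 ≐ stairs i) (right : ∀ i → i ≤ m → G i k ≐ G' i k')
  (empty : G' 0 0 ≐ stairs 0) where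

  private
    module A = Rows g
    module B = Rows g'

    strip : ∀ v → v < m → Strip (G' v 0) (G' (suc v) 0)
    strip v l = B.level l z≤n

    -- A level adds at most one box to the top row, and by interlacing any other row is at most as
    -- long as the row above it was one level earlier.
    bound : ∀ v → v ≤ m → ∀ s → B.len v 0 s ≤ v ∸ s
    bound zero l s = ≤-reflexive (B.len-stairs l z≤n empty s)
    bound (suc v) l zero with strip-step (B.part (<⇒≤ l) z≤n) (B.part l z≤n) (B.lens (<⇒≤ l) z≤n) (B.lens l z≤n) (strip v l) 0
    ... | inj₁ e = ≤-trans (≤-reflexive e) (m≤n⇒m≤1+n (bound v (<⇒≤ l) 0))
    ... | inj₂ e = ≤-trans (≤-reflexive e) (s≤s (bound v (<⇒≤ l) 0))
    bound (suc v) l (suc s) = ≤-trans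
      (strip-inter (B.part (<⇒≤ l) z≤n) (B.part l z≤n) (B.lens (<⇒≤ l) z≤n) (B.lens l z≤n) (strip v l) s)
      (bound v (<⇒≤ l) s)

    same : ∀ N S → N ≤ m → n ≤ S → ∀ x →
      rowsProduct (gains (λ v → B.len v 0)) N S x ≗ rowsProduct (λ r v → r <ᵇ suc v) N S x
    same N S N≤ n≤ x = B.hecke N S N≤ n≤ k' ≤-refl x ⨾ middle ⨾ ≗-sym (A.hecke N S N≤ n≤ k ≤-refl x) ⨾ last
      where
      middle : rowsProduct (gains (λ v → B.len v k')) N S x ≗ rowsProduct (gains (λ v → A.len v k)) N S x
      middle i = cong (λ w → w i) (rowsProduct-cong _ _ N S x (λ s v l → cong₂ _<ᵇ_
        (Lens-cong (≐-sym (right v (≤-trans (<⇒≤ l) N≤))) (B.lens (≤-trans (<⇒≤ l) N≤) ≤-refl) (A.lens (≤-trans (<⇒≤ l) N≤) ≤-refl) s)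
        (Lens-cong (≐-sym (right (suc v) (≤-trans l N≤))) (B.lens (≤-trans l N≤) ≤-refl) (A.lens (≤-trans l N≤) ≤-refl) s)))
      last : rowsProduct (gains (λ v → A.len v 0)) N S x ≗ rowsProduct (λ r v → r <ᵇ suc v) N S x
      last i = cong (λ w → w i) (rowsProduct-cong _ _ N S x (λ s v l → trans (cong₂ _<ᵇ_
        (A.len-stairs (≤-trans (<⇒≤ l) N≤) z≤n (left v (≤-trans (<⇒≤ l) N≤)) s)
        (A.len-stairs (≤-trans l N≤) z≤n (left (suc v) (≤-trans l N≤)) s)) (gains-stairs s v)))

    low : ∀ r v → suc v ≤ m → gains (λ v → B.len v 0) r v ≡ true → r ≤ v
    low r v l h with r ≤? v
    ... | yes q = q
    ... | no q = ⊥-elim (<⇒≱ (<ᵇ-true⁻ {B.len v 0 r} h)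
                   (≤-trans (bound (suc v) l r) (≤-trans (≤-reflexive (m≤n⇒m∸n≡0 (≰⇒> q))) z≤n)))

    -- Below the diagonal the bound is 0. Elsewhere `Detection` on the first `v + 1` levels yields
    -- the gain of row `s` at level `v`. Taking `suc s + n` rows includes all nonempty ones, as
    -- `hecke` requires.
    exact : ∀ v → v ≤ m → ∀ s → B.len v 0 s ≡ v ∸ s
    exact zero l s = B.len-stairs l z≤n empty s
    exact (suc v) l s with s ≤? v
    ... | no q = trans (n≤0⇒n≡0 (≤-trans (bound (suc v) l s) (≤-reflexive z))) (sym z)
      where z = m≤n⇒m∸n≡0 (≰⇒> q)
    ... | yes q = ≤-antisym (bound (suc v) l s) (≤-trans (≤-reflexive (trans (+-∸-assoc 1 q) (cong suc (sym (exact v (<⇒≤ l) s)))))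
          (<ᵇ-true⁻ {B.len v 0 s} (Detection.detect v s q _ (λ r u u< → low r u (≤-trans u< l)) n
            (same (suc v) (suc s + n) l (m≤n+m n (suc s))))))

  left-stairs : ∀ i → i ≤ m → G' i 0 ≐ stairs i
  left-stairs i l = Lens-determine (B.part l z≤n) (stairs-partition i) (B.lens l z≤n) (Lens-stairs i) (exact i l)

-- By the symmetry of the rule, α is determined by β, δ and γ just as δ is by β, α and γ. So a
-- diagram can be filled from its bottom and right edges.
growth-determined : ∀ {n m k G H} → Growth n m k G → Growth n m k H →
  (∀ a → a ≤ k → G 0 a ≐ H 0 a) → (∀ i → i ≤ m → G i k ≐ H i k) → ∀ i a → i ≤ m → a ≤ k → G i a ≐ H i a
growth-determined {m = m} {k} {G} {H} g h bot right zero a p q = bot a q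
growth-determined {m = m} {k} {G} {H} g h bot right (suc i) a p q =
  go (k ∸ a) a (m+[n∸m]≡n q)
  where
  go : ∀ d a → a + d ≡ k → G (suc i) a ≐ H (suc i) a
  go zero a e = subst (λ z → G (suc i) z ≐ H (suc i) z) (trans (sym e) (+-identityʳ a)) (right (suc i) p)
  go (suc d) a e = Square-unique (Square-cong (IH a (<⇒≤ a<k)) (IH (suc a) a<k) (go d (suc a) (trans (sym (+-suc a d)) e)) (λ _ _ → refl)
      (Square-sym (Growth.sq g p a<k))) (Square-sym (Growth.sq h p a<k))
    where
    IH = λ a q → growth-determined g h bot right i a (<⇒≤ p) q
    a<k : a < k
    a<k = subst (a <_) e (m<m+n a (s≤s z≤n))

-- Chain lengths along a diagram

Λ-recut : ∀ S C g → S ≤ C → (∀ t s → S ≤ s → g t s ≡ 0) → ∀ t s → Λ C g t s ≡ Λ S g t s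
Λ-recut S C g l z zero s = refl
Λ-recut S C g l z (suc t) s = go (S ∸ s) s refl
  where
  go : ∀ d s → S ∸ s ≡ d → Λ C g (suc t) s ≡ Λ S g (suc t) s
  go zero s e = trans (Λ-zero-rows C g S z (suc t) s (m∸n≡0⇒m≤n e)) (sym (Λ-cut S g (suc t) s (m∸n≡0⇒m≤n e)))
  go (suc d) s e = trans (Λ-suc C g t s (≤-trans s<S l)) (trans
      (cong₂ _⊔_ (cong (_+ (g (suc t) s ∸ g t s)) (Λ-recut S C g l z t s))
                 (go d (suc s) (suc-injective (trans (sym (+-∸-assoc 1 s<S)) e))))
      (sym (Λ-suc S g t s s<S)))
    where
    s<S : s < S
    s<S = m∸n≢0⇒n<m (λ q → 0≢1+n (trans (sym q) e))

module Chains {n m k : ℕ} {G : ℕ → ℕ → Shape} (g : Growth n m k G) where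

  open Rows g

  -- Longest chains in all rows, on letters a₀ + 1 , … , a₀ + t.
  chainLength : ℕ → ℕ → ℕ → ℕ
  chainLength i a₀ t = Λ n (λ u → len i (a₀ + u)) t 0

  private
    -- `Λ-recut` and `Λ-zero-rows` ask for empty rows at every index, while the diagram is
    -- controlled up to column `k`. The shapes are therefore frozen after letter `a₀ + t`.
    clamp : ℕ → ℕ → ℕ → ℕ → ℕ → ℕ
    clamp i a₀ t u s = len i (a₀ + (u ⊓ t)) s

    unclamp : ∀ C i a₀ t s → Λ C (clamp i a₀ t) t s ≡ Λ C (λ u → len i (a₀ + u)) t s
    unclamp C i a₀ t = Λ-cong C _ _ t (λ u s u≤ _ → cong (λ z → len i (a₀ + z) s) (m≤n⇒m⊓n≡m u≤))

    clamp-zero : ∀ i a₀ t → i ≤ m → a₀ + t ≤ k → ∀ u s → n ≤ s → clamp i a₀ t u s ≡ 0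
    clamp-zero i a₀ t p q u s l = len-zero p (≤-trans (+-monoʳ-≤ a₀ (m⊓n≤n u t)) q) s l

  -- Transport preserves the value in row 0. The cut is placed at `n`, where all rows are empty and
  -- both sides of the boundary condition are 0.
  chainLength-step : ∀ i a₀ t → i < m → a₀ + t ≤ k → chainLength (suc i) a₀ t ≡ chainLength i a₀ t
  chainLength-step i a₀ t p q = begin
    Λ n (λ u → len (suc i) (a₀ + u)) t 0 ≡⟨ sym (unclamp n (suc i) a₀ t 0) ⟩
    Λ n h t 0                            ≡⟨ sym (Λ-recut n (2 + n) h (m≤n+m n 2) hz t 0) ⟩
    Λ (2 + n) h t 0                      ≡⟨ proj₁ (Λ-transport b h t n sqs (λ u _ → trans (Λ-zero-rows (2 + n) h n hz u (suc n) (n≤1+n n))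
                                              (sym (trans (cong (_∸ (b u n ∸ h u (suc n))) (Λ-zero-rows (suc n) b n bz u n ≤-refl)) (0∸n≡0 (b u n ∸ h u (suc n)))))) t ≤-refl) ⟩
    Λ (1 + n) b t 0                      ≡⟨ Λ-recut n (1 + n) b (n≤1+n n) bz t 0 ⟩
    Λ n b t 0                            ≡⟨ unclamp n i a₀ t 0 ⟩
    Λ n (λ u → len i (a₀ + u)) t 0 ∎
    where
    open ≡-Reasoning
    h = clamp (suc i) a₀ t
    b = clamp i a₀ t
    hz = clamp-zero (suc i) a₀ t p q
    bz = clamp-zero i a₀ t (<⇒≤ p) q
    sqs : ∀ u → u < t → RowSquare (b u) (h u) (h (suc u)) (b (suc u))
    sqs u l rewrite m≤n⇒m⊓n≡m (<⇒≤ l) | m≤n⇒m⊓n≡m l | +-suc a₀ u =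
      rowSquare p (≤-trans (≤-trans (≤-reflexive (sym (+-suc a₀ u))) (+-monoʳ-≤ a₀ l)) q)

  chainLength-bottom : ∀ i a₀ t → i ≤ m → a₀ + t ≤ k → chainLength i a₀ t ≡ chainLength 0 a₀ t
  chainLength-bottom zero a₀ t p q = refl
  chainLength-bottom (suc i) a₀ t p q = trans (chainLength-step i a₀ t p q) (chainLength-bottom i a₀ t (<⇒≤ p) q)

  module Cut (left : ∀ i → i ≤ m → G i 0 ≐ stairs i) where

    -- Longest chains of the skew tableau of inner shape σ_{p + j} in the rows s + 1 , … , j + 1.
    cutLength : ℕ → ℕ → ℕ → ℕ
    cutLength p j s = Λ (suc j) (len (p + j)) k s

    private
      mono : ∀ {i u} → i ≤ m → u < k → ∀ s → len i u s ≤ len i (suc u) s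
      mono l q s = Lens.complete (lens l q) s _
        (sub (letter l q) (suc s , _) (Lens.sound (lens l (<⇒≤ q)) s _ ≤-refl))

      clampᵏ : ℕ → ℕ → ℕ → ℕ
      clampᵏ i u s = len i (u ⊓ k) s

      unclampᵏ : ∀ C i s → Λ C (clampᵏ i) k s ≡ Λ C (len i) k s
      unclampᵏ C i = Λ-cong C _ _ k (λ u s u≤ _ → cong (λ z → len i z s) (m≤n⇒m⊓n≡m u≤))

      mono' : ∀ {i} → i ≤ m → ∀ s u → clampᵏ i u s ≤ clampᵏ i (suc u) s
      mono' {i} l s u with suc u ≤? k
      ... | yes q rewrite m≤n⇒m⊓n≡m q | m≤n⇒m⊓n≡m (<⇒≤ q) = mono l q s
      ... | no q rewrite m≥n⇒m⊓n≡n (s≤s⁻¹ (≰⇒> q)) | m≥n⇒m⊓n≡n (m≤n⇒m≤1+n (s≤s⁻¹ (≰⇒> q))) = ≤-refl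

      start : ∀ p j → p + j ≤ m → len (p + j) 0 j ≡ p
      start p j l = trans (len-stairs l z≤n (left (p + j) l) j) (m+n∸n≡m p j)

    cutLength-zero : ∀ p → p ≤ m → cutLength p 0 0 ≡ len p k 0 ∸ p
    cutLength-zero p l rewrite +-identityʳ p =
      trans (Λ-last-row 0 (len p) k (λ u q → mono l q 0))
        (cong (len p k 0 ∸_) (len-stairs l z≤n (left p l) 0))

    cutLength-transport : ∀ p j → suc (p + j) ≤ m →
      Transport (cutLength p j) (cutLength p (suc j)) (len (p + j) k) (len (p + suc j) k)
    cutLength-transport p j l = subst (λ z → Transport (cutLength p j) (λ s → Λ (2 + j) (len z) k s) (len (p + j) k) (len z k))
      (sym (+-suc p j)) tr
      where
      i = p + j
      l' : suc i ≤ m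
      l' = l
      b = clampᵏ i
      h = clampᵏ (suc i)
      sqs : ∀ u → u < k → RowSquare (b u) (h u) (h (suc u)) (b (suc u))
      sqs u q rewrite m≤n⇒m⊓n≡m q | m≤n⇒m⊓n≡m (<⇒≤ q) = rowSquare l' q
      inter : ∀ u → h u (suc j) ≤ b u j
      inter u = strip-inter (part (<⇒≤ l') (m⊓n≤n u k)) (part l' (m⊓n≤n u k)) (lens (<⇒≤ l') (m⊓n≤n u k))
        (lens l' (m⊓n≤n u k)) (level l' (m⊓n≤n u k)) j
      b0 : b 0 j ≡ p
      b0 = start p j (<⇒≤ l')
      h0 : h 0 (suc j) ≡ p
      h0 = trans (cong (λ z → len z 0 (suc j)) (sym (+-suc p j))) (start p (suc j) (subst (_≤ m) (sym (+-suc p j)) l'))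
      grown : ∀ u → p ≤ h u (suc j)
      grown zero = ≤-reflexive (sym h0)
      grown (suc u) = ≤-trans (grown u) (mono' l' (suc j) u)
      arith : ∀ B H → p ≤ H → H ≤ B → H ∸ p ≡ (B ∸ p) ∸ (B ∸ H)
      arith B H pH HB = sym (trans (∸-+-assoc B p (B ∸ H)) (trans (cong (B ∸_) (+-comm p (B ∸ H)))
        (trans (sym (∸-+-assoc B (B ∸ H) p)) (cong (_∸ p) (m∸[m∸n]≡n HB)))))
      -- Only the lowest row is involved, and it starts after column `p` on both levels. So
      -- `Λ-last-row` gives differences of row lengths with the same subtrahend `p`.
      boundary : ∀ u → u ≤ k → Λ (2 + j) h u (suc j) ≡ Λ (suc j) b u j ∸ (b u j ∸ h u (suc j))
      boundary u _ = trans (Λ-last-row (suc j) h u (λ v _ → mono' l' (suc j) v)) (trans (cong (h u (suc j) ∸_) h0)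
        (trans (arith (b u j) (h u (suc j)) (grown u) (inter u))
          (cong (_∸ (b u j ∸ h u (suc j))) (sym (trans (Λ-last-row j b u (λ v _ → mono' (<⇒≤ l') j v)) (cong (b u j ∸_) b0))))))
      raw = Λ-transport b h k j sqs boundary k ≤-refl
      tr : Transport (λ s → Λ (suc j) (len i) k s) (λ s → Λ (2 + j) (len (suc i)) k s) (len i k) (len (suc i) k)
      tr = trans (sym (unclampᵏ (2 + j) (suc i) 0)) (trans (proj₁ raw) (unclampᵏ (suc j) i 0)) ,
        λ s → trans (sym (unclampᵏ (2 + j) (suc i) (suc s))) (trans (proj₂ raw s)
          (cong₂ _⊔_ (unclampᵏ (suc j) i (suc s)) (cong₂ _∸_ (unclampᵏ (suc j) i s)
             (cong₂ _∸_ (cong (λ z → len i z s) (m≤n⇒m⊓n≡m ≤-refl)) (cong (λ z → len (suc i) z (suc s)) (m≤n⇒m⊓n≡m ≤-refl))))))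

-- `cutLength-zero` and `cutLength-transport` compute the cuts from row lengths in the last column
-- alone, and these agree for the two diagrams.
cutLength-determined : ∀ {n m k k' G H} (g : Growth n m k G) (h : Growth n m k' H)
  (left : ∀ i → i ≤ m → G i 0 ≐ stairs i) (left' : ∀ i → i ≤ m → H i 0 ≐ stairs i) →
  (∀ i → i ≤ m → G i k ≐ H i k') → ∀ p j s → p + j ≤ m →
  Chains.Cut.cutLength g left p j s ≡ Chains.Cut.cutLength h left' p j s
cutLength-determined {n} {m} {k} {k'} g h left left' right = go
  where
  module A = Chains g
  module B = Chains h
  module AC = A.Cut left
  module BC = B.Cut left'
  module RA = Rows g
  module RB = Rows h
  same : ∀ i → i ≤ m → ∀ s → RA.len i k s ≡ RB.len i k' s
  same i l = Lens-cong (right i l) (RA.lens l ≤-refl) (RB.lens l ≤-refl)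
  go : ∀ p j s → p + j ≤ m → AC.cutLength p j s ≡ BC.cutLength p j s
  go p zero zero l = trans (AC.cutLength-zero p l') (trans (cong (_∸ p) (same p l' 0)) (sym (BC.cutLength-zero p l')))
    where l' = subst (_≤ m) (+-identityʳ p) l
  go p zero (suc s) l = trans (Λ-cut 1 (RA.len (p + 0)) k (suc s) (s≤s z≤n)) (sym (Λ-cut 1 (RB.len (p + 0)) k' (suc s) (s≤s z≤n)))
  go p (suc j) zero l = trans (proj₁ (AC.cutLength-transport p j l')) (trans (go p j 0 (<⇒≤ l')) (sym (proj₁ (BC.cutLength-transport p j l'))))
    where l' = subst (_≤ m) (+-suc p j) l
  go p (suc j) (suc s) l = trans (proj₂ (AC.cutLength-transport p j l') s) (trans
      (cong₂ _⊔_ (go p j (suc s) (<⇒≤ l')) (cong₂ _∸_ (go p j s (<⇒≤ l')) (cong₂ _∸_ (same (p + j) (<⇒≤ l') s) (same (p + suc j) l (suc s)))))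
      (sym (proj₂ (BC.cutLength-transport p j l') s)))
    where l' = subst (_≤ m) (+-suc p j) l

-- Slides of dots

infix 1 _⟺_
_⟺_ : Set → Set → Set
A ⟺ B = (A → B) × (B → A)

any-true⁻ : {A : Set} (p : A → Bool) (xs : List A) → any p xs ≡ true → ∃ λ x → x ∈ xs × p x ≡ true
any-true⁻ p (x ∷ xs) h with ∨-true {p x} h
... | inj₁ t = x , here refl , t
... | inj₂ t with any-true⁻ p xs t
...   | y , m , q = y , there m , q

any-true⁺ : {A : Set} (p : A → Bool) {xs : List A} {x : A} → x ∈ xs → p x ≡ true → any p xs ≡ true
any-true⁺ p (here refl) h = ∨-introˡ h
any-true⁺ p {y ∷ _} (there m) h = ∨-introʳ {p y} (any-true⁺ p m h)

all-true⁻ : {A : Set} (p : A → Bool) (xs : List A) → all p xs ≡ true → ∀ {x} → x ∈ xs → p x ≡ true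
all-true⁻ p (x ∷ xs) h (here refl) = proj₁ (∧-true {p x} h)
all-true⁻ p (x ∷ xs) h (there m) = all-true⁻ p xs (proj₂ (∧-true {p x} h)) m

all-true⁺ : {A : Set} (p : A → Bool) (xs : List A) → (∀ {x} → x ∈ xs → p x ≡ true) → all p xs ≡ true
all-true⁺ p [] h = refl
all-true⁺ p (x ∷ xs) h = ∧-intro (h (here refl)) (all-true⁺ p xs (h ∘ there))

∈-filterᵇ⁻ : {A : Set} (p : A → Bool) (xs : List A) {x : A} → x ∈ filterᵇ p xs → x ∈ xs × p x ≡ true
∈-filterᵇ⁻ p (y ∷ xs) m with p y in e
∈-filterᵇ⁻ p (y ∷ xs) (here refl) | true = here refl , e
∈-filterᵇ⁻ p (y ∷ xs) (there m) | true with ∈-filterᵇ⁻ p xs m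
... | q , t = there q , t
∈-filterᵇ⁻ p (y ∷ xs) m | false with ∈-filterᵇ⁻ p xs m
... | q , t = there q , t

∈-filterᵇ⁺ : {A : Set} (p : A → Bool) {xs : List A} {x : A} → x ∈ xs → p x ≡ true → x ∈ filterᵇ p xs
∈-filterᵇ⁺ p {x ∷ xs} (here refl) t rewrite t = here refl
∈-filterᵇ⁺ p {y ∷ xs} (there m) t with p y
... | true = there (∈-filterᵇ⁺ p m t)
... | false = ∈-filterᵇ⁺ p m t

≡ᵇ-true : ∀ {m n} → m ≡ n → (m ≡ᵇ n) ≡ true
≡ᵇ-true {m} {n} e = Equivalence.to T-≡ (≡⇒≡ᵇ m n e)

≡ᵇ-true⁻ : ∀ m n → (m ≡ᵇ n) ≡ true → m ≡ n
≡ᵇ-true⁻ m n h = ≡ᵇ⇒≡ m n (Equivalence.from T-≡ h)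

≡ᵇ-false : ∀ {m n} → m ≢ n → (m ≡ᵇ n) ≡ false
≡ᵇ-false {m} {n} ne = ¬true⇒false (ne ∘ ≡ᵇ-true⁻ m n)

boxEq-true : ∀ {b b'} → b ≡ b' → boxEq b b' ≡ true
boxEq-true {r , c} refl = ∧-intro (≡ᵇ-true {r} refl) (≡ᵇ-true {c} refl)

boxEq-true⁻ : ∀ b b' → boxEq b b' ≡ true → b ≡ b'
boxEq-true⁻ (r , c) (r' , c') h with ∧-true {r ≡ᵇ r'} h
... | p , q = cong₂ _,_ (≡ᵇ-true⁻ r r' p) (≡ᵇ-true⁻ c c' q)

hasEntry-true⁻ : ∀ T b i → hasEntry T b i ≡ true → (b , i) ∈ T
hasEntry-true⁻ T b i h with any-true⁻ _ T h
... | (b' , e) , m , t with ∧-true {boxEq b b'} t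
...   | p , q with boxEq-true⁻ b b' p | ≡ᵇ-true⁻ e i q
...     | refl | refl = m

hasEntry-true⁺ : ∀ T b i → (b , i) ∈ T → hasEntry T b i ≡ true
hasEntry-true⁺ T b i m = any-true⁺ _ m (∧-intro (boxEq-true {b} refl) (≡ᵇ-true {i} refl))

∈-boxes⁻ : ∀ T b → b ∈ boxes T → ∃ λ e → (b , e) ∈ T
∈-boxes⁻ T b m with ∈-map⁻ proj₁ m
... | (b' , e) , m' , refl = e , m'

∈-boxes⁺ : ∀ {T b e} → (b , e) ∈ T → b ∈ boxes T
∈-boxes⁺ m = ∈-map⁺ proj₁ m

∈-boxesWith : ∀ i T b → (b ∈ boxesWith i T) ⟺ ((b , i) ∈ T)
∈-boxesWith i T b = to , λ m → ∈-boxes⁺ (∈-filterᵇ⁺ _ m (≡ᵇ-true {i} refl))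
  where
  to : b ∈ boxesWith i T → (b , i) ∈ T
  to m with ∈-boxes⁻ _ b m
  ... | e , m' with ∈-filterᵇ⁻ _ T m'
  ...   | m'' , t with ≡ᵇ-true⁻ e i t
  ...     | refl = m''

module SwapStep (n1 n2 : Box → Box) (i : ℕ) (ds : List Box) (U : Tab) where

  Adjacent : Box → Set
  Adjacent d = (n1 d , i) ∈ U ⊎ (n2 d , i) ∈ U

  NearDot : Box → Set
  NearDot b = ∃ λ d → d ∈ ds × (b ≡ n1 d ⊎ b ≡ n2 d)

  private
    adj : Box → Bool
    adj d = hasEntry U (n1 d) i ∨ hasEntry U (n2 d) i
    near : Box → Bool
    near b = any (λ d → boxEq b (n1 d) ∨ boxEq b (n2 d)) ds
    becomes : Box × ℕ → Bool
    becomes p = (proj₂ p ≡ᵇ i) ∧ near (proj₁ p)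

    adj⁻ : ∀ d → adj d ≡ true → Adjacent d
    adj⁻ d h with ∨-true {hasEntry U (n1 d) i} h
    ... | inj₁ t = inj₁ (hasEntry-true⁻ U _ i t)
    ... | inj₂ t = inj₂ (hasEntry-true⁻ U _ i t)

    adj⁺ : ∀ d → Adjacent d → adj d ≡ true
    adj⁺ d (inj₁ m) = ∨-introˡ (hasEntry-true⁺ U _ i m)
    adj⁺ d (inj₂ m) = ∨-introʳ {hasEntry U (n1 d) i} (hasEntry-true⁺ U _ i m)

    near⁻ : ∀ b → near b ≡ true → NearDot b
    near⁻ b h with any-true⁻ _ ds h
    ... | d , m , t with ∨-true {boxEq b (n1 d)} t
    ...   | inj₁ t' = d , m , inj₁ (boxEq-true⁻ b _ t')
    ...   | inj₂ t' = d , m , inj₂ (boxEq-true⁻ b _ t')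

    near⁺ : ∀ b → NearDot b → near b ≡ true
    near⁺ b (d , m , inj₁ e) = any-true⁺ _ m (∨-introˡ (boxEq-true e))
    near⁺ b (d , m , inj₂ e) = any-true⁺ _ m (∨-introʳ {boxEq b (n1 d)} (boxEq-true e))

  step : List Box × Tab
  step = swapStep n1 n2 i (ds , U)

  dots-spec : ∀ b → (b ∈ proj₁ step) ⟺ ((b ∈ ds × ¬ Adjacent b) ⊎ ((b , i) ∈ U × NearDot b))
  dots-spec b = to , from
    where
    to : b ∈ proj₁ step → _
    to m with ∈-++⁻ (filterᵇ (λ d → not (adj d)) ds) m
    ... | inj₁ m' with ∈-filterᵇ⁻ _ ds m'
    ...   | p , t = inj₁ (p , λ a → absurd (adj⁺ b a) (not-true t))
    to m | inj₂ m' with ∈-boxes⁻ _ b m'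
    ... | e , m'' with ∈-filterᵇ⁻ becomes U m''
    ...   | p , t with ∧-true {e ≡ᵇ i} t
    ...     | q , q' with ≡ᵇ-true⁻ e i q
    ...       | refl = inj₂ (p , near⁻ b q')
    from : _ → b ∈ proj₁ step
    from (inj₁ (m , na)) = ∈-++⁺ˡ (∈-filterᵇ⁺ (λ d → not (adj d)) m (cong not (¬true⇒false (na ∘ adj⁻ b))))
    from (inj₂ (m , nd)) = ∈-++⁺ʳ (filterᵇ (λ d → not (adj d)) ds)
      (∈-boxes⁺ (∈-filterᵇ⁺ becomes m (∧-intro (≡ᵇ-true {i} refl) (near⁺ b nd))))

  tab-spec : ∀ b e → ((b , e) ∈ proj₂ step) ⟺
    (((b , e) ∈ U × ¬ (e ≡ i × NearDot b)) ⊎ (e ≡ i × b ∈ ds × Adjacent b))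
  tab-spec b e = to , from
    where
    to : (b , e) ∈ proj₂ step → _
    to m with ∈-++⁻ (filterᵇ (λ p → not (becomes p)) U) m
    ... | inj₁ m' with ∈-filterᵇ⁻ _ U m'
    ...   | p , t = inj₁ (p , λ { (refl , nd) → absurd (∧-intro (≡ᵇ-true {i} refl) (near⁺ b nd)) (not-true t) })
    to m | inj₂ m' with ∈-map⁻ (λ d → (d , i)) m'
    ... | d , m'' , refl with ∈-filterᵇ⁻ adj ds m''
    ...   | p , t = inj₂ (refl , p , adj⁻ b t)
    from : _ → (b , e) ∈ proj₂ step
    from (inj₁ (m , nb)) = ∈-++⁺ˡ (∈-filterᵇ⁺ (λ p → not (becomes p)) m (cong not (¬true⇒false nope)))
      where
      nope : becomes (b , e) ≡ true → ⊥
      nope t with ∧-true {e ≡ᵇ i} t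
      ... | q , q' = nb (≡ᵇ-true⁻ e i q , near⁻ b q')
    from (inj₂ (refl , m , a)) = ∈-++⁺ʳ (filterᵇ (λ p → not (becomes p)) U)
      (∈-map⁺ (λ d → (d , i)) (∈-filterᵇ⁺ adj m (adj⁺ b a)))

module SquareBoxes {β α γ δ : Shape} (pβ : Partition β) (pα : Partition α) (q : Square β α γ δ) where

  Linked : Box → Set
  Linked b = ∃ λ b' → Adj b b' × Diff β γ b'

  inner⇒ : ∀ {b} → Diff β α b → Diff β γ b
  inner⇒ {b} = Diff-widenˡ {β} {α} {γ} {b} (αγ q)

  outer⇒ : ∀ {b} → Diff α γ b → Diff β γ b
  outer⇒ {b} = Diff-widenʳ {β} {α} {γ} {b} (βα q)

  split : ∀ {b} → Diff β γ b → Diff β α b ⊎ Diff α γ b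
  split {b} (p , r) with bool-cases (at α b)
  ... | inj₁ h = inj₁ (h , r)
  ... | inj₂ h = inj₂ (p , h)

  -- The left and upper neighbours of a box of α/β lie in α, so the rook condition leaves only boxes
  -- of γ/α to the right and below. Hence a dot that looks right and below sees every box to which
  -- it is linked.
  inner-neighbour : ∀ {b b'} → Diff β α b → Adj b b' → Diff β γ b' → Diff α γ b' × (b' ≡ right b ⊎ b' ≡ below b)
  inner-neighbour {b} {b'} d a d' with split {b'} d'
  ... | inj₁ x = ⊥-elim (rook (βα q) a d x)
  inner-neighbour d toRight d' | inj₂ x = x , inj₁ refl
  inner-neighbour d toBelow d' | inj₂ x = x , inj₂ refl
  inner-neighbour (d , _) (toLeft {r} {c}) d' | inj₂ (_ , x) = absurd (leftward pα r c d) x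
  inner-neighbour (d , _) (toAbove {r} {c}) d' | inj₂ (_ , x) = absurd (upward pα r c d) x

  outer-neighbour : ∀ {b b'} → Diff α γ b → Adj b b' → Diff β γ b' →
    Diff β α b' × (b ≡ right b' ⊎ b ≡ below b') × (b' ≡ above b ⊎ b' ≡ left b)
  outer-neighbour {b} {b'} d a d' with split {b'} d'
  ... | inj₂ x = ⊥-elim (rook (αγ q) a d x)
  outer-neighbour (_ , d) (toRight {r} {c}) d' | inj₁ (x , _) = absurd (leftward pα r c x) d
  outer-neighbour (_ , d) (toBelow {r} {c}) d' | inj₁ (x , _) = absurd (upward pα r c x) d
  outer-neighbour d toLeft d' | inj₁ x = x , inj₁ refl , inj₂ refl
  outer-neighbour d toAbove d' | inj₁ x = x , inj₂ refl , inj₁ refl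

  right-adj : ∀ b → Adj b (right b)
  right-adj (r , c) = toRight

  below-adj : ∀ b → Adj b (below b)
  below-adj (r , c) = toBelow

  -- `above` truncates at row 0, but row 0 lies in β and so contains no box of γ/β.
  above-adj : ∀ {b} → Diff β γ b → Adj b (above b)
  above-adj {zero , c} (_ , h) = absurd (row0 pβ c) h
  above-adj {suc r , c} _ = toAbove

  left-adj : ∀ {b} → Diff β γ b → Adj b (left b)
  left-adj {r , zero} (_ , h) = absurd (col0 pβ r) h
  left-adj {r , suc c} _ = toLeft

  δ-false : ∀ {b} → Diff β δ b → Diff δ γ b → ⊥
  δ-false (h , _) (_ , h') = absurd h h'

  new-inner : ∀ {b} → (Diff β α b × Linked b) ⊎ (Diff α γ b × ¬ Linked b) → Diff β δ b
  new-inner {b} (inj₁ (d , _ , a , d')) = trans (linked q a (inner⇒ {b} d) d') (proj₁ d) , proj₂ d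
  new-inner {b} (inj₂ (d , n)) =
    trans (isolated q (outer⇒ {b} d) (λ b' a d' → n (b' , a , d'))) (cong not (proj₂ d)) , proj₂ (outer⇒ {b} d)

  new-outer : ∀ {b} → (Diff β α b × ¬ Linked b) ⊎ (Diff α γ b × Linked b) → Diff δ γ b
  new-outer {b} (inj₁ (d , n)) = proj₁ (inner⇒ {b} d) ,
    trans (isolated q (inner⇒ {b} d) (λ b' a d' → n (b' , a , d'))) (cong not (proj₁ d))
  new-outer {b} (inj₂ (d , _ , a , d')) = proj₁ d , trans (linked q a (outer⇒ {b} d) d') (proj₂ d)

  linked? : ∀ b → Linked b ⊎ ¬ Linked b
  linked? b with neighbour? β γ b
  ... | inj₁ x = inj₁ x
  ... | inj₂ h = inj₂ (λ { (b' , a , d) → h b' a d })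

  new-inner⁻ : ∀ {b} → Diff β δ b → (Diff β α b × Linked b) ⊎ (Diff α γ b × ¬ Linked b)
  new-inner⁻ {b} d with linked? b | split {b} (sub (δγ q) b (proj₁ d) , proj₂ d)
  ... | inj₁ l | inj₁ x = inj₁ (x , l)
  ... | inj₂ l | inj₂ x = inj₂ (x , l)
  ... | inj₁ l | inj₂ x = ⊥-elim (δ-false {b} d (new-outer {b} (inj₂ (x , l))))
  ... | inj₂ l | inj₁ x = ⊥-elim (δ-false {b} d (new-outer {b} (inj₁ (x , l))))

  new-outer⁻ : ∀ {b} → Diff δ γ b → (Diff β α b × ¬ Linked b) ⊎ (Diff α γ b × Linked b)
  new-outer⁻ {b} d with linked? b | split {b} (proj₁ d , ¬true⇒false (λ h → absurd (sub (βδ q) b h) (proj₂ d)))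
  ... | inj₂ l | inj₁ x = inj₁ (x , l)
  ... | inj₁ l | inj₂ x = inj₂ (x , l)
  ... | inj₁ l | inj₁ x = ⊥-elim (δ-false {b} (new-inner {b} (inj₁ (x , l))) d)
  ... | inj₂ l | inj₂ x = ⊥-elim (δ-false {b} (new-inner {b} (inj₂ (x , l))) d)

  module _ (i : ℕ) (ds : List Box) (U : Tab) where

    -- Before the step the dots form the inner strip, after it the outer one. A linked box changes
    -- its content and thereby keeps its place among the two strips; an isolated box keeps its
    -- content and thereby changes place. This is the local rule.
    forward-step : (∀ b → (b ∈ ds) ⟺ Diff β α b) → (∀ b → ((b , i) ∈ U) ⟺ Diff α γ b) →
      let s = swapStep right below i (ds , U) in
      (∀ b → (b ∈ proj₁ s) ⟺ Diff δ γ b) × (∀ b → ((b , i) ∈ proj₂ s) ⟺ Diff β δ b)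
    forward-step hd hu = dots , entries
      where
      open SwapStep right below i ds U
      adj→ : ∀ b → Adjacent b → Linked b
      adj→ b (inj₁ m) = right b , right-adj b , outer⇒ {right b} (proj₁ (hu (right b)) m)
      adj→ b (inj₂ m) = below b , below-adj b , outer⇒ {below b} (proj₁ (hu (below b)) m)
      →adj : ∀ b → Diff β α b → Linked b → Adjacent b
      →adj b d (b' , a , d') with inner-neighbour {b} {b'} d a d'
      ... | x , inj₁ refl = inj₁ (proj₂ (hu _) x)
      ... | x , inj₂ refl = inj₂ (proj₂ (hu _) x)
      near→ : ∀ b → NearDot b → Linked b
      near→ b (d , m , inj₁ refl) = d , Adj-sym (right-adj d) , inner⇒ {d} (proj₁ (hd d) m)
      near→ b (d , m , inj₂ refl) = d , Adj-sym (below-adj d) , inner⇒ {d} (proj₁ (hd d) m)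
      →near : ∀ b → Diff α γ b → Linked b → NearDot b
      →near b d (b' , a , d') with outer-neighbour {b} {b'} d a d'
      ... | x , e , _ = b' , proj₂ (hd b') x , e
      dots : ∀ b → (b ∈ proj₁ step) ⟺ Diff δ γ b
      dots b = (λ m → new-outer {b} (case proj₁ (dots-spec b) m of λ
                 { (inj₁ (m' , n)) → inj₁ (proj₁ (hd b) m' , n ∘ →adj b (proj₁ (hd b) m'))
                 ; (inj₂ (m' , n)) → inj₂ (proj₁ (hu b) m' , near→ b n) }))
             , λ d → proj₂ (dots-spec b) (case new-outer⁻ {b} d of λ
                 { (inj₁ (x , n)) → inj₁ (proj₂ (hd b) x , n ∘ adj→ b)
                 ; (inj₂ (x , l)) → inj₂ (proj₂ (hu b) x , →near b x l) })
      entries : ∀ b → ((b , i) ∈ proj₂ step) ⟺ Diff β δ b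
      entries b = (λ m → new-inner {b} (case proj₁ (tab-spec b i) m of λ
                 { (inj₁ (m' , n)) → inj₂ (proj₁ (hu b) m' , λ l → n (refl , →near b (proj₁ (hu b) m') l))
                 ; (inj₂ (_ , m' , a)) → inj₁ (proj₁ (hd b) m' , adj→ b a) }))
             , λ d → proj₂ (tab-spec b i) (case new-inner⁻ {b} d of λ
                 { (inj₁ (x , l)) → inj₂ (refl , proj₂ (hd b) x , →adj b x l)
                 ; (inj₂ (x , n)) → inj₁ (proj₂ (hu b) x , λ { (_ , nd) → n (near→ b nd) }) })

    backward-step : (∀ b → (b ∈ ds) ⟺ Diff α γ b) → (∀ b → ((b , i) ∈ U) ⟺ Diff β α b) →
      let s = swapStep above left i (ds , U) in
      (∀ b → (b ∈ proj₁ s) ⟺ Diff β δ b) × (∀ b → ((b , i) ∈ proj₂ s) ⟺ Diff δ γ b)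
    backward-step hd hu = dots , entries
      where
      open SwapStep above left i ds U
      adj→ : ∀ b → Diff α γ b → Adjacent b → Linked b
      adj→ b d (inj₁ m) = above b , above-adj {b} (outer⇒ {b} d) , inner⇒ {above b} (proj₁ (hu (above b)) m)
      adj→ b d (inj₂ m) = left b , left-adj {b} (outer⇒ {b} d) , inner⇒ {left b} (proj₁ (hu (left b)) m)
      →adj : ∀ b → Diff α γ b → Linked b → Adjacent b
      →adj b d (b' , a , d') with outer-neighbour {b} {b'} d a d'
      ... | x , _ , inj₁ refl = inj₁ (proj₂ (hu _) x)
      ... | x , _ , inj₂ refl = inj₂ (proj₂ (hu _) x)
      near→ : ∀ b → NearDot b → Linked b
      near→ b (d , m , inj₁ refl) = d , Adj-sym (above-adj {d} (outer⇒ {d} (proj₁ (hd d) m))) , outer⇒ {d} (proj₁ (hd d) m)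
      near→ b (d , m , inj₂ refl) = d , Adj-sym (left-adj {d} (outer⇒ {d} (proj₁ (hd d) m))) , outer⇒ {d} (proj₁ (hd d) m)
      →near : ∀ b → Diff β α b → Linked b → NearDot b
      →near b d (b' , a , d') with inner-neighbour {b} {b'} d a d'
      →near (r , c) d (_ , a , d') | x , inj₁ refl = _ , proj₂ (hd _) x , inj₂ refl
      →near (r , c) d (_ , a , d') | x , inj₂ refl = _ , proj₂ (hd _) x , inj₁ refl
      dots : ∀ b → (b ∈ proj₁ step) ⟺ Diff β δ b
      dots b = (λ m → new-inner {b} (case proj₁ (dots-spec b) m of λ
                 { (inj₁ (m' , n)) → inj₂ (proj₁ (hd b) m' , n ∘ →adj b (proj₁ (hd b) m'))
                 ; (inj₂ (m' , n)) → inj₁ (proj₁ (hu b) m' , near→ b n) }))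
             , λ d → proj₂ (dots-spec b) (case new-inner⁻ {b} d of λ
                 { (inj₂ (x , n)) → inj₁ (proj₂ (hd b) x , n ∘ adj→ b x)
                 ; (inj₁ (x , l)) → inj₂ (proj₂ (hu b) x , →near b x l) })
      entries : ∀ b → ((b , i) ∈ proj₂ step) ⟺ Diff δ γ b
      entries b = (λ m → new-outer {b} (case proj₁ (tab-spec b i) m of λ
                 { (inj₁ (m' , n)) → inj₁ (proj₁ (hu b) m' , λ l → n (refl , →near b (proj₁ (hu b) m') l))
                 ; (inj₂ (_ , m' , a)) → inj₂ (proj₁ (hd b) m' , adj→ b (proj₁ (hd b) m') a) }))
             , λ d → proj₂ (tab-spec b i) (case new-outer⁻ {b} d of λ
                 { (inj₂ (x , l)) → inj₂ (refl , proj₂ (hd b) x , →adj b x l)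
                 ; (inj₁ (x , n)) → inj₁ (proj₂ (hu b) x , λ { (_ , nd) → n (near→ b nd) }) })

-- Tableaux as chains of shapes, and infusion on diagrams

swapStep-other : ∀ n1 n2 i ds U b e → e ≢ i → ((b , e) ∈ proj₂ (swapStep n1 n2 i (ds , U))) ⟺ ((b , e) ∈ U)
swapStep-other n1 n2 i ds U b e ne =
  (λ m → case proj₁ (tab-spec b e) m of λ { (inj₁ (m' , _)) → m' ; (inj₂ (x , _)) → ⊥-elim (ne x) }) ,
  λ m → proj₂ (tab-spec b e) (inj₁ (m , λ { (x , _) → ne x }))
  where open SwapStep n1 n2 i ds U

-- T is the tableau whose entry e + 1 fills F (e + 1) / F e, for e < k.
IsTab : Tab → (ℕ → Shape) → ℕ → Set
IsTab U F k = ∀ b e → ((b , e) ∈ U) ⟺ (∃ λ e' → e ≡ suc e' × e' < k × Diff (F e') (F (suc e')) b)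

-- A tableau in the middle of a slide: the letters up to `a` sit where `P` puts them, the others
-- where `Q` does.
Mixed : Tab → (P Q : ℕ → Shape) → ℕ → ℕ → Set
Mixed U P Q a k = ∀ b e → ((b , e) ∈ U) ⟺ (∃ λ e' → e ≡ suc e' × e' < k ×
  ((e' < a × Diff (P e') (P (suc e')) b) ⊎ (a ≤ e' × Diff (Q e') (Q (suc e')) b)))

-- The loops of the slides run up to `maxEntry`; this condition makes it equal to `k`.
NonEmpty : (ℕ → Shape) → ℕ → Set
NonEmpty F k = ∀ e → e < k → ∃ (Diff (F e) (F (suc e)))

maxEntry-≤ : ∀ U k → (∀ b e → (b , e) ∈ U → e ≤ k) → maxEntry U ≤ k
maxEntry-≤ [] k h = z≤n
maxEntry-≤ ((b , e) ∷ U) k h = ⊔-lub (h b e (here refl)) (maxEntry-≤ U k (λ b e m → h b e (there m)))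

maxEntry-≥ : ∀ U {b e} → (b , e) ∈ U → e ≤ maxEntry U
maxEntry-≥ (p ∷ U) (here refl) = m≤m⊔n _ _
maxEntry-≥ (p ∷ U) (there m) = ≤-trans (maxEntry-≥ U m) (m≤n⊔m (proj₂ p) _)

maxEntry-IsTab : ∀ {U F k} → IsTab U F k → NonEmpty F k → maxEntry U ≡ k
maxEntry-IsTab {U} {F} {k} h ne = ≤-antisym
  (maxEntry-≤ U k (λ b e m → case proj₁ (h b e) m of λ { (e' , refl , l , _) → l })) (lower k refl)
  where
  lower : ∀ j → k ≡ j → k ≤ maxEntry U
  lower zero refl = z≤n
  lower (suc j) refl with ne j ≤-refl
  ... | b , d = maxEntry-≥ U (proj₂ (h b k) (j , refl , ≤-refl , d))

oneTo-suc : ∀ k → oneTo (suc k) ≡ oneTo k ++ suc k ∷ []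
oneTo-suc k = trans (cong (map suc) (sym (upTo-∷ʳ k))) (map-++ suc (upTo k) (k ∷ []))

reverse-oneTo-suc : ∀ k → reverse (oneTo (suc k)) ≡ suc k ∷ reverse (oneTo k)
reverse-oneTo-suc k = trans (cong reverse (oneTo-suc k)) (reverse-++ (oneTo k) (suc k ∷ []))

foldl-up : {S : Set} (f : S → ℕ → S) (I : ℕ → S → Set) → ∀ k s → I 0 s →
  (∀ a s → a < k → I a s → I (suc a) (f s (suc a))) → I k (foldl f s (oneTo k))
foldl-up f I zero s i0 step = i0
foldl-up f I (suc k) s i0 step = subst (I (suc k)) (sym (trans (cong (foldl f s) (oneTo-suc k)) (foldl-∷ʳ f s (suc k) (oneTo k))))
  (step k _ ≤-refl (foldl-up f I k s i0 (λ a s a<k → step a s (m<n⇒m<1+n a<k))))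

foldl-down : {S : Set} (f : S → ℕ → S) (I : ℕ → S → Set) → ∀ k s → I k s →
  (∀ a s → a < k → I (suc a) s → I a (f s (suc a))) → I 0 (foldl f s (reverse (oneTo k)))
foldl-down f I zero s i step = i
foldl-down f I (suc k) s i step = subst (λ l → I 0 (foldl f s l)) (sym (reverse-oneTo-suc k))
  (foldl-down f I k (f s (suc k)) (step k s ≤-refl i) (λ a s a<k → step a s (m<n⇒m<1+n a<k)))

IsTab⇒Mixed-low : ∀ {U P Q k} → IsTab U Q k → Mixed U P Q 0 k
IsTab⇒Mixed-low h b e =
  (λ m → case proj₁ (h b e) m of λ { (e' , p , l , d) → e' , p , l , inj₂ (z≤n , d) }) ,
  λ { (e' , p , l , inj₂ (_ , d)) → proj₂ (h b e) (e' , p , l , d) }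

IsTab⇒Mixed-high : ∀ {U P Q k} → IsTab U P k → Mixed U P Q k k
IsTab⇒Mixed-high h b e =
  (λ m → case proj₁ (h b e) m of λ { (e' , p , l , d) → e' , p , l , inj₁ (l , d) }) ,
  λ { (e' , p , l , inj₁ (_ , d)) → proj₂ (h b e) (e' , p , l , d)
    ; (e' , p , l , inj₂ (l' , d)) → ⊥-elim (<⇒≱ l l') }

Mixed-low⇒IsTab : ∀ {U P Q k} → Mixed U P Q 0 k → IsTab U Q k
Mixed-low⇒IsTab h b e =
  (λ m → case proj₁ (h b e) m of λ { (e' , p , l , inj₂ (_ , d)) → e' , p , l , d }) ,
  λ { (e' , p , l , d) → proj₂ (h b e) (e' , p , l , inj₂ (z≤n , d)) }

Mixed-high⇒IsTab : ∀ {U P Q k} → Mixed U P Q k k → IsTab U P k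
Mixed-high⇒IsTab h b e =
  (λ m → case proj₁ (h b e) m of λ
    { (e' , p , l , inj₁ (_ , d)) → e' , p , l , d ; (e' , p , l , inj₂ (l' , d)) → ⊥-elim (<⇒≱ l l') }) ,
  λ { (e' , p , l , d) → proj₂ (h b e) (e' , p , l , inj₁ (l , d)) }

module MixedStep {U U' : Tab} {P Q : ℕ → Shape} {a k : ℕ} (a<k : a < k)
  (other : ∀ b e → e ≢ suc a → ((b , e) ∈ U') ⟺ ((b , e) ∈ U)) where

  mixed-current-high : Mixed U P Q a k → ∀ b → ((b , suc a) ∈ U) ⟺ Diff (Q a) (Q (suc a)) b
  mixed-current-high h b =
    (λ m → case proj₁ (h b (suc a)) m of λ
      { (_ , refl , _ , inj₁ (l , _)) → ⊥-elim (<-irrefl refl l) ; (_ , refl , _ , inj₂ (_ , d)) → d }) ,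
    λ d → proj₂ (h b (suc a)) (a , refl , a<k , inj₂ (≤-refl , d))

  mixed-current-low : Mixed U P Q (suc a) k → ∀ b → ((b , suc a) ∈ U) ⟺ Diff (P a) (P (suc a)) b
  mixed-current-low h b =
    (λ m → case proj₁ (h b (suc a)) m of λ
      { (_ , refl , _ , inj₂ (l , _)) → ⊥-elim (<-irrefl refl l) ; (_ , refl , _ , inj₁ (_ , d)) → d }) ,
    λ d → proj₂ (h b (suc a)) (a , refl , a<k , inj₁ (≤-refl , d))

  mixed-raise : Mixed U P Q a k → (∀ b → ((b , suc a) ∈ U') ⟺ Diff (P a) (P (suc a)) b) → Mixed U' P Q (suc a) k
  mixed-raise h new b e with e ≟ suc a
  ... | yes refl =
    (λ m → a , refl , a<k , inj₁ (≤-refl , proj₁ (new b) m)) ,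
    λ { (_ , refl , _ , inj₁ (_ , d)) → proj₂ (new b) d ; (_ , refl , _ , inj₂ (l , _)) → ⊥-elim (<-irrefl refl l) }
  ... | no ne =
    (λ m → case proj₁ (h b e) (proj₁ (other b e ne) m) of λ
      { (e' , p , l , inj₁ (l' , d)) → e' , p , l , inj₁ (m<n⇒m<1+n l' , d)
      ; (e' , p , l , inj₂ (l' , d)) → e' , p , l , inj₂ (≤∧≢⇒< l' (λ { refl → ne p }) , d) }) ,
    λ { (e' , p , l , inj₁ (l' , d)) → proj₂ (other b e ne) (proj₂ (h b e) (e' , p , l , inj₁ (≤∧≢⇒< (s≤s⁻¹ l') (λ { refl → ne p }) , d)))
      ; (e' , p , l , inj₂ (l' , d)) → proj₂ (other b e ne) (proj₂ (h b e) (e' , p , l , inj₂ (<⇒≤ l' , d))) }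

  mixed-lower : Mixed U P Q (suc a) k → (∀ b → ((b , suc a) ∈ U') ⟺ Diff (Q a) (Q (suc a)) b) → Mixed U' P Q a k
  mixed-lower h new b e with e ≟ suc a
  ... | yes refl =
    (λ m → a , refl , a<k , inj₂ (≤-refl , proj₁ (new b) m)) ,
    λ { (_ , refl , _ , inj₂ (_ , d)) → proj₂ (new b) d ; (_ , refl , _ , inj₁ (l , _)) → ⊥-elim (<-irrefl refl l) }
  ... | no ne =
    (λ m → case proj₁ (h b e) (proj₁ (other b e ne) m) of λ
      { (e' , p , l , inj₁ (l' , d)) → e' , p , l , inj₁ (≤∧≢⇒< (s≤s⁻¹ l') (λ { refl → ne p }) , d)
      ; (e' , p , l , inj₂ (l' , d)) → e' , p , l , inj₂ (<⇒≤ l' , d) }) ,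
    λ { (e' , p , l , inj₁ (l' , d)) → proj₂ (other b e ne) (proj₂ (h b e) (e' , p , l , inj₁ (m<n⇒m<1+n l' , d)))
      ; (e' , p , l , inj₂ (l' , d)) → proj₂ (other b e ne) (proj₂ (h b e) (e' , p , l , inj₂ (≤∧≢⇒< l' (λ { refl → ne p }) , d))) }

-- Each letter crosses one square: before it the dots are the level strip of column `a`, and the
-- letter `a + 1` moves from the upper level `hi` to the lower level `lo`.
jdtB-spec : ∀ {lo hi : ℕ → Shape} {k C V} →
  (∀ {a} → a ≤ k → Partition (lo a)) → (∀ {a} → a ≤ k → Partition (hi a)) →
  (∀ {a} → a < k → Square (lo a) (hi a) (hi (suc a)) (lo (suc a))) →
  NonEmpty hi k → (∀ b → (b ∈ C) ⟺ Diff (lo 0) (hi 0) b) → IsTab V hi k → IsTab (jdtB C V) lo k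
jdtB-spec {lo} {hi} {k} {C} {V} pl ph sq ne hC hV rewrite maxEntry-IsTab hV ne =
  Mixed-high⇒IsTab (proj₂ (foldl-up (λ s i → swapStep right below i s) Inv k (C , V) (hC , IsTab⇒Mixed-low hV) step))
  where
  Inv : ℕ → List Box × Tab → Set
  Inv a (ds , U) = (∀ b → (b ∈ ds) ⟺ Diff (lo a) (hi a) b) × Mixed U lo hi a k
  step : ∀ a s → a < k → Inv a s → Inv (suc a) (swapStep right below (suc a) s)
  step a (ds , U) a<k (hd , hm) = proj₁ fs , mixed-raise hm (proj₂ fs)
    where
    open MixedStep {U} {proj₂ (swapStep right below (suc a) (ds , U))} {lo} {hi} a<k (λ b e ne → swapStep-other right below (suc a) ds U b e ne)
    fs = SquareBoxes.forward-step (pl (<⇒≤ a<k)) (ph (<⇒≤ a<k)) (sq a<k) (suc a) ds U hd (mixed-current-high hm)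

rjdtC-spec : ∀ {old new : ℕ → Shape} {m C V} →
  (∀ {i} → i ≤ m → Partition (old i)) →
  (∀ {i} → i < m → Square (old i) (old (suc i)) (new (suc i)) (new i)) →
  NonEmpty old m → (∀ b → (b ∈ C) ⟺ Diff (old m) (new m) b) → IsTab V old m → IsTab (rjdtC C V) new m
rjdtC-spec {old} {new} {m} {C} {V} po sq ne hC hV rewrite maxEntry-IsTab hV ne =
  Mixed-low⇒IsTab (proj₂ (foldl-down (λ s i → swapStep above left i s) Inv m (C , V) (hC , IsTab⇒Mixed-high hV) step))
  where
  Inv : ℕ → List Box × Tab → Set
  Inv a (ds , U) = (∀ b → (b ∈ ds) ⟺ Diff (old a) (new a) b) × Mixed U old new a m
  step : ∀ a s → a < m → Inv (suc a) s → Inv a (swapStep above left (suc a) s)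
  step a (ds , U) a<m (hd , hm) = proj₁ bs , mixed-lower hm (proj₂ bs)
    where
    open MixedStep {U} {proj₂ (swapStep above left (suc a) (ds , U))} {old} {new} a<m (λ b e ne → swapStep-other above left (suc a) ds U b e ne)
    bs = SquareBoxes.backward-step (po (<⇒≤ a<m)) (po a<m) (sq a<m) (suc a) ds U hd (mixed-current-low hm)

IsTab-boxesWith : ∀ {U F k} → IsTab U F k → ∀ i → i < k → ∀ b → (b ∈ boxesWith (suc i) U) ⟺ Diff (F i) (F (suc i)) b
IsTab-boxesWith {U} h i l b =
  (λ m → case proj₁ (h b (suc i)) (proj₁ (∈-boxesWith (suc i) U b) m) of λ { (_ , refl , _ , d) → d }) ,
  λ d → proj₂ (∈-boxesWith (suc i) U b) (proj₂ (h b (suc i)) (i , refl , l , d))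

Square-nonempty' : ∀ {β α γ δ} → Square β α γ δ → ∃ (Diff β α) → ∃ (Diff δ γ)
Square-nonempty' {β} {α} {γ} {δ} q (b , p , p') with neighbour? β γ b
... | inj₂ h = b , proj₁ d , trans (isolated q d h) (cong not p)
  where d = Diff-widenˡ {β} {α} {γ} {b} (αγ q) (p , p')
... | inj₁ (b' , a , d'@(g , e)) = b' , g , trans (linked q (Adj-sym a) d' d) α-b'
  where
  d = Diff-widenˡ {β} {α} {γ} {b} (αγ q) (p , p')
  α-b' : at α b' ≡ false
  α-b' with bool-cases (at α b')
  ... | inj₂ x = x
  ... | inj₁ x = ⊥-elim (rook (βα q) a (p , p') (x , e))

module Infusion {n m k : ℕ} {G : ℕ → ℕ → Shape} (g : Growth n m k G)
  (letters≠∅ : NonEmpty (G m) k) (levels≠∅ : NonEmpty (λ i → G i 0) m) where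

  open Growth g

  -- Every letter occurs in the top row of the diagram, and `Square-nonempty` carries it down from
  -- level to level.
  nonempty-letters : ∀ i → i ≤ m → NonEmpty (G i) k
  nonempty-letters i l e e<k = go (m ∸ i) i (m+[n∸m]≡n l)
    where
    go : ∀ d i → i + d ≡ m → ∃ (Diff (G i e) (G i (suc e)))
    go zero i q = subst (λ z → ∃ (Diff (G z e) (G z (suc e)))) (trans (sym q) (+-identityʳ i)) (letters≠∅ e e<k)
    go (suc d) i q = Square-nonempty (sq (subst (i <_) q (m<m+n i (s≤s z≤n))) e<k) (go d (suc i) (trans (sym (+-suc i d)) q))

  nonempty-levels : ∀ a → a ≤ k → NonEmpty (λ i → G i a) m
  nonempty-levels zero l e e<m = levels≠∅ e e<m
  nonempty-levels (suc a) l e e<m = Square-nonempty' (sq e<m l) (nonempty-levels a (<⇒≤ l) e e<m)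

  jdtT-spec : ∀ {U V} → IsTab U (λ i → G i 0) m → IsTab V (G m) k → IsTab (jdtT U V) (G 0) k
  jdtT-spec {U} {V} hU hV rewrite maxEntry-IsTab hU levels≠∅ =
    foldl-down (λ V i → jdtB (boxesWith i U) V) (λ i V → IsTab V (G i) k) m V hV
      (λ i V i<m h → jdtB-spec {G i} {G (suc i)} (part (<⇒≤ i<m)) (part i<m) (sq i<m) (nonempty-letters (suc i) i<m)
         (IsTab-boxesWith hU i i<m) h)

  rjdtU-spec : ∀ {U V} → IsTab U (G m) k → IsTab V (λ i → G i 0) m → IsTab (rjdtU U V) (λ i → G i k) m
  rjdtU-spec {U} {V} hU hV rewrite maxEntry-IsTab hU letters≠∅ =
    foldl-up (λ S a → rjdtC (boxesWith a U) S) (λ a S → IsTab S (λ i → G i a) m) k V hV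
      (λ a S a<k h → rjdtC-spec {λ i → G i a} {λ i → G i (suc a)} (λ l → part l (<⇒≤ a<k)) (λ l → sq l a<k)
         (nonempty-levels a (<⇒≤ a<k)) (IsTab-boxesWith hU a a<k) h)

IsTab-cong : ∀ {U F F' k} → (∀ a → a ≤ k → F a ≐ F' a) → IsTab U F k → IsTab U F' k
IsTab-cong {F = F} {F'} e h b x =
  (λ m → case proj₁ (h b x) m of λ { (y , p , l , d) → y , p , l , Diff-cong (e y (<⇒≤ l)) (e (suc y) l) {b} d }) ,
  λ { (y , p , l , d) → proj₂ (h b x) (y , p , l , Diff-cong (≐-sym (e y (<⇒≤ l))) (≐-sym (e (suc y) l)) {b} d) }

Chain : (ℕ → Shape) → ℕ → Set
Chain F k = ∀ a → a < k → Strip (F a) (F (suc a))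

chain-⊆ : ∀ {F k} → Chain F k → ∀ {a b} → a ≤ b → b ≤ k → F a ⊆ˢ F b
chain-⊆ {F} {k} c {a} {b} p q with m≤n⇒m<n∨m≡n p
... | inj₂ refl = λ _ h → h
chain-⊆ {F} {k} c {a} {suc b} p q | inj₁ (s≤s l) = λ x h → sub (c b q) x (chain-⊆ c l (<⇒≤ q) x h)

chain-entry : ∀ {F k} → Chain F k → ∀ {b} → Diff (F 0) (F k) b → ∃ λ e → e < k × Diff (F e) (F (suc e)) b
chain-entry {F} {zero} c (p , q) = absurd p q
chain-entry {F} {suc k} c {b} (p , q) with bool-cases (at (F k) b)
... | inj₂ h = k , ≤-refl , p , h
... | inj₁ h with chain-entry (λ a l → c a (m<n⇒m<1+n l)) {b} (h , q)
...   | e , l , d = e , m<n⇒m<1+n l , d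

IsTab-boxes : ∀ {U F k} → Chain F k → IsTab U F k → ∀ b → (b ∈ boxes U) ⟺ Diff (F 0) (F k) b
IsTab-boxes {U} {F} {k} c h b = to , from
  where
  to : b ∈ boxes U → Diff (F 0) (F k) b
  to m with ∈-boxes⁻ U b m
  ... | e , m' with proj₁ (h b e) m'
  ...   | y , _ , l , d = chain-⊆ c l ≤-refl b (proj₁ d) , ¬true⇒false (λ x → absurd (chain-⊆ c z≤n (<⇒≤ l) b x) (proj₂ d))
  from : Diff (F 0) (F k) b → b ∈ boxes U
  from d with chain-entry c {b} d
  ... | e , l , d' = ∈-boxes⁺ (proj₂ (h b (suc e)) (e , refl , l , d'))

IsTab-determines : ∀ {U F F' k} → F 0 ≐ F' 0 → Chain F k → Chain F' k → IsTab U F k → IsTab U F' k →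
  ∀ a → a ≤ k → F a ≐ F' a
IsTab-determines e c c' h h' zero l = e
IsTab-determines {U} {F} {F'} {k} e c c' h h' (suc a) l r x = lemma
  where
  IH : F a ≐ F' a
  IH = IsTab-determines e c c' h h' a (<⇒≤ l)
  b = (r , x)
  transfer : ∀ {H H'} → IsTab U H k → IsTab U H' k → Diff (H a) (H (suc a)) b → Diff (H' a) (H' (suc a)) b
  transfer {H} {H'} t t' d with proj₁ (t' b (suc a)) (proj₂ (t b (suc a)) (a , refl , l , d))
  ... | _ , refl , _ , d' = d'
  lemma : F (suc a) r x ≡ F' (suc a) r x
  lemma with bool-cases (F (suc a) r x) | bool-cases (F' (suc a) r x)
  ... | inj₁ p | inj₁ p' = trans p (sym p')
  ... | inj₂ p | inj₂ p' = trans p (sym p')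
  ... | inj₁ p | inj₂ p' with bool-cases (F a r x)
  ...   | inj₁ s = absurd (sub (c' a l) b (trans (sym (IH r x)) s)) p'
  ...   | inj₂ s = absurd (proj₁ (transfer {F} {F'} h h' (p , s))) p'
  lemma | inj₂ p | inj₁ p' with bool-cases (F' a r x)
  ...   | inj₁ s = absurd (sub (c a l) b (trans (IH r x) s)) p
  ...   | inj₂ s = absurd (proj₁ (transfer {F'} {F} h' h (p' , s))) p

pairEq-true : ∀ {p p'} → p ≡ p' → pairEq p p' ≡ true
pairEq-true {b , e} refl = ∧-intro (boxEq-true {b} refl) (≡ᵇ-true {e} refl)

pairEq-true⁻ : ∀ p p' → pairEq p p' ≡ true → p ≡ p'
pairEq-true⁻ (b , e) (b' , e') h with ∧-true {boxEq b b'} h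
... | x , y = cong₂ _,_ (boxEq-true⁻ b b' x) (≡ᵇ-true⁻ e e' y)

tabEqᵇ-true⁻ : ∀ U V → tabEqᵇ U V ≡ true → ∀ p → (p ∈ U) ⟺ (p ∈ V)
tabEqᵇ-true⁻ U V h p with ∧-true {all (λ p → any (pairEq p) V) U} h
... | x , y = half x , half y
  where
  half : ∀ {U V} → all (λ p → any (pairEq p) V) U ≡ true → p ∈ U → p ∈ V
  half {U} {V} x m with any-true⁻ (pairEq p) V (all-true⁻ _ U x m)
  ... | p' , m' , t with pairEq-true⁻ p p' t
  ...   | refl = m'

tabEqᵇ-true⁺ : ∀ U V → (∀ p → (p ∈ U) ⟺ (p ∈ V)) → tabEqᵇ U V ≡ true
tabEqᵇ-true⁺ U V h = ∧-intro
  (all-true⁺ _ U (λ {p} m → any-true⁺ (pairEq p) (proj₁ (h p) m) (pairEq-true {p} refl)))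
  (all-true⁺ _ V (λ {p} m → any-true⁺ (pairEq p) (proj₂ (h p) m) (pairEq-true {p} refl)))

IsTab-unique : ∀ {U V F k} → IsTab U F k → IsTab V F k → ∀ p → (p ∈ U) ⟺ (p ∈ V)
IsTab-unique h h' (b , e) = (λ m → proj₂ (h' b e) (proj₁ (h b e) m)) , (λ m → proj₂ (h b e) (proj₁ (h' b e) m))

IsTab-transfer : ∀ {U V F k} → (∀ p → (p ∈ U) ⟺ (p ∈ V)) → IsTab U F k → IsTab V F k
IsTab-transfer q h b e = (λ m → proj₁ (h b e) (proj₂ (q (b , e)) m)) , λ x → proj₁ (q (b , e)) (proj₂ (h b e) x)

-- Diagrams of words

∈-oneTo⁻ : ∀ k {x} → x ∈ oneTo k → ∃ λ y → x ≡ suc y × y < k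
∈-oneTo⁻ k m with ∈-map⁻ suc m
... | y , m' , e = y , e , ∈-upTo⁻ m'

∈-oneTo⁺ : ∀ {k y} → y < k → suc y ∈ oneTo k
∈-oneTo⁺ l = ∈-map⁺ suc (∈-upTo⁺ l)

stairs-diff⁻ : ∀ i b → Diff (stairs i) (stairs (suc i)) b → ∃ λ r → ∃ λ c → b ≡ (suc r , suc c) × r + c ≡ i
stairs-diff⁻ i (suc r , suc c) (p , q) =
  r , c , refl , ≤-antisym (s≤s⁻¹ (<ᵇ-true⁻ {r + c} {suc i} p)) (<ᵇ-false⁻ {r + c} {i} q)
stairs-diff⁻ i (zero , c) (p , q) = absurd refl q
stairs-diff⁻ i (suc r , zero) (p , q) = absurd refl q

stairs-diff⁺ : ∀ {i r c} → r + c ≡ i → Diff (stairs i) (stairs (suc i)) (suc r , suc c)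
stairs-diff⁺ {i} {r} {c} refl = <ᵇ-true {r + c} ≤-refl , <ᵇ-false {r + c} {r + c} ≤-refl

Adj-antidiagonal : ∀ {m r c r' c'} → Adj (suc r , suc c) (suc r' , suc c') → r + c ≡ m → r' + c' ≡ m → ⊥
Adj-antidiagonal {r = r} {c} toRight p q = 1+n≢n (trans (sym (+-suc r c)) (trans q (sym p)))
Adj-antidiagonal {r = r} {c' = c} toLeft p q = 1+n≢n (trans (sym (+-suc r c)) (trans p (sym q)))
Adj-antidiagonal toBelow p q = 1+n≢n (trans q (sym p))
Adj-antidiagonal toAbove p q = 1+n≢n (trans p (sym q))

stairs-⊆ : ∀ {i j} → i ≤ j → stairs i ⊆ˢ stairs j
stairs-⊆ l (zero , c) h = refl
stairs-⊆ l (suc r , zero) h = refl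
stairs-⊆ {i} {j} l (suc r , suc c) h = <ᵇ-true {r + c} {j} (≤-trans (<ᵇ-true⁻ {r + c} {i} h) l)

stairs-strip : ∀ i → Strip (stairs i) (stairs (suc i))
stairs-strip i = record
  { sub = stairs-⊆ (n≤1+n i)
  ; rook = λ { {b} {b'} a d d' → case stairs-diff⁻ i b d , stairs-diff⁻ i b' d' of λ
      { ((r , c , refl , p) , (r' , c' , refl , q)) → Adj-antidiagonal a p q } } }

stairs-nonempty : ∀ m → NonEmpty stairs m
stairs-nonempty m e _ = (suc e , 1) , stairs-diff⁺ {e} {e} {0} (+-identityʳ e)

Mstair-spec : ∀ m → IsTab (Mstair (suc m)) stairs m
Mstair-spec m b e = to , from
  where
  row : ℕ → Tab
  row i = map (λ j → ((i , j) , i + j ∸ 1)) (oneTo (suc m ∸ i))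
  to : (b , e) ∈ Mstair (suc m) → _
  to h with find (∈-concatMap⁻ row {xs = oneTo (suc m)} h)
  ... | i , hi , h' with ∈-oneTo⁻ (suc m) hi | ∈-map⁻ (λ j → ((i , j) , i + j ∸ 1)) h'
  ...   | r , refl , r< | j , hj , refl with ∈-oneTo⁻ (m ∸ r) hj
  ...     | c , refl , c< = r + c , +-suc r c , subst (_≤ m) (+-suc r c) (≤-trans (+-monoʳ-≤ r c<) (≤-reflexive (m+[n∸m]≡n (s≤s⁻¹ r<)))) , stairs-diff⁺ {r + c} {r} {c} refl
  from : _ → (b , e) ∈ Mstair (suc m)
  from (e' , refl , l , d) with stairs-diff⁻ e' b d
  ... | r , c , refl , refl = ∈-concatMap⁺ row {xs = oneTo (suc m)}
    (lose {P = (λ i → ((suc r , suc c) , suc (r + c)) ∈ row i)} (∈-oneTo⁺ (s≤s (≤-trans (m≤m+n r c) (<⇒≤ l))))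
      (subst (λ x → ((suc r , suc c) , x) ∈ row (suc r)) (+-suc r c)
        (∈-map⁺ (λ j → ((suc r , j) , suc r + j ∸ 1)) (∈-oneTo⁺ (m+n≤o⇒m≤o∸n (suc c) (≤-trans (≤-reflexive (cong suc (+-comm c r))) l))))))

≤ᵇ-true : ∀ {m n} → m ≤ n → (m ≤ᵇ n) ≡ true
≤ᵇ-true h = Equivalence.to T-≡ (≤⇒≤ᵇ h)

≤ᵇ-true⁻ : ∀ m n → (m ≤ᵇ n) ≡ true → m ≤ n
≤ᵇ-true⁻ m n h = ≤ᵇ⇒≤ m n (Equivalence.from T-≡ h)

≤ᵇ-false⁻ : ∀ m n → (m ≤ᵇ n) ≡ false → n < m
≤ᵇ-false⁻ m n h = ≰⇒> (λ p → absurd (≤ᵇ-true p) h)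

≤ᵇ-false : ∀ {m n} → n < m → (m ≤ᵇ n) ≡ false
≤ᵇ-false {m} {n} h = ¬true⇒false (λ p → <⇒≱ h (≤ᵇ-true⁻ m n p))

-- A word of length m + 1, as the chain of shapes obtained by adding its letters ≤ a to σ_m.
wordShape : ℕ → List ℕ → ℕ → Shape
wordShape m w a zero c = true
wordShape m w a (suc r) zero = true
wordShape m w a (suc r) (suc c) = (r + c <ᵇ m) ∨ ((r + c ≡ᵇ m) ∧ (nthD w c ≤ᵇ a))

wordShape-in⁻ : ∀ m w a r c → wordShape m w a (suc r) (suc c) ≡ true → r + c < m ⊎ (r + c ≡ m × nthD w c ≤ a)
wordShape-in⁻ m w a r c h with ∨-true {r + c <ᵇ m} h
... | inj₁ p = inj₁ (<ᵇ-true⁻ {r + c} {m} p)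
... | inj₂ p with ∧-true {r + c ≡ᵇ m} p
...   | x , y = inj₂ (≡ᵇ-true⁻ (r + c) m x , ≤ᵇ-true⁻ (nthD w c) a y)

wordShape-in⁺ : ∀ m w a r c → r + c < m ⊎ (r + c ≡ m × nthD w c ≤ a) → wordShape m w a (suc r) (suc c) ≡ true
wordShape-in⁺ m w a r c (inj₁ p) = ∨-introˡ (<ᵇ-true {r + c} {m} p)
wordShape-in⁺ m w a r c (inj₂ (p , q)) = ∨-introʳ {r + c <ᵇ m} (∧-intro (≡ᵇ-true {r + c} p) (≤ᵇ-true {nthD w c} q))

wordShape-partition : ∀ m w a → Partition (wordShape m w a)
wordShape-partition m w a = record
  { row0 = λ _ → refl ; col0 = λ { zero → refl ; (suc r) → refl }
  ; upward = λ { zero c h → refl ; (suc r) zero h → refl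
               ; (suc r) (suc c) h → wordShape-in⁺ m w a r c (inj₁ (s≤s⁻¹ (small (wordShape-in⁻ m w a (suc r) c h)))) }
  ; leftward = λ { zero c h → refl ; (suc r) zero h → refl
               ; (suc r) (suc c) h → wordShape-in⁺ m w a r c (inj₁ (s≤s⁻¹ (subst (_< suc m) (+-suc r c) (small (wordShape-in⁻ m w a r (suc c) h))))) } }
  where
  small : ∀ {x} {y : Set} → x < m ⊎ (x ≡ m × y) → x < suc m
  small (inj₁ p) = m<n⇒m<1+n p
  small (inj₂ (refl , _)) = ≤-refl

wordShape-bdd : ∀ m w a → Bounded (suc m) (wordShape m w a)
wordShape-bdd m w a r c h with wordShape-in⁻ m w a r c h
... | inj₁ p = m<n⇒m<1+n p
... | inj₂ (refl , _) = ≤-refl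

wordShape-diff⁻ : ∀ m w a b → Diff (wordShape m w a) (wordShape m w (suc a)) b →
  ∃ λ r → ∃ λ c → b ≡ (suc r , suc c) × r + c ≡ m × nthD w c ≡ suc a
wordShape-diff⁻ m w a (zero , c) (p , q) = absurd p q
wordShape-diff⁻ m w a (suc r , zero) (p , q) = absurd p q
wordShape-diff⁻ m w a (suc r , suc c) (p , q) with wordShape-in⁻ m w (suc a) r c p
... | inj₁ l = absurd (wordShape-in⁺ m w a r c (inj₁ l)) q
... | inj₂ (e , l) = r , c , refl , e , ≤-antisym l (≰⇒> (λ l' → absurd (wordShape-in⁺ m w a r c (inj₂ (e , l'))) q))

wordShape-diff⁺ : ∀ m w a r c → r + c ≡ m → nthD w c ≡ suc a → Diff (wordShape m w a) (wordShape m w (suc a)) (suc r , suc c)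
wordShape-diff⁺ m w a r c p q = wordShape-in⁺ m w (suc a) r c (inj₂ (p , ≤-reflexive q)) ,
  ¬true⇒false (λ h → case wordShape-in⁻ m w a r c h of λ
    { (inj₁ l) → <-irrefl p l ; (inj₂ (_ , l)) → <⇒≱ (≤-reflexive (sym q)) l })

wordShape-strip : ∀ m w a → Strip (wordShape m w a) (wordShape m w (suc a))
wordShape-strip m w a = record
  { sub = λ { (zero , c) h → refl ; (suc r , zero) h → refl
            ; (suc r , suc c) h → wordShape-in⁺ m w (suc a) r c (case wordShape-in⁻ m w a r c h of λ
                { (inj₁ l) → inj₁ l ; (inj₂ (e , l)) → inj₂ (e , m≤n⇒m≤1+n l) }) }
  ; rook = λ { {b} {b'} a' d d' → case wordShape-diff⁻ m w a b d , wordShape-diff⁻ m w a b' d' of λ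
      { ((r , c , refl , p , _) , (r' , c' , refl , q , _)) → Adj-antidiagonal a' p q } } }

record Standard (k : ℕ) (w : List ℕ) : Set where
  field
    positive : ∀ c → c < length w → 1 ≤ nthD w c
    atMost   : ∀ c → c < length w → nthD w c ≤ k
    occurs   : ∀ e → e < k → ∃ λ c → c < length w × nthD w c ≡ suc e

wordShape-zero : ∀ {m k w} → length w ≡ suc m → Standard k w → wordShape m w 0 ≐ stairs m
wordShape-zero e s zero c = refl
wordShape-zero e s (suc r) zero = refl
wordShape-zero {m} {k} {w} e s (suc r) (suc c) with bool-cases (r + c <ᵇ m)
... | inj₁ h rewrite h = refl
... | inj₂ h rewrite h = ¬true⇒false (λ x → case ∧-true {r + c ≡ᵇ m} x of λ { (p , q) →
  <⇒≱ (Standard.positive s c (≤-trans (s≤s (≤-trans (m≤n+m c r) (≤-reflexive (≡ᵇ-true⁻ (r + c) m p)))) (≤-reflexive (sym e))))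
      (≤ᵇ-true⁻ (nthD w c) 0 q) })

zip-applyUpTo : ∀ {A : Set} (f : ℕ → A) w q x → ((q , x) ∈ zip (applyUpTo f (length w)) w) ⟺
  (∃ λ p → p < length w × q ≡ f p × nthD w p ≡ x)
zip-applyUpTo f [] q x = (λ ()) , λ { (_ , () , _) }
zip-applyUpTo f (y ∷ w) q x = to , from
  where
  IH = zip-applyUpTo (f ∘ suc) w q x
  to : _ → _
  to (here refl) = 0 , s≤s z≤n , refl , refl
  to (there h) with proj₁ IH h
  ... | p , l , e , e' = suc p , s≤s l , e , e'
  from : _ → _
  from (zero , l , refl , refl) = here refl
  from (suc p , s≤s l , e , e') = there (proj₂ IH (p , l , e , e'))

wordTab-spec : ∀ {m k w} → length w ≡ suc m → Standard k w → IsTab (wordTab w) (wordShape m w) k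
wordTab-spec {m} {k} {w} lw s b e = to , from
  where
  f : ℕ × ℕ → Box × ℕ
  f p = ((length w ∸ proj₁ p , suc (proj₁ p)) , proj₂ p)
  Entry : Set
  Entry = ∃ λ e' → e ≡ suc e' × e' < k × Diff (wordShape m w e') (wordShape m w (suc e')) b
  to : (b , e) ∈ wordTab w → Entry
  to h with ∈-map⁻ f h
  ... | (p , x) , h' , refl with proj₁ (zip-applyUpTo (λ z → z) w p x) h'
  ...   | _ , l , refl , refl with nthD w p in q
  ...     | zero = ⊥-elim (<⇒≱ (Standard.positive s p l) (≤-reflexive q))
  ...     | suc y = y , refl , subst (_≤ k) q (Standard.atMost s p l) ,
    subst (λ z → Diff (wordShape m w y) (wordShape m w (suc y)) (z , suc p)) (sym row)
      (wordShape-diff⁺ m w y (m ∸ p) p (m∸n+n≡m p≤m) q)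
    where
    p≤m : p ≤ m
    p≤m = s≤s⁻¹ (≤-trans l (≤-reflexive lw))
    row : length w ∸ p ≡ suc (m ∸ p)
    row = trans (cong (_∸ p) lw) (+-∸-assoc 1 p≤m)
  from : Entry → (b , e) ∈ wordTab w
  from (y , refl , l , d) with wordShape-diff⁻ m w y b d
  ... | r , c , refl , p , q = subst (λ z → ((z , suc c) , suc y) ∈ wordTab w) row
    (∈-map⁺ f (proj₂ (zip-applyUpTo (λ z → z) w c (suc y)) (c , c< , refl , q)))
    where
    c< : c < length w
    c< = ≤-trans (s≤s (≤-trans (m≤n+m c r) (≤-reflexive p))) (≤-reflexive (sym lw))
    row : length w ∸ c ≡ suc r
    row = trans (cong (_∸ c) (trans lw (cong suc (sym p)))) (m+n∸n≡m (suc r) c)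

wordShape-nonempty : ∀ {m k w} → length w ≡ suc m → Standard k w → NonEmpty (wordShape m w) k
wordShape-nonempty {m} {k} {w} lw s e l with Standard.occurs s e l
... | c , c< , q = (suc (m ∸ c) , suc c) , wordShape-diff⁺ m w e (m ∸ c) c (m∸n+n≡m (s≤s⁻¹ (≤-trans c< (≤-reflexive lw)))) q

record WordGrowth (m k : ℕ) (w : List ℕ) (G : ℕ → ℕ → Shape) : Set where
  field
    size : length w ≡ suc m
    std  : Standard k w
    growth : Growth (suc m) m k G
    leftEdge : ∀ i → i ≤ m → G i 0 ≐ stairs i
    topEdge  : ∀ a → a ≤ k → G m a ≐ wordShape m w a

  open Growth growth public

  top-nonempty : NonEmpty (G m) k
  top-nonempty e l with wordShape-nonempty size std e l
  ... | b , d = b , Diff-cong (≐-sym (topEdge e (<⇒≤ l))) (≐-sym (topEdge (suc e) l)) {b} d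

  left-nonempty : NonEmpty (λ i → G i 0) m
  left-nonempty e l with stairs-nonempty m e l
  ... | b , d = b , Diff-cong (≐-sym (leftEdge e (<⇒≤ l))) (≐-sym (leftEdge (suc e) l)) {b} d

  open Infusion growth top-nonempty left-nonempty public using (nonempty-letters; nonempty-levels)

  private
    stair : IsTab (Mstair (length w)) (λ i → G i 0) m
    stair = subst (λ n → IsTab (Mstair n) (λ i → G i 0) m) (sym size) (IsTab-cong (λ a l → ≐-sym (leftEdge a l)) (Mstair-spec m))

  fInf-bottom : IsTab (proj₁ (fInf w)) (G 0) k
  fInf-bottom = Infusion.jdtT-spec growth top-nonempty left-nonempty
    stair
    (IsTab-cong (λ a l → ≐-sym (topEdge a l)) (wordTab-spec size std))

  fInf-right : IsTab (proj₂ (fInf w)) (λ i → G i k) m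
  fInf-right = Infusion.rjdtU-spec growth top-nonempty left-nonempty
    (IsTab-cong (λ a l → ≐-sym (topEdge a l)) (wordTab-spec size std))
    stair

module WordGrowthOf {m k : ℕ} {w : List ℕ} (lw : length w ≡ suc m) (s : Standard k w) where

  private
    X Y : ℕ → Shape
    X = wordShape m w
    Y j = stairs (m ∸ j)

    sY : ∀ {j} → j < m → Strip (Y (suc j)) (build X Y j 0)
    sY {zero} l = Strip-cong (λ _ _ → refl) (≐-trans (λ r c → cong (λ z → stairs z r c) (sym (+-∸-assoc 1 l))) (≐-sym (wordShape-zero lw s)))
      (stairs-strip (m ∸ 1))
    sY {suc j} l = subst (λ z → Strip (stairs (m ∸ suc (suc j))) (stairs z)) (sym (+-∸-assoc 1 l)) (stairs-strip (m ∸ suc (suc j)))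

    module B = Build X Y m k (λ {a} _ → wordShape-partition m w a) (λ {a} _ → wordShape-strip m w a)
      (λ {j} _ → stairs-partition (m ∸ suc j)) (λ {j} → sY {j})

    first-column : ∀ j → j ≤ m → build X Y j 0 ≐ stairs (m ∸ j)
    first-column zero l = wordShape-zero lw s
    first-column (suc j) l r c = refl

  diagram : ℕ → ℕ → Shape
  diagram i a = build X Y (m ∸ i) a

  wordGrowth : WordGrowth m k w diagram
  wordGrowth = record
    { size = lw ; std = s
    ; growth = B.growth-from-top (wordShape-bdd m w k)
    ; leftEdge = λ i l r c → trans (first-column (m ∸ i) (m∸n≤m m i) r c) (cong (λ z → stairs z r c) (m∸[m∸n]≡n l))
    ; topEdge = λ a l r c → cong (λ z → build X Y z a r c) (n∸n≡0 m) }

-- The letter in a corner of the staircase is the first column whose shape contains that box.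
firstTrue : (ℕ → Bool) → ℕ → ℕ
firstTrue f zero = 0
firstTrue f (suc k) = if f 0 then 0 else suc (firstTrue (f ∘ suc) k)

firstTrue-≤ : ∀ f k → firstTrue f k ≤ k
firstTrue-≤ f zero = z≤n
firstTrue-≤ f (suc k) with f 0
... | true = z≤n
... | false = s≤s (firstTrue-≤ (f ∘ suc) k)

firstTrue-spec : ∀ f k → (∀ a → a < k → f a ≡ true → f (suc a) ≡ true) → f k ≡ true →
  ∀ a → a ≤ k → f a ≡ (firstTrue f k ≤ᵇ a)
firstTrue-spec f zero mono h zero l = h
firstTrue-spec f (suc k) mono h a l with f 0 in e
... | true = up a l
  where
  up : ∀ a → a ≤ suc k → f a ≡ true
  up zero l = e
  up (suc a) l = mono a l (up a (<⇒≤ l))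
firstTrue-spec f (suc k) mono h zero l | false = e
firstTrue-spec f (suc k) mono h (suc a) (s≤s l) | false =
  trans (firstTrue-spec (f ∘ suc) k (λ a l → mono (suc a) (s≤s l)) h a l) (≤ᵇ-suc (firstTrue (f ∘ suc) k) a)
  where
  ≤ᵇ-suc : ∀ x y → (x ≤ᵇ y) ≡ (suc x ≤ᵇ suc y)
  ≤ᵇ-suc zero y = refl
  ≤ᵇ-suc (suc x) y = refl

nthD-applyUpTo : ∀ (h : ℕ → ℕ) n c → c < n → nthD (applyUpTo h n) c ≡ h c
nthD-applyUpTo h (suc n) zero l = refl
nthD-applyUpTo h (suc n) (suc c) (s≤s l) = nthD-applyUpTo (h ∘ suc) n c l

-- The surjectivity of f onto the pairs with second component ℳ(w).
module Realize {m k : ℕ} {w : List ℕ} {G : ℕ → ℕ → Shape} (wg : WordGrowth m k w G)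
  (F : ℕ → Shape) (pF : ∀ a → a ≤ k → Partition (F a)) (cF : Chain F k) (F0 : F 0 ≐ stairs 0) (Fk : F k ≐ G 0 k)
  (neF : NonEmpty F k) where

  open WordGrowth wg

  private
    X Y : ℕ → Shape
    X i = G i k
    Y j = F (k ∸ j)

    sY : ∀ {j} → j < k → Strip (Y (suc j)) (build X Y j 0)
    sY {zero} l = Strip-cong (λ _ _ → refl) (≐-trans (λ r c → cong (λ z → F z r c) (sym (+-∸-assoc 1 l))) Fk)
      (cF (k ∸ 1) (≤-reflexive (sym (+-∸-assoc 1 l))))
    sY {suc j} l = subst (λ z → Strip (F (k ∸ suc (suc j))) (F z)) (sym (+-∸-assoc 1 l))
      (cF (k ∸ suc (suc j)) (≤-trans (≤-reflexive (sym (+-∸-assoc 1 l))) (m∸n≤m k (suc j))))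

    module B = Build X Y k m (λ l → part l ≤-refl) (λ l → level l ≤-refl)
      (λ {j} l → pF (k ∸ suc j) (m∸n≤m k (suc j))) (λ {j} → sY {j})

  diagram : ℕ → ℕ → Shape
  diagram i a = build X Y (k ∸ a) i

  private
    first : ∀ j → j ≤ k → build X Y j 0 ≐ F (k ∸ j)
    first zero l = ≐-sym Fk
    first (suc j) l r c = refl

  growth' : Growth (suc m) m k diagram
  growth' = B.growth-from-right (bdd ≤-refl ≤-refl)

  right' : ∀ i → i ≤ m → G i k ≐ diagram i k
  right' i l r c = sym (cong (λ z → build X Y z i r c) (n∸n≡0 k))

  bottom' : ∀ a → a ≤ k → diagram 0 a ≐ F a
  bottom' a l r c = trans (first (k ∸ a) (m∸n≤m k a) r c) (cong (λ z → F z r c) (m∸[m∸n]≡n l))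

  -- The decisive point: the diagram was filled without reference to its left edge, and only the
  -- right edge shared with `w` and the empty shape at its start force the staircases.
  left' : ∀ i → i ≤ m → diagram i 0 ≐ stairs i
  left' = UniqueRectification.left-stairs growth growth' leftEdge right' (≐-trans (bottom' 0 z≤n) F0)

  private
    module G' = Growth growth'
    corner : ℕ → ℕ → Bool
    corner c a = diagram m a (suc (m ∸ c)) (suc c)

    letterAt : ℕ → ℕ
    letterAt c = firstTrue (corner c) k

  word' : List ℕ
  word' = applyUpTo letterAt (suc m)

  private
    corner-letter : ∀ c → c ≤ m → ∀ a → a ≤ k → corner c a ≡ (letterAt c ≤ᵇ a)
    corner-letter c l = firstTrue-spec (corner c) k
      (λ a a<k h → sub (G'.letter ≤-refl a<k) (suc (m ∸ c) , suc c) h)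
      (trans (sym (right' m ≤-refl (suc (m ∸ c)) (suc c))) (trans (topEdge k ≤-refl (suc (m ∸ c)) (suc c))
        (wordShape-in⁺ m w k (m ∸ c) c (inj₂ (m∸n+n≡m l , Standard.atMost std c (≤-trans (s≤s l) (≤-reflexive (sym size))))))))

    letter-word : ∀ c → c ≤ m → nthD word' c ≡ letterAt c
    letter-word c l = nthD-applyUpTo letterAt (suc m) c (s≤s l)

  -- The top row of the diagram contains σ_m by `left'` and lies in σ_{m+1} by boundedness, so only
  -- the antidiagonal is free, and there `letterAt` records when a box appears.
  top' : ∀ a → a ≤ k → diagram m a ≐ wordShape m word' a
  top' a l zero c = row0 (G'.part ≤-refl l) c
  top' a l (suc r) zero = col0 (G'.part ≤-refl l) (suc r)
  top' a l (suc r) (suc c) with <-cmp (r + c) m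
  ... | tri< p _ _ = trans (chain-⊆ (λ a → G'.letter ≤-refl) {0} {a} z≤n l (suc r , suc c)
          (trans (left' m ≤-refl (suc r) (suc c)) (<ᵇ-true {r + c} {m} p))) (sym (wordShape-in⁺ m word' a r c (inj₁ p)))
  ... | tri≈ _ refl _ = trans (cong (λ z → diagram (r + c) a (suc z) (suc c)) (sym (m+n∸n≡m r c)))
          (trans (corner-letter c (m≤n+m c r) a l) (trans (cong (_≤ᵇ a) (sym (letter-word c (m≤n+m c r))))
            (sym (cong₂ _∨_ (<ᵇ-false {r + c} {r + c} ≤-refl) (cong (_∧ (nthD word' c ≤ᵇ a)) (≡ᵇ-true {r + c} refl))))))
  ... | tri> p _ q = trans (¬true⇒false (λ h → <⇒≱ q (s≤s⁻¹ (G'.bdd ≤-refl l r c h))))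
          (sym (¬true⇒false (λ h → case wordShape-in⁻ m word' a r c h of λ { (inj₁ x) → p x ; (inj₂ (x , _)) → <-irrefl (sym x) q })))

  private
    size' : length word' ≡ suc m
    size' = length-applyUpTo letterAt (suc m)

    nonempty' : ∀ i → i ≤ m → NonEmpty (diagram i) k
    nonempty' zero l e e<k with neF e e<k
    ... | b , d = b , Diff-cong (≐-sym (bottom' e (<⇒≤ e<k))) (≐-sym (bottom' (suc e) e<k)) {b} d
    nonempty' (suc i) l e e<k = Square-nonempty' (Square-sym (G'.sq l e<k)) (nonempty' i (<⇒≤ l) e e<k)

    position : ∀ c → c < length word' → c ≤ m
    position c l = s≤s⁻¹ (≤-trans l (≤-reflexive size'))

  std' : Standard k word'
  std' = record
    { positive = λ c l → let p = position c l in subst (1 ≤_) (sym (letter-word c p))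
        (≤ᵇ-false⁻ (letterAt c) 0 (trans (sym (corner-letter c p 0 z≤n))
          (trans (left' m ≤-refl (suc (m ∸ c)) (suc c)) (<ᵇ-false {m ∸ c + c} {m} (≤-reflexive (sym (m∸n+n≡m p)))))))
    ; atMost = λ c l → subst (_≤ k) (sym (letter-word c (position c l))) (firstTrue-≤ (corner c) k)
    ; occurs = λ e l → case nonempty' m ≤-refl e l of λ { (b , d) →
        case wordShape-diff⁻ m word' e b (Diff-cong (top' e (<⇒≤ l)) (top' (suc e) l) {b} d) of λ
          { (r , c , refl , p , q) → c , ≤-trans (s≤s (≤-trans (m≤n+m c r) (≤-reflexive p))) (≤-reflexive (sym size')) , q } } }

  wordGrowth' : WordGrowth m k word' diagram
  wordGrowth' = record { size = size' ; std = std' ; growth = growth' ; leftEdge = left' ; topEdge = top' }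

-- Promotion

module Promotion {n k' : ℕ} {F : ℕ → Shape} (pF : ∀ a → a ≤ suc k' → Partition (F a)) (cF : Chain F (suc k'))
  (F0 : F 0 ≐ stairs 0) (neF : NonEmpty F (suc k')) (bF : Bounded n (F (suc k'))) where

  private
    k = suc k'
    X Y : ℕ → Shape
    -- Dropping the first shape deletes the entry 1 and decrements the others. The lower edge starts
    -- at the empty shape, so the dots of the slide are the boxes of `F 1`, which is (1,1) alone.
    X j = F (suc j)
    Y _ = stairs 0

    sY : ∀ {j} → j < 1 → Strip (Y (suc j)) (build X Y j 0)
    sY {zero} _ = Strip-cong F0 (λ _ _ → refl) (cF 0 (s≤s z≤n))
    sY {suc j} (s≤s ())

    module B = Build X Y 1 k' (λ {a} l → pF (suc a) (s≤s l)) (λ {a} l → cF (suc a) (s≤s l)) (λ _ → stairs-partition 0) (λ {j} → sY {j})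

  slid : ℕ → Shape
  slid a = build X Y 1 a

  slide-growth : Growth n 1 k' (λ i a → build X Y (1 ∸ i) a)
  slide-growth = B.growth-from-top bF

  -- After the slide the dots occupy `F k` outside `slid k'`. These are the vacated boxes, which
  -- receive the entry `k`.
  promoted : ℕ → Shape
  promoted a = if a <ᵇ k then slid a else F k

  promoted-low : ∀ {a} → a ≤ k' → promoted a ≡ slid a
  promoted-low {a} l = cong (λ z → if z then slid a else F k) (<ᵇ-true {a} {k} (s≤s l))

  promoted-top : promoted k ≡ F k
  promoted-top = cong (λ z → if z then slid k else F k) (<ᵇ-false {k} {k} ≤-refl)

  promoted-zero : promoted 0 ≐ stairs 0
  promoted-zero r c = refl

  private
    cases : ∀ {a} → a ≤ k → a ≤ k' ⊎ a ≡ k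
    cases l with m≤n⇒m<n∨m≡n l
    ... | inj₁ (s≤s x) = inj₁ x
    ... | inj₂ e = inj₂ e

  promoted-part : ∀ a → a ≤ k → Partition (promoted a)
  promoted-part a l with cases l
  ... | inj₁ x = subst Partition (sym (promoted-low x)) (B.build-part {1} {a} ≤-refl x)
  ... | inj₂ refl = subst Partition (sym promoted-top) (pF k ≤-refl)

  promoted-chain : Chain promoted k
  promoted-chain a l with cases l
  ... | inj₁ x = subst₂ Strip (sym (promoted-low (<⇒≤ x))) (sym (promoted-low x)) (B.build-up {1} {a} ≤-refl x)
  ... | inj₂ refl = subst₂ Strip (sym (promoted-low ≤-refl)) (sym promoted-top) (B.build-left {0} {k'} ≤-refl ≤-refl)

  private
    corner-diff : ∃ (Diff (stairs 0) (F 1))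
    corner-diff with neF 0 (s≤s z≤n)
    ... | b , d = b , Diff-cong {γ = F 1} {F 1} F0 (λ _ _ → refl) {b} d

    dots : ∀ a → a ≤ k' → ∃ (Diff (slid a) (X a))
    dots zero l = corner-diff
    dots (suc a) l = Square-nonempty' (B.build-square {0} {a} ≤-refl l) (dots a (<⇒≤ l))

  promoted-nonempty : NonEmpty promoted k
  promoted-nonempty a l with cases l
  ... | inj₁ x = subst₂ (λ S S' → ∃ (Diff S S')) (sym (promoted-low (<⇒≤ x))) (sym (promoted-low x))
      (Square-nonempty (B.build-square {0} {a} ≤-refl x) (neF (suc a) (s≤s x)))
  ... | inj₂ refl = subst₂ (λ S S' → ∃ (Diff S S')) (sym (promoted-low ≤-refl)) (sym promoted-top) (dots k' ≤-refl)

  private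
    one-in : F 1 1 1 ≡ true
    one-in with corner-diff
    ... | (zero , c) , (_ , q) = absurd refl q
    ... | (suc r , zero) , (_ , q) = absurd refl q
    ... | (suc r , suc c) , (p , _) = leftwards (pF 1 (s≤s z≤n)) 1 (s≤s z≤n) (up r p)
      where
      up : ∀ r → F 1 (suc r) (suc c) ≡ true → F 1 1 (suc c) ≡ true
      up zero h = h
      up (suc r) h = up r (upward (pF 1 (s≤s z≤n)) (suc r) (suc c) h)

    -- Any other box of a strip over the empty shape would have its upper or left neighbour in the
    -- strip as well.
    only-one : ∀ b → Diff (F 0) (F 1) b → b ≡ (1 , 1)
    only-one (zero , c) (_ , q) = absurd (trans (F0 0 c) refl) q
    only-one (suc r , zero) (_ , q) = absurd (trans (F0 (suc r) 0) refl) q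
    only-one (suc zero , suc zero) _ = refl
    only-one (suc (suc r) , suc c) d@(p , _) = ⊥-elim (rook (cF 0 (s≤s z≤n)) {suc (suc r) , suc c} {suc r , suc c} toAbove d
      (upward (pF 1 (s≤s z≤n)) (suc r) (suc c) p , F0 (suc r) (suc c)))
    only-one (suc zero , suc (suc c)) d@(p , _) = ⊥-elim (rook (cF 0 (s≤s z≤n)) {1 , suc (suc c)} {1 , suc c} toLeft d
      (leftward (pF 1 (s≤s z≤n)) 1 (suc c) p , F0 1 (suc c)))

  module _ {W : Tab} (hW : IsTab W F k) where

    private
      keep : Box × ℕ → Bool
      keep p = not (boxEq (proj₁ p) (1 , 1))
      shift : Box × ℕ → Box × ℕ
      shift p = (proj₁ p , proj₂ p ∸ 1)
      Wm : Tab
      Wm = map shift (filterᵇ keep W)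

      Wm-spec : IsTab Wm X k'
      Wm-spec b e = to , from
        where
        to : (b , e) ∈ Wm → ∃ λ e' → e ≡ suc e' × e' < k' × Diff (X e') (X (suc e')) b
        to m with ∈-map⁻ shift m
        ... | (b , e₀) , m' , refl with ∈-filterᵇ⁻ keep W m'
        ...   | m'' , t with proj₁ (hW b e₀) m''
        ...     | zero , refl , l , d = absurd (boxEq-true (only-one b d)) (not-true t)
        ...     | suc y , refl , s≤s l , d = y , refl , l , d
        from : (∃ λ e' → e ≡ suc e' × e' < k' × Diff (X e') (X (suc e')) b) → (b , e) ∈ Wm
        from (y , refl , l , d) = ∈-map⁺ shift (∈-filterᵇ⁺ keep {x = (b , suc (suc y))}
          (proj₂ (hW b (suc (suc y))) (suc y , refl , s≤s l , d))
          (cong not (¬true⇒false (λ h → absurd (subst (λ z → at (X y) z ≡ true) (sym (boxEq-true⁻ b (1 , 1) h))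
            (chain-⊆ cF {1} {suc y} (s≤s z≤n) (s≤s (<⇒≤ l)) (1 , 1) one-in)) (proj₂ d)))))

      slidTab : Tab
      slidTab = jdtB ((1 , 1) ∷ []) Wm

      slidTab-spec : IsTab slidTab slid k'
      slidTab-spec = jdtB-spec {slid} {X} (λ {a} l → B.build-part {1} {a} ≤-refl l) (λ {a} l → pF (suc a) (s≤s l))
        (λ {a} l → B.build-square {0} {a} ≤-refl l) (λ e l → neF (suc e) (s≤s l))
        (λ b → (λ { (here refl) → one-in , refl ; (there ()) }) , λ d → here (only-one b (Diff-cong {γ = F 1} {F 1} (≐-sym F0) (λ _ _ → refl) {b} d))) Wm-spec

      chain-slid : Chain slid k'
      chain-slid a l = B.build-up {1} {a} ≤-refl l

      kept : Box → Bool
      kept b = not (inBoxes b (boxes slidTab))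

      in-boxes⁻ : ∀ b → inBoxes b (boxes slidTab) ≡ true → Diff (slid 0) (slid k') b
      in-boxes⁻ b h with any-true⁻ (boxEq b) (boxes slidTab) h
      ... | b' , m , t with boxEq-true⁻ b b' t
      ...   | refl = proj₁ (IsTab-boxes chain-slid slidTab-spec b) m

      in-boxes⁺ : ∀ b → Diff (slid 0) (slid k') b → inBoxes b (boxes slidTab) ≡ true
      in-boxes⁺ b d = any-true⁺ (boxEq b) (proj₂ (IsTab-boxes chain-slid slidTab-spec b) d) (boxEq-true {b} refl)

      Entry : Box → ℕ → Set
      Entry b e = ∃ λ e' → e ≡ suc e' × e' < k × Diff (promoted e') (promoted (suc e')) b

      max : maxEntry W ≡ k
      max = maxEntry-IsTab hW neF

      stairs-empty : ∀ b → Diff (F 0) (F k) b → at (slid 0) b ≡ false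
      stairs-empty (r , c) (_ , q) = trans (sym (F0 r c)) q

    promotion-spec : IsTab (promotion W) promoted k
    promotion-spec b e = to , from
      where
      to : (b , e) ∈ promotion W → Entry b e
      to m with ∈-++⁻ slidTab m
      ... | inj₁ m' with proj₁ (slidTab-spec b e) m'
      ...   | y , p , l , d = y , p , m<n⇒m<1+n l ,
              subst₂ (λ S S' → Diff S S' b) (sym (promoted-low (<⇒≤ l))) (sym (promoted-low l)) d
      to m | inj₂ m' with ∈-map⁻ (λ b → (b , maxEntry W)) m'
      ... | b' , m'' , refl with ∈-filterᵇ⁻ kept (boxes W) m''
      ...   | m₃ , t = k' , max , ≤-refl , subst₂ (λ S S' → Diff S S' b') (sym (promoted-low ≤-refl)) (sym promoted-top)
        (proj₁ d , ¬true⇒false (λ h → absurd (in-boxes⁺ b' (h , stairs-empty b' d)) (not-true t)))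
        where d = proj₁ (IsTab-boxes cF hW b') m₃
      from : Entry b e → (b , e) ∈ promotion W
      from (y , p , l , d) with cases l
      ... | inj₁ x = ∈-++⁺ˡ (proj₂ (slidTab-spec b e) (y , p , x ,
              subst₂ (λ S S' → Diff S S' b) (promoted-low (<⇒≤ x)) (promoted-low x) d))
      ... | inj₂ refl = subst (λ z → (b , z) ∈ promotion W) (trans max (sym p)) (∈-++⁺ʳ slidTab (∈-map⁺ (λ b → (b , maxEntry W))
              (∈-filterᵇ⁺ kept (proj₂ (IsTab-boxes cF hW b) whole) (cong not (¬true⇒false (λ h → absurd (proj₁ (in-boxes⁻ b h)) (proj₂ d')))))))
        where
        d' : Diff (slid k') (F k) b
        d' = subst₂ (λ S S' → Diff S S' b) (promoted-low ≤-refl) promoted-top d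
        whole : Diff (F 0) (F k) b
        whole = proj₁ d' , ¬true⇒false (λ h → absurd (chain-⊆ chain-slid z≤n ≤-refl b (trans (sym (≐-at F0 b)) h)) (proj₂ d'))

-- u = R(w) for a standard word w. P is the two-level diagram of the promotion slide; its columns
-- are shifted by one against those of G.
record PromotionPair (m k' : ℕ) (w u : List ℕ) : Set₁ where
  field
    {G G' P} : ℕ → ℕ → Shape
    source : WordGrowth m (suc k') w G
    target : WordGrowth m (suc k') u G'
    slide  : Growth (suc m) 1 k' P
    upper  : ∀ a → a ≤ k' → P 1 a ≐ G 0 (suc a)
    lower  : ∀ a → a ≤ k' → P 0 a ≐ G' 0 a
    edge   : ∀ i → i ≤ m → G i (suc k') ≐ G' i (suc k')

module PromotionOf {m k' : ℕ} {w : List ℕ} {G : ℕ → ℕ → Shape} (wg : WordGrowth m (suc k') w G) where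

  open WordGrowth wg

  private
    k = suc k'
    module Pr = Promotion {suc m} {k'} {G 0} (λ a l → part z≤n l) (λ a l → letter z≤n l) (leftEdge 0 z≤n)
      (nonempty-letters 0 z≤n) (bdd z≤n ≤-refl)

  open Pr using (promoted; slid; slide-growth; promoted-low; promoted-top)

  target-bottom : IsTab (promotion (proj₁ (fInf w))) promoted k
  target-bottom = Pr.promotion-spec fInf-bottom

  private
    module Re = Realize wg promoted Pr.promoted-part Pr.promoted-chain Pr.promoted-zero
      (λ r c → cong (λ S → S r c) promoted-top) Pr.promoted-nonempty

  image : List ℕ
  image = Re.word'

  Matches : List ℕ → Set
  Matches u = tabEqᵇ (proj₁ (fInf u)) (promotion (proj₁ (fInf w))) ∧ tabEqᵇ (proj₂ (fInf u)) (proj₂ (fInf w)) ≡ true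

  image-growth : WordGrowth m k image Re.diagram
  image-growth = Re.wordGrowth'

  image-matches : Matches image
  image-matches = ∧-intro
    (tabEqᵇ-true⁺ _ _ (IsTab-unique (IsTab-cong Re.bottom' (WordGrowth.fInf-bottom image-growth)) target-bottom))
    (tabEqᵇ-true⁺ _ _ (IsTab-unique (IsTab-cong (λ i l → ≐-sym (Re.right' i l)) (WordGrowth.fInf-right image-growth)) fInf-right))

  module _ {u : List ℕ} {k₀ : ℕ} {H : ℕ → ℕ → Shape} (wh : WordGrowth m k₀ u H) (mt : Matches u) where

    private
      module H = WordGrowth wh
      hb : IsTab (proj₁ (fInf u)) promoted k
      hb = IsTab-transfer (λ p → let e = tabEqᵇ-true⁻ _ _ (proj₁ (∧-true {tabEqᵇ (proj₁ (fInf u)) (promotion (proj₁ (fInf w)))} mt)) p in proj₂ e , proj₁ e) target-bottom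
      hr : IsTab (proj₂ (fInf u)) (λ i → G i k) m
      hr = IsTab-transfer (λ p → let e = tabEqᵇ-true⁻ _ _ (proj₂ (∧-true {tabEqᵇ (proj₁ (fInf u)) (promotion (proj₁ (fInf w)))} mt)) p in proj₂ e , proj₁ e) fInf-right

    -- The number of letters of `u` is the largest entry of 𝒲(u), and the test compares this
    -- tableau.
    same-k : k₀ ≡ k
    same-k = trans (sym (maxEntry-IsTab H.fInf-bottom (H.nonempty-letters 0 z≤n))) (maxEntry-IsTab hb Pr.promoted-nonempty)

    matched-bottom : ∀ a → a ≤ k → H 0 a ≐ promoted a
    matched-bottom = IsTab-determines (H.leftEdge 0 z≤n) (λ a l → H.letter z≤n (subst (a <_) (sym same-k) l)) Pr.promoted-chain
      (subst (IsTab (proj₁ (fInf u)) (H 0)) same-k H.fInf-bottom) hb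

    matched-right : ∀ i → i ≤ m → H i k ≐ G i k
    matched-right = IsTab-determines (≐-trans (matched-bottom k ≤-refl) (λ r c → cong (λ S → S r c) promoted-top))
      (λ i l → H.level l (≤-reflexive (sym same-k))) (λ i l → level l ≤-refl)
      (subst (λ z → IsTab (proj₂ (fInf u)) (λ i → H i z) m) same-k H.fInf-right) hr

    -- Passing the test fixes the bottom and right edges of the diagram of `u`. So this holds for
    -- whichever word the search returns.
    matched-pair : PromotionPair m k' w u
    matched-pair = record
      { source = wg ; target = subst (λ z → WordGrowth m z u H) same-k wh ; slide = slide-growth
      ; upper = λ a l r c → refl
      ; lower = λ a l → ≐-trans (λ r c → cong (λ S → S r c) (sym (promoted-low l))) (≐-sym (matched-bottom a (m≤n⇒m≤1+n l)))
      ; edge = λ i l → ≐-sym (matched-right i l) }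

-- Undoing promotion

nthD-ext : ∀ u w → length u ≡ length w → (∀ c → c < length u → nthD u c ≡ nthD w c) → u ≡ w
nthD-ext [] [] e h = refl
nthD-ext (x ∷ u) (y ∷ w) e h = cong₂ _∷_ (h 0 (s≤s z≤n)) (nthD-ext u w (suc-injective e) (λ c l → h (suc c) (s≤s l)))

wordShape-determines : ∀ {m k u w} → length u ≡ suc m → length w ≡ suc m → Standard k u → Standard k w →
  (∀ a → a ≤ k → wordShape m u a ≐ wordShape m w a) → u ≡ w
wordShape-determines {m} {k} {u} {w} lu lw su sw h = nthD-ext u w (trans lu (sym lw)) letter
  where
  le : ∀ {u w} → (∀ a → a ≤ k → wordShape m u a ≐ wordShape m w a) → ∀ c → c ≤ m → nthD w c ≤ k → nthD u c ≤ nthD w c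
  le {u} {w} h c l x with wordShape-in⁻ m u (nthD w c) (m ∸ c) c
      (trans (h (nthD w c) x (suc (m ∸ c)) (suc c)) (wordShape-in⁺ m w (nthD w c) (m ∸ c) c (inj₂ (m∸n+n≡m l , ≤-refl))))
  ... | inj₁ y = ⊥-elim (<-irrefl (m∸n+n≡m l) y)
  ... | inj₂ (_ , y) = y
  letter : ∀ c → c < length u → nthD u c ≡ nthD w c
  letter c l = ≤-antisym (le {u} {w} h c c≤ (Standard.atMost sw c (≤-trans l (≤-reflexive (trans lu (sym lw))))))
    (le {w} {u} (λ a x → ≐-sym (h a x)) c c≤ (Standard.atMost su c l))
    where c≤ = s≤s⁻¹ (≤-trans l (≤-reflexive lu))

growth-determined-top : ∀ {n m k G H} → Growth n m k G → Growth n m k H →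
  (∀ i → i ≤ m → G i 0 ≐ H i 0) → (∀ a → a ≤ k → G m a ≐ H m a) → ∀ i a → i ≤ m → a ≤ k → G i a ≐ H i a
growth-determined-top {m = m} {k} {G} {H} g h left top i a p = row (m ∸ i) i (m+[n∸m]≡n p) a
  where
  row : ∀ d i → i + d ≡ m → ∀ a → a ≤ k → G i a ≐ H i a
  row zero i e a l = subst (λ z → G z a ≐ H z a) (trans (sym e) (+-identityʳ i)) (top a l)
  row (suc d) i e zero l = left i (≤-trans (m≤m+n i (suc d)) (≤-reflexive e))
  row (suc d) i e (suc a) l = Square-unique
    (Square-cong (row (suc d) i e a (<⇒≤ l)) (row d (suc i) e' a (<⇒≤ l)) (row d (suc i) e' (suc a) l) (λ _ _ → refl) (Growth.sq g i<m l))
    (Growth.sq h i<m l)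
    where
    e' = trans (sym (+-suc i d)) e
    i<m : i < m
    i<m = subst (i <_) e (m<m+n i (s≤s z≤n))

-- The word `u` determines its diagram; the edges of that diagram determine the slide, run
-- backwards; the slide determines 𝒲(w); and from 𝒲(w) and the right edge the diagram of `w` is
-- filled upwards.
promotion-injective : ∀ {m k' w w' u} → PromotionPair m k' w u → PromotionPair m k' w' u → w ≡ w'
promotion-injective {m} {k'} {w} {w'} {u} p q = wordShape-determines P.S.size Q.S.size P.S.std Q.S.std
  (λ a l → ≐-trans (≐-sym (P.S.topEdge a l)) (≐-trans (whole m a ≤-refl l) (Q.S.topEdge a l)))
  where
  module P where
    open PromotionPair p public
    module S = WordGrowth source
    module T = WordGrowth target
  module Q where
    open PromotionPair q public
    module S = WordGrowth source
    module T = WordGrowth target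
  targets : ∀ i a → i ≤ m → a ≤ suc k' → P.G' i a ≐ Q.G' i a
  targets = growth-determined-top P.T.growth Q.T.growth
    (λ i l → ≐-trans (P.T.leftEdge i l) (≐-sym (Q.T.leftEdge i l)))
    (λ a l → ≐-trans (P.T.topEdge a l) (≐-sym (Q.T.topEdge a l)))
  rights : ∀ i → i ≤ m → P.G i (suc k') ≐ Q.G i (suc k')
  rights i l = ≐-trans (P.edge i l) (≐-trans (targets i (suc k') l ≤-refl) (≐-sym (Q.edge i l)))
  slides : ∀ i a → i ≤ 1 → a ≤ k' → P.P i a ≐ Q.P i a
  slides = growth-determined P.slide Q.slide low high
    where
    low : ∀ a → a ≤ k' → P.P 0 a ≐ Q.P 0 a
    low a l = ≐-trans (P.lower a l) (≐-trans (targets 0 a z≤n (m≤n⇒m≤1+n l)) (≐-sym (Q.lower a l)))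
    high : ∀ i → i ≤ 1 → P.P i k' ≐ Q.P i k'
    high zero l = low k' ≤-refl
    -- The corner `P 1 k'` is `G 0 (suc k')`, which lies on the right edge that `G` shares with
    -- `G'`.
    high (suc zero) l = ≐-trans (P.upper k' ≤-refl) (≐-trans (rights 0 z≤n) (≐-sym (Q.upper k' ≤-refl)))
    high (suc (suc i)) (s≤s ())
  bottoms : ∀ a → a ≤ suc k' → P.G 0 a ≐ Q.G 0 a
  bottoms zero l = ≐-trans (P.S.leftEdge 0 z≤n) (≐-sym (Q.S.leftEdge 0 z≤n))
  bottoms (suc a) (s≤s l) = ≐-trans (≐-sym (P.upper a l)) (≐-trans (slides 1 a ≤-refl l) (Q.upper a l))
  whole : ∀ i a → i ≤ m → a ≤ suc k' → P.G i a ≐ Q.G i a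
  whole = growth-determined P.S.growth Q.S.growth bottoms rights

-- Longest monotone subsequences

maxL-upper : ∀ xs {v} → v ∈ xs → v ≤ maxL xs
maxL-upper (x ∷ xs) (here refl) = m≤m⊔n x _
maxL-upper (x ∷ xs) (there m) = ≤-trans (maxL-upper xs m) (m≤n⊔m x _)

maxL-attained : ∀ xs → maxL xs ≡ 0 ⊎ maxL xs ∈ xs
maxL-attained [] = inj₁ refl
maxL-attained (x ∷ xs) with ⊔-sel x (maxL xs)
... | inj₁ e = inj₂ (here e)
... | inj₂ e with maxL-attained xs
...   | inj₁ z = inj₁ (trans e z)
...   | inj₂ m = inj₂ (there (subst (_∈ xs) (sym e) m))

subs-sound : ∀ x {y} → y ∈ subs x → y ⊆ x
subs-sound [] (here refl) = []
subs-sound (z ∷ x) m with ∈-++⁻ (map (z ∷_) (subs x)) m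
... | inj₂ m' = z ∷ʳ subs-sound x m'
... | inj₁ m' with ∈-map⁻ (z ∷_) m'
...   | y , m'' , refl = refl ∷ subs-sound x m''

subs-complete : ∀ {x y} → y ⊆ x → y ∈ subs x
subs-complete [] = here refl
subs-complete (z ∷ʳ p) = ∈-++⁺ʳ (map (z ∷_) _) (subs-complete p)
subs-complete {z ∷ x} (refl ∷ p) = ∈-++⁺ˡ (∈-map⁺ (z ∷_) (subs-complete p))

[]-⊆ : ∀ (x : List ℕ) → [] ⊆ x
[]-⊆ [] = []
[]-⊆ (z ∷ x) = z ∷ʳ []-⊆ x

longest : (List ℕ → Bool) → List ℕ → ℕ
longest p x = maxL (map length (filterᵇ p (subs x)))

longest-upper : ∀ p {x y} → y ⊆ x → p y ≡ true → length y ≤ longest p x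
longest-upper p s h = maxL-upper _ (∈-map⁺ length (∈-filterᵇ⁺ p (subs-complete s) h))

longest-attained : ∀ p x → p [] ≡ true → ∃ λ y → y ⊆ x × p y ≡ true × length y ≡ longest p x
longest-attained p x h with maxL-attained (map length (filterᵇ p (subs x)))
... | inj₁ z = [] , []-⊆ x , h , sym z
... | inj₂ m with ∈-map⁻ length m
...   | y , m' , e with ∈-filterᵇ⁻ p (subs x) m'
...     | m'' , q = y , subs-sound x m'' , q , sym e

Inc Dec : List ℕ → Set
Inc = AllPairs _<_
Dec = AllPairs _>_

inc-sound : ∀ x → incᵇ x ≡ true → Inc x
inc-sound [] h = []
inc-sound (x ∷ []) h = [] ∷ []
inc-sound (x ∷ y ∷ ys) h = cons (proj₁ pq) (inc-sound (y ∷ ys) (proj₂ pq))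
  where
  pq = ∧-true {x <ᵇ y} h
  cons : (x <ᵇ y) ≡ true → Inc (y ∷ ys) → Inc (x ∷ y ∷ ys)
  cons p r@(a ∷ _) = (<ᵇ-true⁻ {x} {y} p ∷ All.map (<-trans (<ᵇ-true⁻ {x} {y} p)) a) ∷ r

inc-complete : ∀ {x} → Inc x → incᵇ x ≡ true
inc-complete [] = refl
inc-complete (_ ∷ []) = refl
inc-complete ((p ∷ _) ∷ r@(_ ∷ _)) = ∧-intro (<ᵇ-true p) (inc-complete r)

dec-sound : ∀ x → decᵇ x ≡ true → Dec x
dec-sound [] h = []
dec-sound (x ∷ []) h = [] ∷ []
dec-sound (x ∷ y ∷ ys) h = cons (proj₁ pq) (dec-sound (y ∷ ys) (proj₂ pq))
  where
  pq = ∧-true {y <ᵇ x} h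
  cons : (y <ᵇ x) ≡ true → Dec (y ∷ ys) → Dec (x ∷ y ∷ ys)
  cons p r@(a ∷ _) = (<ᵇ-true⁻ {y} {x} p ∷ All.map (λ l → <-trans l (<ᵇ-true⁻ {y} {x} p)) a) ∷ r

dec-complete : ∀ {x} → Dec x → decᵇ x ≡ true
dec-complete [] = refl
dec-complete (_ ∷ []) = refl
dec-complete ((p ∷ _) ∷ r@(_ ∷ _)) = ∧-intro (<ᵇ-true p) (dec-complete r)

lds-upper : ∀ {x y} → y ⊆ x → Dec y → length y ≤ lds x
lds-upper s d = longest-upper decᵇ s (dec-complete d)

lds-attained : ∀ x → ∃ λ y → y ⊆ x × Dec y × length y ≡ lds x
lds-attained x with longest-attained decᵇ x refl
... | y , s , d , e = y , s , dec-sound y d , e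

lis-upper : ∀ {x y} → y ⊆ x → Inc y → length y ≤ lis x
lis-upper s d = longest-upper incᵇ s (inc-complete d)

lis-attained : ∀ x → ∃ λ y → y ⊆ x × Inc y × length y ≡ lis x
lis-attained x with longest-attained incᵇ x refl
... | y , s , d , e = y , s , inc-sound y d , e

All-reverse : ∀ {P : ℕ → Set} {x} → All P x → All P (reverse x)
All-reverse a = All.tabulate (λ m → All.lookup a (AnyP.reverse⁻ m))

AllPairs-reverse : ∀ {R : ℕ → ℕ → Set} {x} → AllPairs R x → AllPairs (λ a b → R b a) (reverse x)
AllPairs-reverse [] = []
AllPairs-reverse {R} {z ∷ x} (a ∷ r) = subst (AllPairs (λ a b → R b a)) (sym (unfold-reverse z x))
  (AllPairsP.++⁺ (AllPairs-reverse r) ([] ∷ []) (All-reverse (All.map (λ q → q ∷ []) a)))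

reverse-⊆ : ∀ {y x : List ℕ} → y ⊆ x → reverse y ⊆ reverse x
reverse-⊆ = Sublist.reverse⁺

lis-reverse : ∀ x → lis x ≡ lds (reverse x)
lis-reverse x = ≤-antisym one two
  where
  one : lis x ≤ lds (reverse x)
  one with lis-attained x
  ... | y , s , i , e = ≤-trans (≤-reflexive (trans (sym e) (sym (length-reverse y)))) (lds-upper (reverse-⊆ s) (AllPairs-reverse i))
  two : lds (reverse x) ≤ lis x
  two with lds-attained (reverse x)
  ... | y , s , i , e = ≤-trans (≤-reflexive (trans (sym e) (sym (length-reverse y))))
    (lis-upper (subst (reverse y ⊆_) (reverse-involutive x) (reverse-⊆ s)) (AllPairs-reverse i))

filter-⊆⁻ : ∀ (p : ℕ → Bool) x {y} → y ⊆ filterᵇ p x → y ⊆ x × All (λ z → p z ≡ true) y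
filter-⊆⁻ p [] [] = [] , []
filter-⊆⁻ p (z ∷ x) s with p z in e
filter-⊆⁻ p (z ∷ x) s | false with filter-⊆⁻ p x s
... | q , a = z ∷ʳ q , a
filter-⊆⁻ p (z ∷ x) (.z ∷ʳ s) | true with filter-⊆⁻ p x s
... | q , a = z ∷ʳ q , a
filter-⊆⁻ p (z ∷ x) (refl ∷ s) | true with filter-⊆⁻ p x s
... | q , a = refl ∷ q , e ∷ a

filter-⊆⁺ : ∀ (p : ℕ → Bool) {x y} → y ⊆ x → All (λ z → p z ≡ true) y → y ⊆ filterᵇ p x
filter-⊆⁺ p [] a = []
filter-⊆⁺ p (z ∷ʳ s) a with p z
... | true = z ∷ʳ filter-⊆⁺ p s a
... | false = filter-⊆⁺ p s a
filter-⊆⁺ p {z ∷ x} (refl ∷ s) (e ∷ a) rewrite e = refl ∷ filter-⊆⁺ p s a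

[_≟1_] : ℕ → ℕ → ℕ
[ x ≟1 y ] = if x ≡ᵇ y then 1 else 0

-- Longest decreasing subsequences on the letters a₀ + 1 , … , a₀ + t, computed letter by letter.
desc : ℕ → ℕ → List ℕ → ℕ
desc a₀ zero zs = 0
desc a₀ (suc t) [] = 0
desc a₀ (suc t) (z ∷ zs) = (desc a₀ t (z ∷ zs) + [ z ≟1 suc (a₀ + t) ]) ⊔ desc a₀ (suc t) zs

InRange : ℕ → ℕ → List ℕ → Set
InRange a₀ t = All (λ z → a₀ < z × z ≤ a₀ + t)

-- The letter `a₀ + t + 1` can only be the first one of `y`; the remaining letters are smaller and
-- are counted by `desc a₀ t` from the same position on.
desc-upper : ∀ a₀ t zs {y} → y ⊆ zs → Dec y → InRange a₀ t y → length y ≤ desc a₀ t zs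
desc-upper a₀ zero zs s d [] = z≤n
desc-upper a₀ zero zs s d ((p , q) ∷ _) = ⊥-elim (<⇒≱ p (≤-trans q (≤-reflexive (+-identityʳ a₀))))
desc-upper a₀ (suc t) .[] [] d r = z≤n
desc-upper a₀ (suc t) (z ∷ zs) (.z ∷ʳ s) d r = ≤-trans (desc-upper a₀ (suc t) zs s d r) (m≤n⊔m _ _)
desc-upper a₀ (suc t) (z ∷ zs) (refl ∷ s) (a ∷ d) ((p , q) ∷ r) with z ≟ suc (a₀ + t)
... | yes e = ≤-trans (≤-trans (≤-reflexive (+-comm 1 _))
      (+-mono-≤ (desc-upper a₀ t (z ∷ zs) (z ∷ʳ s) d
        (All.zipWith (λ { (l , (x , _)) → x , s≤s⁻¹ (≤-trans l (≤-reflexive e)) }) (a , r)))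
        (≤-reflexive (cong (λ b → if b then 1 else 0) (sym (≡ᵇ-true {z} e)))))) (m≤m⊔n _ _)
... | no ne = ≤-trans (desc-upper a₀ t (z ∷ zs) (refl ∷ s) (a ∷ d) ((p , z≤) ∷
        All.zipWith (λ { (l , (x , _)) → x , ≤-trans (<⇒≤ l) z≤ }) (a , r)))
      (≤-trans (m≤m+n _ _) (m≤m⊔n _ _))
  where
  z≤ : z ≤ a₀ + t
  z≤ = s≤s⁻¹ (≤∧≢⇒< (≤-trans q (≤-reflexive (+-suc a₀ t))) ne)

desc-attained : ∀ a₀ t zs → ∃ λ y → y ⊆ zs × Dec y × InRange a₀ t y × length y ≡ desc a₀ t zs
desc-attained a₀ zero zs = [] , []-⊆ zs , [] , [] , refl
desc-attained a₀ (suc t) [] = [] , [] , [] , [] , refl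
desc-attained a₀ (suc t) (z ∷ zs) = combine (desc-attained a₀ (suc t) zs) (desc-attained a₀ t (z ∷ zs)) (z ≟ suc (a₀ + t))
    (⊔-sel (desc a₀ t (z ∷ zs) + [ z ≟1 suc (a₀ + t) ]) (desc a₀ (suc t) zs))
  where
  D₁ = desc a₀ t (z ∷ zs) + [ z ≟1 suc (a₀ + t) ]
  D₂ = desc a₀ (suc t) zs
  Attained : ℕ → List ℕ → ℕ → Set
  Attained t zs ℓ = ∃ λ y → y ⊆ zs × Dec y × InRange a₀ t y × length y ≡ ℓ
  widen : ∀ {y} → InRange a₀ t y → InRange a₀ (suc t) y
  widen = All.map (λ { (x , l) → x , ≤-trans l (+-monoʳ-≤ a₀ (n≤1+n t)) })
  combine : Attained (suc t) zs D₂ → Attained t (z ∷ zs) (desc a₀ t (z ∷ zs)) → Relation.Nullary.Dec (z ≡ suc (a₀ + t)) →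
    (D₁ ⊔ D₂ ≡ D₁) ⊎ (D₁ ⊔ D₂ ≡ D₂) → Attained (suc t) (z ∷ zs) (D₁ ⊔ D₂)
  combine (y , s , d , r , f) _ _ (inj₂ e) = y , z ∷ʳ s , d , r , trans f (sym e)
  combine _ (y , s , d , r , f) (no ne) (inj₁ e) = y , s , d , widen r ,
    trans f (sym (trans e (trans (cong (λ b → desc a₀ t (z ∷ zs) + (if b then 1 else 0)) (≡ᵇ-false ne)) (+-identityʳ _))))
  combine _ (y , s , d , r , f) (yes q) (inj₁ e) = z ∷ y , refl ∷ unused s r , All.map (λ { (_ , l) → ≤-trans (s≤s l) (≤-reflexive (sym q)) }) r ∷ d ,
      (≤-trans (s≤s (m≤m+n a₀ t)) (≤-reflexive (sym q)) , ≤-reflexive (trans q (sym (+-suc a₀ t)))) ∷ widen r ,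
      trans (cong suc f) (trans (+-comm 1 _) (sym (trans e (cong (λ b → desc a₀ t (z ∷ zs) + (if b then 1 else 0)) (≡ᵇ-true {z} q)))))
    where
    unused : ∀ {y} → y ⊆ z ∷ zs → InRange a₀ t y → y ⊆ zs
    unused (_ ∷ʳ s) r = s
    unused (refl ∷ s) ((_ , l) ∷ _) = ⊥-elim (<⇒≱ (≤-reflexive (sym q)) l)

desc-lds : ∀ a₀ t zs → desc a₀ t zs ≡ lds (restrict (suc a₀) (a₀ + t) zs)
desc-lds a₀ t zs = ≤-antisym one two
  where
  p : ℕ → Bool
  p x = (suc a₀ ≤ᵇ x) ∧ (x ≤ᵇ a₀ + t)
  one : desc a₀ t zs ≤ lds (restrict (suc a₀) (a₀ + t) zs)
  one with desc-attained a₀ t zs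
  ... | y , s , d , r , e = ≤-trans (≤-reflexive (sym e)) (lds-upper (filter-⊆⁺ p s
        (All.map (λ { (a , b) → ∧-intro (≤ᵇ-true a) (≤ᵇ-true b) }) r)) d)
  two : lds (restrict (suc a₀) (a₀ + t) zs) ≤ desc a₀ t zs
  two with lds-attained (restrict (suc a₀) (a₀ + t) zs)
  ... | y , s , d , e with filter-⊆⁻ p zs s
  ...   | s' , a = ≤-trans (≤-reflexive (sym e)) (desc-upper a₀ t zs s' d (All.map (λ {z} h →
            let q = ∧-true {suc a₀ ≤ᵇ z} h in ≤ᵇ-true⁻ (suc a₀) z (proj₁ q) , ≤ᵇ-true⁻ z (a₀ + t) (proj₂ q)) a))

drop-nthD : ∀ s zs → s < length zs → drop s zs ≡ nthD zs s ∷ drop (suc s) zs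
drop-nthD zero (z ∷ zs) l = refl
drop-nthD (suc s) (z ∷ zs) (s≤s l) = drop-nthD s zs l

drop-all' : ∀ s (zs : List ℕ) → length zs ≤ s → drop s zs ≡ []
drop-all' zero [] l = refl
drop-all' (suc s) [] l = refl
drop-all' (suc s) (z ∷ zs) (s≤s l) = drop-all' s zs l

-- `Λ` and `desc` obey the same recursion. A chain moves up while its letters increase, so read from
-- top to bottom it is a decreasing subsequence.
Λ-desc : ∀ C g a₀ zs → length zs ≡ C → ∀ t →
  (∀ u s → u < t → s < C → g (suc u) s ∸ g u s ≡ [ nthD zs s ≟1 suc (a₀ + u) ]) →
  ∀ s → Λ C g t s ≡ desc a₀ t (drop s zs)
Λ-desc C g a₀ zs lz zero h s = refl
Λ-desc C g a₀ zs lz (suc t) h s = go (C ∸ s) s refl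
  where
  go : ∀ d s → C ∸ s ≡ d → Λ C g (suc t) s ≡ desc a₀ (suc t) (drop s zs)
  go zero s e = trans (Λ-cut C g (suc t) s C≤s)
      (sym (cong (desc a₀ (suc t)) (drop-all' s zs (≤-trans (≤-reflexive lz) C≤s))))
    where C≤s = m∸n≡0⇒m≤n e
  go (suc d) s e = trans (Λ-suc C g t s s<C) (trans
      (cong₂ _⊔_ (cong₂ _+_ (trans (Λ-desc C g a₀ zs lz t (λ u s l → h u s (m<n⇒m<1+n l)) s) (cong (desc a₀ t) dr)) (h t s ≤-refl s<C))
                 (go d (suc s) (suc-injective (trans (sym (+-∸-assoc 1 s<C)) e))))
      (sym (cong (desc a₀ (suc t)) dr)))
    where
    s<C : s < C
    s<C = m∸n≢0⇒n<m (λ z → 0≢1+n (trans (sym z) e))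
    dr = drop-nthD s zs (≤-trans s<C (≤-reflexive (sym lz)))

nthD-take : ∀ e zs s → s < e → nthD (take e zs) s ≡ nthD zs s
nthD-take (suc e) [] s l = refl
nthD-take (suc e) (z ∷ zs) zero l = refl
nthD-take (suc e) (z ∷ zs) (suc s) (s≤s l) = nthD-take e zs s l

nthD-++ˡ : ∀ xs ys s → s < length xs → nthD (xs ++ ys) s ≡ nthD xs s
nthD-++ˡ (x ∷ xs) ys zero l = refl
nthD-++ˡ (x ∷ xs) ys (suc s) (s≤s l) = nthD-++ˡ xs ys s l

nthD-++-end : ∀ xs y → nthD (xs ++ y ∷ []) (length xs) ≡ y
nthD-++-end [] y = refl
nthD-++-end (x ∷ xs) y = nthD-++-end xs y

nthD-reverse : ∀ w s → s < length w → nthD (reverse w) s ≡ nthD w (length w ∸ suc s)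
nthD-reverse (x ∷ w) s l rewrite unfold-reverse x w with m≤n⇒m<n∨m≡n (s≤s⁻¹ l)
... | inj₁ l' = trans (nthD-++ˡ (reverse w) (x ∷ []) s (subst (s <_) (sym (length-reverse w)) l'))
      (trans (nthD-reverse w s l') (cong (nthD (x ∷ w)) (sym (+-∸-assoc 1 l'))))
... | inj₂ refl = trans (cong (nthD (reverse w ++ x ∷ [])) (sym (length-reverse w)))
      (trans (nthD-++-end (reverse w) x) (cong (nthD (x ∷ w)) (sym (n∸n≡0 (length w)))))

-- The rows of the top edge of a diagram, from top to bottom, receive the letters of zs.
record TopRows (m k : ℕ) (ℓ : ℕ → ℕ → ℕ) (zs : List ℕ) : Set where
  field
    count : length zs ≡ suc m
    row   : ∀ a s → a ≤ k → s ≤ m → ℓ a s ≡ (m ∸ s) + (if nthD zs s ≤ᵇ a then 1 else 0)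
    range : All (λ z → 1 ≤ z × z ≤ k) zs

  increment : ∀ a s → a < k → s ≤ m → ℓ (suc a) s ∸ ℓ a s ≡ [ nthD zs s ≟1 suc a ]
  increment a s l l' rewrite row (suc a) s l l' | row a s (<⇒≤ l) l' =
    trans ([m+n]∸[m+o]≡n∸o (m ∸ s) _ _) (steps (nthD zs s))
    where
    steps : ∀ x → (if x ≤ᵇ suc a then 1 else 0) ∸ (if x ≤ᵇ a then 1 else 0) ≡ [ x ≟1 suc a ]
    steps x with <-cmp x (suc a)
    ... | tri< p ne _ rewrite ≤ᵇ-true {x} {suc a} (<⇒≤ p) | ≤ᵇ-true {x} {a} (s≤s⁻¹ p) | ≡ᵇ-false ne = refl
    ... | tri≈ _ refl _ rewrite ≤ᵇ-true {suc a} {suc a} ≤-refl | ≤ᵇ-false {suc a} {a} ≤-refl | ≡ᵇ-true {a} refl = refl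
    ... | tri> _ ne q rewrite ≤ᵇ-false {x} {suc a} q | ≤ᵇ-false {x} {a} (<-trans ≤-refl q) | ≡ᵇ-false ne = refl

top-row-length : ∀ {S ℓ m a x s} → Lens S ℓ → s ≤ m →
  (∀ c → (S (suc s) (suc c) ≡ true) ⟺ (s + c < m ⊎ (s + c ≡ m × x ≤ a))) →
  ℓ s ≡ (m ∸ s) + (if x ≤ᵇ a then 1 else 0)
top-row-length {S} {ℓ} {m} {a} {x} {s} L s≤m h = ≤-antisym
  (upper (ℓ s) (Lens.sound L s (ℓ s) ≤-refl))
  (lower (x ≤ᵇ a) refl)
  where
  upper : ∀ c → S (suc s) c ≡ true → c ≤ (m ∸ s) + (if x ≤ᵇ a then 1 else 0)
  upper zero _ = z≤n
  upper (suc c) p with proj₁ (h c) p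
  ... | inj₁ l = ≤-trans (m+n≤o⇒m≤o∸n (suc c) (≤-trans (≤-reflexive (cong suc (+-comm c s))) l)) (m≤m+n _ _)
  ... | inj₂ (e , l) rewrite ≤ᵇ-true l = ≤-reflexive (trans (cong suc (trans (sym (m+n∸m≡n s c)) (cong (_∸ s) e))) (+-comm 1 (m ∸ s)))
  full : ∀ c → c ≤ m ∸ s → c ≤ ℓ s
  full zero _ = z≤n
  full (suc c) l = Lens.complete L s (suc c) (proj₂ (h c) (inj₁ (≤-trans (≤-reflexive (sym (+-suc s c)))
    (≤-trans (+-monoʳ-≤ s l) (≤-reflexive (m+[n∸m]≡n s≤m))))))
  lower : ∀ b → (x ≤ᵇ a) ≡ b → (m ∸ s) + (if b then 1 else 0) ≤ ℓ s
  lower false e = ≤-trans (≤-reflexive (+-identityʳ _)) (full (m ∸ s) ≤-refl)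
  lower true e = ≤-trans (≤-reflexive (+-comm (m ∸ s) 1)) (Lens.complete L s (suc (m ∸ s))
    (proj₂ (h (m ∸ s)) (inj₂ (m+[n∸m]≡n s≤m , ≤ᵇ-true⁻ x a e))))

All-nthD : ∀ {P : ℕ → Set} xs → (∀ c → c < length xs → P (nthD xs c)) → All P xs
All-nthD [] h = []
All-nthD (x ∷ xs) h = h 0 (s≤s z≤n) ∷ All-nthD xs (λ c l → h (suc c) (s≤s l))

module _ {m k : ℕ} {w : List ℕ} {G : ℕ → ℕ → Shape} (wg : WordGrowth m k w G) where

  open WordGrowth wg

  private
    letters-range : All (λ z → 1 ≤ z × z ≤ k) w
    letters-range = All-nthD w (λ c l → Standard.positive std c l , Standard.atMost std c l)

  -- The antidiagonal box of row `s` lies over position `m ∸ s` of the word, so from top to bottom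
  -- the rows receive `w` reversed. From left to right the columns receive `w` itself.
  rows-of-word : TopRows m k (Rows.len growth m) (reverse w)
  rows-of-word = record
    { count = trans (length-reverse w) size
    ; row = λ a s a≤ s≤ → trans (top-row-length {x = nthD w (m ∸ s)} (Rows.lens growth ≤-refl a≤) s≤ (λ c →
          (λ p → case wordShape-in⁻ m w a s c (trans (sym (topEdge a a≤ (suc s) (suc c))) p) of λ
             { (inj₁ l) → inj₁ l
             ; (inj₂ (e , l)) → inj₂ (e , subst (λ z → nthD w z ≤ a) (position s c e) l) }) ,
          λ q → trans (topEdge a a≤ (suc s) (suc c)) (wordShape-in⁺ m w a s c (case q of λ
             { (inj₁ l) → inj₁ l
             ; (inj₂ (e , l)) → inj₂ (e , subst (λ z → nthD w z ≤ a) (sym (position s c e)) l) }))))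
        (cong (λ z → (m ∸ s) + (if z ≤ᵇ a then 1 else 0)) (sym (trans (nthD-reverse w s (≤-trans (s≤s s≤) (≤-reflexive (sym size))))
          (cong (λ n → nthD w (n ∸ suc s)) size))))
    ; range = All-reverse letters-range }
    where
    position : ∀ s c → s + c ≡ m → c ≡ m ∸ s
    position s c e = trans (sym (m+n∸m≡n s c)) (cong (_∸ s) e)

  columns-of-word : TopRows m k (Rows.len (Growth-transpose growth) m) w
  columns-of-word = record
    { count = size
    ; row = λ a s a≤ s≤ → top-row-length {x = nthD w s} (Rows.lens (Growth-transpose growth) ≤-refl a≤) s≤ (λ c →
          (λ p → case wordShape-in⁻ m w a c s (trans (sym (topEdge a a≤ (suc c) (suc s))) p) of λ
             { (inj₁ l) → inj₁ (subst (_< m) (+-comm c s) l)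
             ; (inj₂ (e , l)) → inj₂ (trans (+-comm s c) e , l) }) ,
          λ q → trans (topEdge a a≤ (suc c) (suc s)) (wordShape-in⁺ m w a c s (case q of λ
             { (inj₁ l) → inj₁ (subst (_< m) (+-comm s c) l)
             ; (inj₂ (e , l)) → inj₂ (trans (+-comm c s) e , l) })))
    ; range = letters-range }

-- From diagrams to the lengths of subsequences

restrict-all : ∀ k zs → All (λ z → 1 ≤ z × z ≤ k) zs → restrict 1 k zs ≡ zs
restrict-all k [] [] = refl
restrict-all k (z ∷ zs) ((p , q) ∷ a) rewrite ≤ᵇ-true {1} {z} p | ≤ᵇ-true {z} {k} q = cong (z ∷_) (restrict-all k zs a)

module CidRows {m k : ℕ} {G H : ℕ → ℕ → Shape} (g : Growth (suc m) m k G) (h : Growth (suc m) m k H)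
  (left₁ : ∀ i → i ≤ m → G i 0 ≐ stairs i) (left₂ : ∀ i → i ≤ m → H i 0 ≐ stairs i)
  (edge : ∀ i → i ≤ m → G i k ≐ H i k) {zs zs' : List ℕ}
  (tz : TopRows m k (Rows.len g m) zs) (tz' : TopRows m k (Rows.len h m) zs') where

  private
    cut : ∀ {zs ℓ} → TopRows m k ℓ zs → ∀ j s → j ≤ m → Λ (suc j) ℓ k s ≡ lds (drop s (take (suc j) zs))
    cut {zs} {ℓ} t j s l = trans
      (Λ-desc (suc j) ℓ 0 (take (suc j) zs) (trans (length-take (suc j) zs) (m≤n⇒m⊓n≡m (≤-trans (s≤s l) (≤-reflexive (sym (TopRows.count t)))))) k
        (λ u s u< s< → trans (TopRows.increment t u s u< (≤-trans (s≤s⁻¹ s<) l)) (cong (λ x → [ x ≟1 suc u ]) (sym (nthD-take (suc j) zs s s<)))) s)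
      (trans (desc-lds 0 k (drop s (take (suc j) zs))) (cong lds (restrict-all k _ (AllP.drop⁺ s (AllP.take⁺ (suc j) (TopRows.range t))))))

  -- A factor that ends with entry `j` of the list, counted from 0, is the cut at row `j` on level
  -- `m`, so `cutLength` is taken with `p = m ∸ j`.
  factors : ∀ s e → e ≤ suc m → lds (drop s (take e zs)) ≡ lds (drop s (take e zs'))
  factors s zero l = refl
  factors s (suc j) (s≤s l) = trans (sym (cut tz j s l)) (trans same (cut tz' j s l))
    where
    p+j : m ∸ j + j ≡ m
    p+j = m∸n+n≡m l
    same : Λ (suc j) (Rows.len g m) k s ≡ Λ (suc j) (Rows.len h m) k s
    same = subst (λ i → Λ (suc j) (Rows.len g i) k s ≡ Λ (suc j) (Rows.len h i) k s) p+j
      (cutLength-determined g h left₁ left₂ edge (m ∸ j) j s (≤-reflexive p+j))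

module RidRows {m k' : ℕ} {G G' P : ℕ → ℕ → Shape} (g : Growth (suc m) m (suc k') G) (g' : Growth (suc m) m (suc k') G')
  (p : Growth (suc m) 1 k' P) (upper : ∀ a → a ≤ k' → P 1 a ≐ G 0 (suc a)) (lower : ∀ a → a ≤ k' → P 0 a ≐ G' 0 a)
  {zs zs' : List ℕ} (tz : TopRows m (suc k') (Rows.len g m) zs) (tz' : TopRows m (suc k') (Rows.len g' m) zs') where

  private
    module A = Chains g
    module B = Chains g'
    module C = Chains p

    interval : ∀ {G zs} (g : Growth (suc m) m (suc k') G) → TopRows m (suc k') (Rows.len g m) zs → ∀ a₀ t → a₀ + t ≤ suc k' →
      Chains.chainLength g m a₀ t ≡ lds (restrict (suc a₀) (a₀ + t) zs)
    interval {zs = zs} g tr a₀ t l = trans (Λ-desc (suc m) (λ u → Rows.len g m (a₀ + u)) a₀ zs (TopRows.count tr) t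
      (λ u s u< s< → trans (cong (λ z → Rows.len g m z s ∸ Rows.len g m (a₀ + u) s) (+-suc a₀ u))
        (TopRows.increment tr (a₀ + u) s (≤-trans (≤-trans (≤-reflexive (sym (+-suc a₀ u))) (+-monoʳ-≤ a₀ u<)) l) (s≤s⁻¹ s<))) 0)
      (desc-lds a₀ t zs)

  -- The chains are followed from the word down to 𝒲(w), across the slide, and up again to the
  -- image. The slide starts at column 1 of `G`, which accounts for the shift of the letters by one.
  intervals : ∀ a₀ t → a₀ + t ≤ k' →
    lds (restrict (suc (suc a₀)) (suc (a₀ + t)) zs) ≡ lds (restrict (suc a₀) (a₀ + t) zs')
  intervals a₀ t l = begin
    lds (restrict (suc (suc a₀)) (suc (a₀ + t)) zs) ≡⟨ sym (interval g tz (suc a₀) t (s≤s l)) ⟩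
    A.chainLength m (suc a₀) t                      ≡⟨ A.chainLength-bottom m (suc a₀) t ≤-refl (s≤s l) ⟩
    A.chainLength 0 (suc a₀) t                      ≡⟨ Λ-cong (suc m) _ _ t (λ u s u≤ _ → sym (Lens-cong (upper (a₀ + u) (le u≤))
                                                         (Rows.lens p ≤-refl (le u≤)) (Rows.lens g z≤n (s≤s (le u≤))) s)) 0 ⟩
    C.chainLength 1 a₀ t                            ≡⟨ C.chainLength-bottom 1 a₀ t ≤-refl l ⟩
    C.chainLength 0 a₀ t                            ≡⟨ Λ-cong (suc m) _ _ t (λ u s u≤ _ → Lens-cong (lower (a₀ + u) (le u≤))
                                                         (Rows.lens p z≤n (le u≤)) (Rows.lens g' z≤n (m≤n⇒m≤1+n (le u≤))) s) 0 ⟩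
    B.chainLength 0 a₀ t                            ≡⟨ sym (B.chainLength-bottom m a₀ t ≤-refl (m≤n⇒m≤1+n l)) ⟩
    B.chainLength m a₀ t                            ≡⟨ interval g' tz' a₀ t (m≤n⇒m≤1+n l) ⟩
    lds (restrict (suc a₀) (a₀ + t) zs') ∎
    where
    open ≡-Reasoning
    le : ∀ {u} → u ≤ t → a₀ + u ≤ k'
    le u≤ = ≤-trans (+-monoʳ-≤ a₀ u≤) l

-- Reversal, filters and monotone relabelling of words

drop-take : ∀ s e (x : List ℕ) → drop s (take e x) ≡ take (e ∸ s) (drop s x)
drop-take zero e x = refl
drop-take (suc s) zero x = refl
drop-take (suc s) (suc e) [] with e ∸ s
... | zero = refl
... | suc _ = refl
drop-take (suc s) (suc e) (z ∷ x) = drop-take s e x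

drop-length-++ : ∀ (xs ys : List ℕ) → drop (length xs) (xs ++ ys) ≡ ys
drop-length-++ [] ys = refl
drop-length-++ (x ∷ xs) ys = drop-length-++ xs ys

take-length-++ : ∀ (xs ys : List ℕ) → take (length xs) (xs ++ ys) ≡ xs
take-length-++ [] ys = refl
take-length-++ (x ∷ xs) ys = cong (x ∷_) (take-length-++ xs ys)

reverse-split : ∀ e (x : List ℕ) → reverse x ≡ reverse (drop e x) ++ reverse (take e x)
reverse-split e x = trans (cong reverse (sym (take++drop≡id e x))) (reverse-++ (take e x) (drop e x))

reverse-take : ∀ e (x : List ℕ) → reverse (take e x) ≡ drop (length x ∸ e) (reverse x)
reverse-take e x = sym (trans (cong (drop (length x ∸ e)) (reverse-split e x))
  (trans (cong (λ n → drop n (reverse (drop e x) ++ reverse (take e x)))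
           (sym (trans (length-reverse (drop e x)) (length-drop e x))))
    (drop-length-++ (reverse (drop e x)) (reverse (take e x)))))

reverse-drop : ∀ e (x : List ℕ) → reverse (drop e x) ≡ take (length x ∸ e) (reverse x)
reverse-drop e x = sym (trans (cong (take (length x ∸ e)) (reverse-split e x))
  (trans (cong (λ n → take n (reverse (drop e x) ++ reverse (take e x)))
           (sym (trans (length-reverse (drop e x)) (length-drop e x))))
    (take-length-++ (reverse (drop e x)) (reverse (take e x)))))

reverse-factor : ∀ s e (x : List ℕ) → e ≤ length x →
  reverse (drop s (take e x)) ≡ drop (length x ∸ e) (take (length x ∸ e + (e ∸ s)) (reverse x))
reverse-factor s e x l = trans (reverse-drop s (take e x)) (trans
  (cong₂ take (cong (_∸ s) (trans (length-take e x) (m≤n⇒m⊓n≡m l))) (reverse-take e x))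
  (sym (trans (drop-take (length x ∸ e) (length x ∸ e + (e ∸ s)) (reverse x))
    (cong (λ n → take n (drop (length x ∸ e) (reverse x))) (m+n∸m≡n (length x ∸ e) (e ∸ s))))))

filterᵇ-++ : ∀ (p : ℕ → Bool) xs ys → filterᵇ p (xs ++ ys) ≡ filterᵇ p xs ++ filterᵇ p ys
filterᵇ-++ p [] ys = refl
filterᵇ-++ p (x ∷ xs) ys with p x
... | true = cong (x ∷_) (filterᵇ-++ p xs ys)
... | false = filterᵇ-++ p xs ys

filterᵇ-reverse : ∀ (p : ℕ → Bool) xs → filterᵇ p (reverse xs) ≡ reverse (filterᵇ p xs)
filterᵇ-reverse p [] = refl
filterᵇ-reverse p (x ∷ xs) = trans (cong (filterᵇ p) (unfold-reverse x xs)) (trans (filterᵇ-++ p (reverse xs) (x ∷ [])) last)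
  where
  last : filterᵇ p (reverse xs) ++ filterᵇ p (x ∷ []) ≡ reverse (filterᵇ p (x ∷ xs))
  last with p x
  ... | true = trans (cong (_++ x ∷ []) (filterᵇ-reverse p xs)) (sym (unfold-reverse x (filterᵇ p xs)))
  ... | false = trans (++-identityʳ (filterᵇ p (reverse xs))) (filterᵇ-reverse p xs)

filterᵇ-map : ∀ (p q : ℕ → Bool) (f : ℕ → ℕ) xs → All (λ z → p (f z) ≡ q z) xs → filterᵇ p (map f xs) ≡ map f (filterᵇ q xs)
filterᵇ-map p q f [] [] = refl
filterᵇ-map p q f (x ∷ xs) (e ∷ a) rewrite e with q x
... | true = cong (f x ∷_) (filterᵇ-map p q f xs a)
... | false = filterᵇ-map p q f xs a

filterᵇ-filterᵇ : ∀ (p q r : ℕ → Bool) xs → All (λ z → p z ∧ q z ≡ r z) xs → filterᵇ p (filterᵇ q xs) ≡ filterᵇ r xs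
filterᵇ-filterᵇ p q r [] [] = refl
filterᵇ-filterᵇ p q r (x ∷ xs) (e ∷ a) with q x
... | false rewrite sym e | ∧-zeroʳ (p x) = filterᵇ-filterᵇ p q r xs a
... | true with p x
...   | true rewrite sym e = cong (x ∷_) (filterᵇ-filterᵇ p q r xs a)
...   | false rewrite sym e = filterᵇ-filterᵇ p q r xs a

All-filterᵇ : ∀ {P : ℕ → Set} (p : ℕ → Bool) {xs} → All P xs → All P (filterᵇ p xs)
All-filterᵇ p {xs} a = All.tabulate (λ m → All.lookup a (proj₁ (∈-filterᵇ⁻ p xs m)))

SameLengths : List ℕ → List ℕ → Set
SameLengths x y = lis x ≡ lis y × lds x ≡ lds y

SameLengths-sym : ∀ {x y} → SameLengths x y → SameLengths y x
SameLengths-sym (p , q) = sym p , sym q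

SameLengths-trans : ∀ {x y z} → SameLengths x y → SameLengths y z → SameLengths x z
SameLengths-trans (p , q) (p' , q') = trans p p' , trans q q'

-- A domain is needed because the maps used are strictly increasing only there: relabelling on 1 ,
-- ... , k, as `nthD` returns 0 past the end of its list, and `_∸ 1` on positive numbers.
MonotoneOn : (ℕ → Set) → (ℕ → ℕ) → Set
MonotoneOn D f = ∀ {i j} → D i → D j → i < j → f i < f j

module _ {D : ℕ → Set} {f : ℕ → ℕ} (mono : MonotoneOn D f) where

  monotone-reflects : ∀ {i j} → D i → D j → f i < f j → i < j
  monotone-reflects {i} {j} di dj l with <-cmp i j
  ... | tri< p _ _ = p
  ... | tri≈ _ refl _ = ⊥-elim (<-irrefl refl l)
  ... | tri> _ _ q = ⊥-elim (<-asym l (mono dj di q))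

  monotone-injective : ∀ {i j} → D i → D j → f i ≡ f j → i ≡ j
  monotone-injective {i} {j} di dj e with <-cmp i j
  ... | tri< p _ _ = ⊥-elim (<-irrefl e (mono di dj p))
  ... | tri≈ _ q _ = q
  ... | tri> _ _ q = ⊥-elim (<-irrefl (sym e) (mono dj di q))

  private
    ⊆-map : ∀ {y x} → y ⊆ x → map f y ⊆ map f x
    ⊆-map [] = []
    ⊆-map (z ∷ʳ s) = f z ∷ʳ ⊆-map s
    ⊆-map (refl ∷ s) = refl ∷ ⊆-map s

    ⊆-map⁻ : ∀ x {z} → z ⊆ map f x → ∃ λ y → y ⊆ x × z ≡ map f y
    ⊆-map⁻ [] [] = [] , [] , refl
    ⊆-map⁻ (a ∷ x) (_ ∷ʳ s) with ⊆-map⁻ x s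
    ... | y , t , e = y , a ∷ʳ t , e
    ⊆-map⁻ (a ∷ x) (refl ∷ s) with ⊆-map⁻ x s
    ... | y , t , e = a ∷ y , refl ∷ t , cong (f a ∷_) e

    All-⊆ : ∀ {y x} → y ⊆ x → All D x → All D y
    All-⊆ [] a = []
    All-⊆ (_ ∷ʳ s) (_ ∷ a) = All-⊆ s a
    All-⊆ (refl ∷ s) (d ∷ a) = d ∷ All-⊆ s a

    inc-map⁺ : ∀ {y} → All D y → Inc y → Inc (map f y)
    inc-map⁺ [] [] = []
    inc-map⁺ (d ∷ a) (p ∷ i) = AllP.map⁺ (All.zipWith (λ { (l , d') → mono d d' l }) (p , a)) ∷ inc-map⁺ a i

    inc-map⁻ : ∀ {y} → All D y → Inc (map f y) → Inc y
    inc-map⁻ {[]} [] [] = []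
    inc-map⁻ {z ∷ y} (d ∷ a) (p ∷ i) = All.zipWith (λ { (l , d') → monotone-reflects d d' l }) (AllP.map⁻ p , a) ∷ inc-map⁻ a i

  lis-map : ∀ x → All D x → lis (map f x) ≡ lis x
  lis-map x a = ≤-antisym one two
    where
    one : lis (map f x) ≤ lis x
    one with lis-attained (map f x)
    ... | z , s , i , e with ⊆-map⁻ x s
    ...   | y , s' , refl = ≤-trans (≤-reflexive (trans (sym e) (length-map f y))) (lis-upper s' (inc-map⁻ (All-⊆ s' a) i))
    two : lis x ≤ lis (map f x)
    two with lis-attained x
    ... | y , s , i , e = ≤-trans (≤-reflexive (trans (sym e) (sym (length-map f y)))) (lis-upper (⊆-map s) (inc-map⁺ (All-⊆ s a) i))

  lds-map : ∀ x → All D x → lds (map f x) ≡ lds x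
  lds-map x a = trans (sym (lds-reverse (map f x))) (trans (cong lis (sym (reverse-map f x))) (trans (lis-map (reverse x) (All-reverse a)) (lds-reverse x)))
    where
    lds-reverse : ∀ y → lis (reverse y) ≡ lds y
    lds-reverse y = trans (lis-reverse (reverse y)) (cong lds (reverse-involutive y))

  sameLengths-map : ∀ x → All D x → SameLengths (map f x) x
  sameLengths-map x a = lis-map x a , lds-map x a

module _ {m k' : ℕ} {x u : List ℕ} (pp : PromotionPair m k' x u) where

  open PromotionPair pp

  private
    module S = WordGrowth source
    module T = WordGrowth target

    tr : ∀ {A B} → A ≐ B → transpose A ≐ transpose B
    tr e r c = e c r

    transpose-stairs : ∀ i → transpose (stairs i) ≐ stairs i
    transpose-stairs i zero zero = refl
    transpose-stairs i zero (suc c) = refl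
    transpose-stairs i (suc r) zero = refl
    transpose-stairs i (suc r) (suc c) = cong (_<ᵇ i) (+-comm c r)

    left-transposed : ∀ {G : ℕ → ℕ → Shape} → (∀ i → i ≤ m → G i 0 ≐ stairs i) → ∀ i → i ≤ m → transpose (G i 0) ≐ stairs i
    left-transposed {G} h i l = ≐-trans (tr {G i 0} {stairs i} (h i l)) (transpose-stairs i)

    module RowCid = CidRows S.growth T.growth S.leftEdge T.leftEdge edge (rows-of-word source) (rows-of-word target)
    module ColCid = CidRows {G = λ i a → transpose (G i a)} {H = λ i a → transpose (G' i a)} (Growth-transpose S.growth) (Growth-transpose T.growth) (left-transposed {G} S.leftEdge)
      (left-transposed {G'} T.leftEdge) (λ i l → tr {G i (suc k')} {G' i (suc k')} (edge i l)) (columns-of-word source) (columns-of-word target)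
    module RowRid = RidRows S.growth T.growth slide upper lower (rows-of-word source) (rows-of-word target)
    module ColRid = RidRows {G = λ i a → transpose (G i a)} {G' = λ i a → transpose (G' i a)} {P = λ i a → transpose (P i a)} (Growth-transpose S.growth) (Growth-transpose T.growth) (Growth-transpose slide)
      (λ a l → tr {P 1 a} {G 0 (suc a)} (upper a l)) (λ a l → tr {P 0 a} {G' 0 a} (lower a l)) (columns-of-word source) (columns-of-word target)

  -- The columns of the diagrams give lds directly. The rows list the word backwards, so for lis the
  -- factor is reversed and sits at the mirrored place `suc m ∸ e`.
  standard-cid : ∀ s e → s ≤ e → e ≤ suc m → SameLengths (drop s (take e x)) (drop s (take e u))
  standard-cid s e s≤e l = lisᶜ , ColCid.factors s e l
    where
    rev : ∀ w → length w ≡ suc m → lis (drop s (take e w)) ≡ lds (drop (suc m ∸ e) (take (suc m ∸ e + (e ∸ s)) (reverse w)))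
    rev w lw = trans (lis-reverse (drop s (take e w))) (cong lds (trans (reverse-factor s e w (≤-trans l (≤-reflexive (sym lw))))
      (cong (λ n → drop (n ∸ e) (take (n ∸ e + (e ∸ s)) (reverse w))) lw)))
    lisᶜ : lis (drop s (take e x)) ≡ lis (drop s (take e u))
    lisᶜ = trans (rev x S.size) (trans (RowCid.factors (suc m ∸ e) (suc m ∸ e + (e ∸ s))
        (≤-trans (+-monoʳ-≤ (suc m ∸ e) (m∸n≤m e s)) (≤-reflexive (m∸n+n≡m l))))
      (sym (rev u T.size)))

  standard-rid : ∀ a₀ t → a₀ + t ≤ k' →
    SameLengths (restrict (suc (suc a₀)) (suc (a₀ + t)) x) (restrict (suc a₀) (a₀ + t) u)
  standard-rid a₀ t l = trans (rev (suc (suc a₀)) (suc (a₀ + t)) x) (trans (RowRid.intervals a₀ t l) (sym (rev (suc a₀) (a₀ + t) u))) , ColRid.intervals a₀ t l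
    where
    rev : ∀ a b w → lis (restrict a b w) ≡ lds (restrict a b (reverse w))
    rev a b w = trans (lis-reverse (restrict a b w)) (cong lds (sym (filterᵇ-reverse (λ z → (a ≤ᵇ z) ∧ (z ≤ᵇ b)) w)))

-- The letters of a word and the search for the preimage

sorted-unique : ∀ {xs ys} → AllPairs _<_ xs → AllPairs _<_ ys → (∀ z → (z ∈ xs) ⟺ (z ∈ ys)) → xs ≡ ys
sorted-unique {[]} {[]} _ _ _ = refl
sorted-unique {[]} {y ∷ ys} _ _ h with proj₂ (h y) (here refl)
... | ()
sorted-unique {x ∷ xs} {[]} _ _ h with proj₁ (h x) (here refl)
... | ()
sorted-unique {x ∷ xs} {y ∷ ys} (a ∷ p) (b ∷ q) h = cong₂ _∷_ x≡y (sorted-unique p q tails)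
  where
  x≡y : x ≡ y
  x≡y with proj₁ (h x) (here refl) | proj₂ (h y) (here refl)
  ... | here e | _ = e
  ... | there m | here e = sym e
  ... | there m | there m' = ⊥-elim (<-asym (All.lookup b m) (All.lookup a m'))
  tails : ∀ z → (z ∈ xs) ⟺ (z ∈ ys)
  tails z = (λ m → case proj₁ (h z) (there m) of λ
      { (here e) → ⊥-elim (<-irrefl (trans x≡y (sym e)) (All.lookup a m)) ; (there m') → m' }) ,
    λ m → case proj₂ (h z) (there m) of λ
      { (here e) → ⊥-elim (<-irrefl (trans (sym x≡y) (sym e)) (All.lookup b m)) ; (there m') → m' }

elemᵇ-true⁻ : ∀ v w → elemᵇ v w ≡ true → v ∈ w
elemᵇ-true⁻ v w h with any-true⁻ (v ≡ᵇ_) w h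
... | z , m , e = subst (_∈ w) (sym (≡ᵇ-true⁻ v z e)) m

∈-letters : ∀ w v → (v ∈ letters w) ⟺ (v ∈ w)
∈-letters w v = (λ m → elemᵇ-true⁻ v w (proj₂ (∈-filterᵇ⁻ (λ v → elemᵇ v w) (upTo (suc (maxL w))) m))) ,
  λ m → ∈-filterᵇ⁺ (λ v → elemᵇ v w) (∈-upTo⁺ (s≤s (maxL-upper w m))) (any-true⁺ (v ≡ᵇ_) m (≡ᵇ-true {v} refl))

letters-sorted : ∀ w → AllPairs _<_ (letters w)
letters-sorted w = AllPairsP.filter⁺ (λ v → T? (elemᵇ v w)) (AllPairsP.applyUpTo⁺₁ (λ z → z) (suc (maxL w)) (λ l _ → l))

oneTo-sorted : ∀ k → AllPairs _<_ (oneTo k)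
oneTo-sorted k = AllPairsP.map⁺ (AllPairsP.applyUpTo⁺₁ (λ z → z) k (λ l _ → s≤s l))

length-oneTo : ∀ k → length (oneTo k) ≡ k
length-oneTo k = trans (length-map suc (upTo k)) (length-applyUpTo (λ z → z) k)

∈-nthD : ∀ xs c → c < length xs → nthD xs c ∈ xs
∈-nthD (x ∷ xs) zero l = here refl
∈-nthD (x ∷ xs) (suc c) (s≤s l) = there (∈-nthD xs c l)

nthD-∈ : ∀ xs {v} → v ∈ xs → ∃ λ c → c < length xs × nthD xs c ≡ v
nthD-∈ (x ∷ xs) (here refl) = 0 , s≤s z≤n , refl
nthD-∈ (x ∷ xs) (there m) with nthD-∈ xs m
... | c , l , e = suc c , s≤s l , e

standard-letters : ∀ {k w} → Standard k w → letters w ≡ oneTo k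
standard-letters {k} {w} s = sorted-unique (letters-sorted w) (oneTo-sorted k) (λ z →
  (λ m → case nthD-∈ w (proj₁ (∈-letters w z) m) of λ { (c , l , e) →
     from-range z (subst (1 ≤_) e (Standard.positive s c l)) (subst (_≤ k) e (Standard.atMost s c l)) }) ,
  λ m → case ∈-oneTo⁻ k m of λ { (y , refl , l) → case Standard.occurs s y l of λ { (c , l' , e) →
     proj₂ (∈-letters w z) (subst (_∈ w) e (∈-nthD w c l')) } })
  where
  from-range : ∀ z → 1 ≤ z → z ≤ k → z ∈ oneTo k
  from-range (suc z) _ l = ∈-oneTo⁺ l

letters-standard : ∀ {k w} → letters w ≡ oneTo k → Standard k w
letters-standard {k} {w} e = record
  { positive = λ c l → proj₁ (range c l) ; atMost = λ c l → proj₂ (range c l)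
  ; occurs = λ y l → nthD-∈ w (proj₁ (∈-letters w (suc y)) (subst (suc y ∈_) (sym e) (∈-oneTo⁺ l))) }
  where
  range : ∀ c → c < length w → 1 ≤ nthD w c × nthD w c ≤ k
  range c l with ∈-oneTo⁻ k (subst (nthD w c ∈_) e (proj₂ (∈-letters w _) (∈-nthD w c l)))
  ... | y , q , l' rewrite q = s≤s z≤n , l'

listEqᵇ-true : ∀ xs → listEqᵇ xs xs ≡ true
listEqᵇ-true [] = refl
listEqᵇ-true (x ∷ xs) = ∧-intro (≡ᵇ-true {x} refl) (listEqᵇ-true xs)

listEqᵇ-true⁻ : ∀ xs ys → listEqᵇ xs ys ≡ true → xs ≡ ys
listEqᵇ-true⁻ [] [] h = refl
listEqᵇ-true⁻ (x ∷ xs) (y ∷ ys) h with ∧-true {x ≡ᵇ y} h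
... | p , q = cong₂ _∷_ (≡ᵇ-true⁻ x y p) (listEqᵇ-true⁻ xs ys q)

isStd-standard : ∀ w → isStd w ≡ true → Standard (length (letters w)) w
isStd-standard w h = letters-standard (listEqᵇ-true⁻ _ _ h)

standard-isStd : ∀ {k w} → Standard k w → isStd w ≡ true
standard-isStd {k} {w} s = trans (cong (λ l → listEqᵇ l (oneTo (length l))) (standard-letters s))
  (trans (cong (λ n → listEqᵇ (oneTo k) (oneTo n)) (length-oneTo k)) (listEqᵇ-true (oneTo k)))

-- Distinct letters sit at distinct positions. This puts every standard word into the list of
-- candidates, whose letters go up to the length of the word.
standard-bound : ∀ {k w} → Standard k w → k ≤ length w
standard-bound {k} {w} s = FinP.injective⇒≤ {f = position} inj
  where
  open Standard s
  position : Fin k → Fin (length w)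
  position e = fromℕ< (proj₁ (proj₂ (occurs (toℕ e) (FinP.toℕ<n e))))
  letter : ∀ e → nthD w (toℕ (position e)) ≡ suc (toℕ e)
  letter e = trans (cong (nthD w) (FinP.toℕ-fromℕ< _)) (proj₂ (proj₂ (occurs (toℕ e) (FinP.toℕ<n e))))
  inj : ∀ {e e'} → position e ≡ position e' → e ≡ e'
  inj {e} {e'} q = FinP.toℕ-injective (suc-injective (trans (sym (letter e)) (trans (cong (nthD w ∘ toℕ) q) (letter e'))))

∈-allWords⁺ : ∀ m w → All (λ a → 1 ≤ a × a ≤ m) w → w ∈ allWords m (length w)
∈-allWords⁺ m [] [] = here refl
∈-allWords⁺ m (suc a ∷ w) ((_ , l) ∷ h) = ∈-concatMap⁺ (λ a → map (a ∷_) (allWords m (length w))) {xs = oneTo m}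
  (lose {P = λ b → (suc a ∷ w) ∈ map (b ∷_) (allWords m (length w))} (∈-oneTo⁺ l) (∈-map⁺ (suc a ∷_) (∈-allWords⁺ m w h)))

∈-allWords⁻ : ∀ m n {w} → w ∈ allWords m n → length w ≡ n
∈-allWords⁻ m zero (here refl) = refl
∈-allWords⁻ m (suc n) h with find (∈-concatMap⁻ (λ a → map (a ∷_) (allWords m n)) {xs = oneTo m} h)
... | a , _ , h' with ∈-map⁻ (a ∷_) h'
...   | w , h'' , refl = cong suc (∈-allWords⁻ m n h'')

findFirst-spec : {A : Set} (p : A → Bool) (d : A) (xs : List A) {x : A} → x ∈ xs → p x ≡ true →
  findFirst p d xs ∈ xs × p (findFirst p d xs) ≡ true
findFirst-spec p d (y ∷ xs) m h with p y in e
... | true = here refl , e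
findFirst-spec p d (y ∷ xs) (here refl) h | false = absurd h e
findFirst-spec p d (y ∷ xs) (there m) h | false with findFirst-spec p d xs m h
... | m' , h' = there m' , h'

-- The word built in `Realize` is among the candidates and passes the test, so `findFirst` does not
-- fall back on its default value.
Rst-pair : ∀ {m k' x} → length x ≡ suc m → Standard (suc k') x → PromotionPair m k' x (Rst x)
Rst-pair {m} {k'} {x} lx sx = Pr.matched-pair (WordGrowthOf.wordGrowth size (isStd-standard (Rst x) std)) (proj₂ found)
  where
  module Pr = PromotionOf (WordGrowthOf.wordGrowth lx sx)
  module I = WordGrowth Pr.image-growth
  matches : List ℕ → Bool
  matches u = tabEqᵇ (proj₁ (fInf u)) (promotion (proj₁ (fInf x))) ∧ tabEqᵇ (proj₂ (fInf u)) (proj₂ (fInf x))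
  found : Rst x ∈ filterᵇ isStd (allWords (length x) (length x)) × matches (Rst x) ≡ true
  found = findFirst-spec matches x (filterᵇ isStd (allWords (length x) (length x)))
    (∈-filterᵇ⁺ isStd (subst (λ n → Pr.image ∈ allWords n n) (trans I.size (sym lx))
      (∈-allWords⁺ (length Pr.image) Pr.image (All-nthD Pr.image (λ c l → Standard.positive I.std c l ,
        ≤-trans (Standard.atMost I.std c l) (standard-bound I.std)))))
      (standard-isStd I.std))
    Pr.image-matches
  std : isStd (Rst x) ≡ true
  std = proj₂ (∈-filterᵇ⁻ isStd (allWords (length x) (length x)) (proj₁ found))
  size : length (Rst x) ≡ suc m
  size = trans (∈-allWords⁻ (length x) (length x) (proj₁ (∈-filterᵇ⁻ isStd (allWords (length x) (length x)) (proj₁ found)))) lx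

-- Relabelling

idx-nthD : ∀ {a} vs → a ∈ vs → idx a vs < length vs × nthD vs (idx a vs) ≡ a
idx-nthD {a} (v ∷ vs) m with a ≡ᵇ v in e
... | true = s≤s z≤n , sym (≡ᵇ-true⁻ a v e)
idx-nthD {a} (v ∷ vs) (here refl) | false = absurd (≡ᵇ-true {a} refl) e
idx-nthD {a} (v ∷ vs) (there m) | false with idx-nthD vs m
... | l , q = s≤s l , q

nthD-sorted : ∀ {vs} → AllPairs _<_ vs → ∀ {c d} → c < d → d < length vs → nthD vs c < nthD vs d
nthD-sorted {v ∷ vs} (a ∷ p) {zero} {suc d} _ (s≤s l) = All.lookup a (∈-nthD vs d l)
nthD-sorted {v ∷ vs} (a ∷ p) {suc c} {suc d} (s≤s q) (s≤s l) = nthD-sorted p q l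

prevOf-nthD : ∀ {vs} → AllPairs _<_ vs → ∀ c → suc c < length vs → prevOf vs (nthD vs (suc c)) ≡ nthD vs c
prevOf-nthD {v ∷ v' ∷ vs} p zero l rewrite ≡ᵇ-true {v'} refl = refl
prevOf-nthD {v ∷ v' ∷ vs} (_ ∷ p@(a ∷ _)) (suc c) (s≤s l)
  rewrite ≡ᵇ-false {nthD vs c} {v'} (λ e → <-irrefl (sym e) (All.lookup a (∈-nthD vs c (s≤s⁻¹ l)))) = prevOf-nthD p c l
prevOf-nthD {v ∷ []} p c (s≤s ())

Between : ℕ → ℕ → Set
Between k i = 1 ≤ i × i ≤ k

threshold : ∀ (p : ℕ → Bool) k → (∀ {i j} → Between k i → Between k j → i < j → p j ≡ true → p i ≡ true) →
  ∃ λ c → c ≤ k × (∀ i → Between k i → (p i ≡ true) ⟺ (i ≤ c))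
threshold p zero down = 0 , z≤n , λ i b → (λ _ → proj₂ b) , λ l → ⊥-elim (<⇒≱ (proj₁ b) l)
threshold p (suc k) down with bool-cases (p (suc k))
... | inj₁ t = suc k , ≤-refl , λ i b → (λ _ → proj₂ b) , λ l → case m≤n⇒m<n∨m≡n l of λ
      { (inj₁ lt) → down b (s≤s z≤n , ≤-refl) lt t ; (inj₂ refl) → t }
... | inj₂ f with threshold p k (λ { (a , b) (a' , b') → down (a , m≤n⇒m≤1+n b) (a' , m≤n⇒m≤1+n b') })
...   | c , c≤ , h = c , m≤n⇒m≤1+n c≤ , λ { i (a , b) → case m≤n⇒m<n∨m≡n b of λ
      { (inj₁ lt) → h i (a , s≤s⁻¹ lt)
      ; (inj₂ refl) → (λ t → absurd t f) , λ l → ⊥-elim (<⇒≱ (s≤s c≤) l) } }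

Standard-∈ : ∀ {k w z} → Standard k w → z ∈ w → Between k z
Standard-∈ {k} {w} s m with nthD-∈ w m
... | c , l , refl = Standard.positive s c l , Standard.atMost s c l

Standard-All : ∀ {k w} → Standard k w → All (Between k) w
Standard-All s = All.tabulate (Standard-∈ s)

⇔-bool : ∀ {a b : Bool} → (a ≡ true → b ≡ true) → (b ≡ true → a ≡ true) → a ≡ b
⇔-bool {true} f g = sym (f refl)
⇔-bool {false} {true} f g = g refl
⇔-bool {false} {false} f g = refl

module Letters {vs : List ℕ} {k' : ℕ} (sorted : AllPairs _<_ vs) (size : length vs ≡ suc k') where

  private
    k = suc k'

  relabel : ℕ → ℕ
  relabel i = nthD vs (i ∸ 1)

  relabel-mono : MonotoneOn (Between k) relabel
  relabel-mono {suc i} {suc j} (_ , _) (_ , l) (s≤s q) = nthD-sorted sorted q (≤-trans l (≤-reflexive (sym size)))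

  relabel-∈ : ∀ {i} → Between k i → relabel i ∈ vs
  relabel-∈ {suc i} (_ , l) = ∈-nthD vs i (≤-trans l (≤-reflexive (sym size)))

  relabel-injective : ∀ {u v} → All (Between k) u → All (Between k) v → map relabel u ≡ map relabel v → u ≡ v
  relabel-injective {[]} {[]} _ _ _ = refl
  relabel-injective {x ∷ u} {y ∷ v} (a ∷ as) (b ∷ bs) e with ∷-inj e
    where
    ∷-inj : ∀ {p q : ℕ} {ps qs} → p ∷ ps ≡ q ∷ qs → p ≡ q × ps ≡ qs
    ∷-inj refl = refl , refl
  ... | p , q = cong₂ _∷_ (monotone-injective relabel-mono a b p) (relabel-injective as bs q)

  relabel-prev : ∀ {i} → Between k' i → prevOf vs (relabel (suc i)) ≡ relabel i
  relabel-prev {suc i} (_ , l) = prevOf-nthD sorted i (≤-trans (s≤s l) (≤-reflexive (sym size)))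

  delete-relabel : ∀ i {u} → Between k i → All (Between k) u →
    deleteLetter (relabel i) (map relabel u) ≡ map relabel (deleteLetter i u)
  delete-relabel i b a = filterᵇ-map _ _ relabel _ (All.map (λ {z} bz → cong not (⇔-bool
    (λ h → ≡ᵇ-true {z} (monotone-injective relabel-mono bz b (≡ᵇ-true⁻ (relabel z) (relabel i) h)))
    (λ h → ≡ᵇ-true (cong relabel (≡ᵇ-true⁻ z i h))))) a)

  -- Among the first `k'` letters, `a₀` counts those below `a` and `b₀` those up to `b`. When no
  -- letter lies in the interval, the truncated difference `b₀ ∸ a₀` is 0 and the right side is
  -- empty too.
  restrict-relabel : ∀ a b → ∃ λ a₀ → ∃ λ t → a₀ + t ≤ k' ×
    (∀ u → All (Between k') u → restrict a b (map relabel u) ≡ map relabel (restrict (suc a₀) (a₀ + t) u))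
  restrict-relabel a b = a₀ , b₀ ∸ a₀ , bounded , λ u h → filterᵇ-map _ _ relabel u (All.map agree h)
    where
    wide : ∀ {i} → Between k' i → Between k i
    wide (p , q) = p , m≤n⇒m≤1+n q
    low = threshold (λ i → relabel i <ᵇ a) k' (λ {i} {j} bi bj l h →
      <ᵇ-true {relabel i} {a} (<-trans (relabel-mono (wide bi) (wide bj) l) (<ᵇ-true⁻ {relabel j} {a} h)))
    high = threshold (λ i → relabel i ≤ᵇ b) k' (λ {i} {j} bi bj l h →
      ≤ᵇ-true {relabel i} {b} (≤-trans (<⇒≤ (relabel-mono (wide bi) (wide bj) l)) (≤ᵇ-true⁻ (relabel j) b h)))
    a₀ = proj₁ low
    b₀ = proj₁ high
    bounded : a₀ + (b₀ ∸ a₀) ≤ k'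
    bounded with ≤-total a₀ b₀
    ... | inj₁ l = ≤-trans (≤-reflexive (m+[n∸m]≡n l)) (proj₁ (proj₂ high))
    ... | inj₂ l = ≤-trans (≤-reflexive (trans (cong (a₀ +_) (m≤n⇒m∸n≡0 l)) (+-identityʳ a₀))) (proj₁ (proj₂ low))
    agree : ∀ {z} → Between k' z → (a ≤ᵇ relabel z) ∧ (relabel z ≤ᵇ b) ≡ (suc a₀ ≤ᵇ z) ∧ (z ≤ᵇ a₀ + (b₀ ∸ a₀))
    agree {z} bz = ⇔-bool to from
      where
      L = proj₂ (proj₂ low) z bz
      H = proj₂ (proj₂ high) z bz
      to : _ → _
      to h with ∧-true {a ≤ᵇ relabel z} h
      ... | p , q = ∧-intro (≤ᵇ-true (≰⇒> (λ l → <⇒≱ (<ᵇ-true⁻ {relabel z} {a} (proj₂ L l)) (≤ᵇ-true⁻ a (relabel z) p))))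
                            (≤ᵇ-true (≤-trans (proj₁ H q) (m≤n+m∸n b₀ a₀)))
      from : (suc a₀ ≤ᵇ z) ∧ (z ≤ᵇ a₀ + (b₀ ∸ a₀)) ≡ true → (a ≤ᵇ relabel z) ∧ (relabel z ≤ᵇ b) ≡ true
      from h with ∧-true {suc a₀ ≤ᵇ z} h
      ... | p , q = ∧-intro (≤ᵇ-true {a} {relabel z} (≮⇒≥ (λ l → <⇒≱ (≤ᵇ-true⁻ (suc a₀) z p) (proj₁ L (<ᵇ-true {relabel z} {a} l))))) (proj₂ H z≤b₀)
        where
        z≤b₀ : z ≤ b₀
        z≤b₀ with ≤-total a₀ b₀
        ... | inj₁ l = ≤-trans (≤ᵇ-true⁻ z _ q) (≤-reflexive (m+[n∸m]≡n l))
        ... | inj₂ l = ⊥-elim (<⇒≱ (≤ᵇ-true⁻ (suc a₀) z p)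
              (≤-trans (≤ᵇ-true⁻ z _ q) (≤-reflexive (trans (cong (a₀ +_) (m≤n⇒m∸n≡0 l)) (+-identityʳ a₀)))))

st-standard : ∀ w → Standard (length (letters w)) (st w)
st-standard w = record
  { positive = λ c l → proj₁ (range c l) ; atMost = λ c l → proj₂ (range c l)
  ; occurs = λ e l → nthD-∈ (st w) (subst (_∈ st w) (cong suc (index e l))
      (∈-map⁺ (λ a → suc (idx a vs)) (proj₁ (∈-letters w (nthD vs e)) (∈-nthD vs e l)))) }
  where
  vs = letters w
  range : ∀ c → c < length (st w) → 1 ≤ nthD (st w) c × nthD (st w) c ≤ length vs
  range c l with ∈-map⁻ (λ a → suc (idx a vs)) (∈-nthD (st w) c l)
  ... | a , m , e rewrite e = s≤s z≤n , proj₁ (idx-nthD vs (proj₂ (∈-letters w a) m))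
  index : ∀ e → e < length vs → idx (nthD vs e) vs ≡ e
  index e l with idx-nthD vs (∈-nthD vs e l)
  ... | l' , q with <-cmp (idx (nthD vs e) vs) e
  ...   | tri< p _ _ = ⊥-elim (<-irrefl q (nthD-sorted (letters-sorted w) p l))
  ...   | tri≈ _ p _ = p
  ...   | tri> _ _ p = ⊥-elim (<-irrefl (sym q) (nthD-sorted (letters-sorted w) p l'))

destd-st : ∀ w → destd (letters w) (st w) ≡ w
destd-st w = go w (λ a m → proj₂ (idx-nthD (letters w) (proj₂ (∈-letters w a) m)))
  where
  vs = letters w
  go : ∀ x → (∀ a → a ∈ x → nthD vs (idx a vs) ≡ a) → map (λ i → nthD vs (i ∸ 1)) (map (λ a → suc (idx a vs)) x) ≡ x
  go [] h = refl
  go (a ∷ x) h = cong₂ _∷_ (h a (here refl)) (go x (λ b m → h b (there m)))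

-- The words w and r = R w are relabellings of the standard words x and u.
module Relabelled {m k' : ℕ} {w vs x u r : List ℕ} (lw : length w ≡ suc m) (vs≡ : letters w ≡ vs) (lv : length vs ≡ suc k')
  (pair : PromotionPair m k' x u)
  (word-relabel : w ≡ map (λ i → nthD vs (i ∸ 1)) x) (R-relabel : r ≡ map (λ i → nthD vs (i ∸ 1)) u) where

  private
    k = suc k'
    module S = WordGrowth (PromotionPair.source pair)
    module T = WordGrowth (PromotionPair.target pair)

  open Letters {vs} {k'} (subst (AllPairs _<_) vs≡ (letters-sorted w)) lv

  u-range : All (Between k) u
  u-range = Standard-All T.std

  x-range : All (Between k) x
  x-range = Standard-All S.std

  R-length : length (r) ≡ suc m
  R-length = trans (cong length R-relabel) (trans (length-map relabel u) T.size)

  R-letters : ∀ a → (a ∈ w) ⟺ (a ∈ r)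
  R-letters a = to , from
    where
    to : a ∈ w → a ∈ r
    to h with nthD-∈ vs (subst (a ∈_) vs≡ (proj₂ (∈-letters w a) h))
    ... | c , l , e with Standard.occurs T.std c (≤-trans l (≤-reflexive lv))
    ...   | d , l' , e' = subst (a ∈_) (sym R-relabel) (subst (_∈ map relabel u) e
              (∈-map⁺ relabel (subst (_∈ u) e' (∈-nthD u d l'))))
    from : a ∈ r → a ∈ w
    from h with ∈-map⁻ relabel (subst (a ∈_) R-relabel h)
    ... | i , mem , refl = proj₁ (∈-letters w (relabel i)) (subst (relabel i ∈_) (sym vs≡) (relabel-∈ (All.lookup u-range mem)))

  R-cid : w ∼cid r
  R-cid = trans lw (sym R-length) , λ { (suc i) j _ i≤j j≤ → factors i j (<⇒≤ i≤j) (≤-trans j≤ (≤-reflexive lw)) ; zero j () _ _ }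
    where
    relabelled : ∀ s e y → All (Between k) y → SameLengths (factor (suc s) e (map relabel y)) (drop s (take e y))
    relabelled s e y a = subst (λ z → SameLengths z (drop s (take e y)))
      (sym (trans (sym (drop-take s e (map relabel y))) (trans (cong (drop s) (take-map e y)) (drop-map s (take e y)))))
      (sameLengths-map relabel-mono (drop s (take e y)) (AllP.drop⁺ s (AllP.take⁺ e a)))
    factors : ∀ s e → s ≤ e → e ≤ suc m → SameLengths (factor (suc s) e w) (factor (suc s) e (r))
    factors s e l l' = subst₂ (λ y z → SameLengths (factor (suc s) e y) (factor (suc s) e z)) (sym word-relabel) (sym R-relabel)
      (SameLengths-trans {factor (suc s) e (map relabel x)} {drop s (take e x)} {factor (suc s) e (map relabel u)} (relabelled s e x x-range)
        (SameLengths-trans {drop s (take e x)} {drop s (take e u)} {factor (suc s) e (map relabel u)} (standard-cid pair s e l l')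
          (SameLengths-sym {factor (suc s) e (map relabel u)} {drop s (take e u)} (relabelled s e u u-range))))

  private
    largest-relabel : largest w ≡ relabel k
    largest-relabel = ≤-antisym upper (maxL-upper w (proj₁ (∈-letters w _) (subst (relabel k ∈_) (sym vs≡) (relabel-∈ (s≤s z≤n , ≤-refl)))))
      where
      upper : maxL w ≤ relabel k
      upper with maxL-attained w
      ... | inj₁ e = ≤-trans (≤-reflexive e) z≤n
      ... | inj₂ mem with nthD-∈ vs (subst (maxL w ∈_) vs≡ (proj₂ (∈-letters w _) mem))
      ...   | c , l , e with m≤n⇒m<n∨m≡n (s≤s⁻¹ (≤-trans l (≤-reflexive lv)))
      ...     | inj₂ refl = ≤-reflexive (sym e)
      ...     | inj₁ lt = ≤-trans (≤-reflexive (sym e)) (<⇒≤ (nthD-sorted (subst (AllPairs _<_) vs≡ (letters-sorted w)) lt (≤-reflexive (sym lv))))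

    x⁻ u⁻ : List ℕ
    x⁻ = map (_∸ 1) (deleteLetter 1 x)
    u⁻ = deleteLetter k u

    above-one : All (λ z → 2 ≤ z × z ≤ k) (deleteLetter 1 x)
    above-one = All.tabulate (λ {z} mem → case ∈-filterᵇ⁻ (λ y → not (y ≡ᵇ 1)) x mem of λ { (mem' , t) →
      case All.lookup x-range mem' of λ { (p , q) → ≤∧≢⇒< p (λ e → absurd (≡ᵇ-true (sym e)) (not-true t)) , q } })

    -- In the labels 1 , ... , k, the passage from a letter to the previous one is subtraction of 1.
    shifted : delMinShift w ≡ map relabel x⁻
    shifted = trans (cong₂ (λ l y → map (prevOf l) (deleteLetter (nthD l 0) y)) vs≡ word-relabel)
      (trans (cong (map (prevOf vs)) (delete-relabel 1 (s≤s z≤n , s≤s z≤n) x-range)) (go (deleteLetter 1 x) above-one))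
      where
      go : ∀ y → All (λ z → 2 ≤ z × z ≤ k) y → map (prevOf vs) (map relabel y) ≡ map relabel (map (_∸ 1) y)
      go [] [] = refl
      go (suc z ∷ y) ((s≤s p , s≤s q) ∷ a) = cong₂ _∷_ (relabel-prev (p , q)) (go y a)

    deleted : deleteLetter (largest w) (r) ≡ map relabel u⁻
    deleted = trans (cong₂ deleteLetter largest-relabel R-relabel) (delete-relabel k (s≤s z≤n , ≤-refl) u-range)

    x⁻-range : All (Between k') x⁻
    x⁻-range = AllP.map⁺ (All.map (λ { {suc z} (s≤s p , s≤s q) → p , q }) above-one)

    u⁻-range : All (Between k') u⁻
    u⁻-range = All.tabulate (λ {z} mem → case ∈-filterᵇ⁻ (λ y → not (y ≡ᵇ k)) u mem of λ { (mem' , t) →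
      case All.lookup u-range mem' of λ { (p , q) → p , s≤s⁻¹ (≤∧≢⇒< q (λ e → absurd (≡ᵇ-true e) (not-true t))) } })

    restrict-x⁻ : ∀ a₀ t → restrict (suc a₀) (a₀ + t) x⁻ ≡ map (_∸ 1) (restrict (suc (suc a₀)) (suc (a₀ + t)) x)
    restrict-x⁻ a₀ t = trans
      (filterᵇ-map _ inside (_∸ 1) (deleteLetter 1 x) (All.map (λ { {suc (suc z)} (s≤s (s≤s _) , _) → refl }) above-one))
      -- The interval starts at `a₀ + 2`, so the deletion of the letter 1 does not affect it.
      (cong (map (_∸ 1)) (filterᵇ-filterᵇ inside (λ y → not (y ≡ᵇ 1)) inside x
        (All.map (λ { {suc zero} _ → refl ; {suc (suc z)} _ → ∧-true-right _ ; {zero} (() , _) }) x-range)))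
      where
      inside : ℕ → Bool
      inside z = (suc (suc a₀) ≤ᵇ z) ∧ (z ≤ᵇ suc (a₀ + t))
      ∧-true-right : ∀ b → b ∧ true ≡ b
      ∧-true-right true = refl
      ∧-true-right false = refl

    restrict-u⁻ : ∀ a₀ t → a₀ + t ≤ k' → restrict (suc a₀) (a₀ + t) u⁻ ≡ restrict (suc a₀) (a₀ + t) u
    restrict-u⁻ a₀ t l = filterᵇ-filterᵇ _ (λ y → not (y ≡ᵇ k)) _ u (All.map (λ {z} _ → ⇔-bool
      (λ h → proj₁ (∧-true {(suc a₀ ≤ᵇ z) ∧ (z ≤ᵇ a₀ + t)} h))
      (λ h → ∧-intro h (cong not (≡ᵇ-false {z} {k} (λ { refl → <⇒≱ (s≤s l)
          (≤ᵇ-true⁻ k (a₀ + t) (proj₂ (∧-true {suc a₀ ≤ᵇ k} h))) }))))) u-range)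

    lowering-mono : MonotoneOn (1 ≤_) (_∸ 1)
    lowering-mono (s≤s _) (s≤s _) (s≤s l) = l

  R-rid : delMinShift w ∼rid deleteLetter (largest w) (r)
  R-rid a b with restrict-relabel a b
  ... | a₀ , t , l , h = subst₂ (λ y z → SameLengths (restrict a b y) (restrict a b z)) (sym shifted) (sym deleted)
    (subst₂ SameLengths (sym (h x⁻ x⁻-range)) (sym (h u⁻ u⁻-range))
      (SameLengths-trans {map relabel A} {A} {map relabel B} (sameLengths-map relabel-mono A (wide x⁻-range))
        (SameLengths-trans {A} {B} {map relabel B} middle
          (SameLengths-sym {map relabel B} {B} (sameLengths-map relabel-mono B (wide u⁻-range))))))
    where
    A = restrict (suc a₀) (a₀ + t) x⁻
    B = restrict (suc a₀) (a₀ + t) u⁻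
    wide : ∀ {y} → All (Between k') y → All (Between k) (restrict (suc a₀) (a₀ + t) y)
    wide r = All-filterᵇ _ (All.map (λ { (p , q) → p , m≤n⇒m≤1+n q }) r)
    C = restrict (suc (suc a₀)) (suc (a₀ + t)) x
    middle : SameLengths A B
    middle = subst₂ SameLengths (sym (restrict-x⁻ a₀ t)) (sym (restrict-u⁻ a₀ t l))
      (SameLengths-trans {map (_∸ 1) C} {C} {restrict (suc a₀) (a₀ + t) u} (sameLengths-map lowering-mono C (All-filterᵇ _ (All.map proj₁ x-range)))
        (standard-rid pair a₀ t l))

-- The map R on arbitrary words

nonempty-letters-length : ∀ {m} w → length w ≡ suc m → ∃ λ k' → length (letters w) ≡ suc k'
nonempty-letters-length (a ∷ w) _ with letters (a ∷ w) | proj₂ (∈-letters (a ∷ w) a) (here refl)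
... | v ∷ vs | _ = length vs , refl

Standard-single : ∀ {k' u w} → length u ≡ 1 → length w ≡ 1 → Standard (suc k') u → Standard (suc k') w → u ≡ w
Standard-single {k'} {u} {w} lu lw su sw = nthD-ext u w (trans lu (sym lw)) (λ c l →
    trans (one su lu c l) (sym (one sw lw c (≤-trans l (≤-reflexive (trans lu (sym lw)))))))
  where
  one : ∀ {y} → Standard (suc k') y → length y ≡ 1 → ∀ c → c < length y → nthD y c ≡ 1
  one s e c l = ≤-antisym (≤-trans (Standard.atMost s c l) (≤-trans (standard-bound s) (≤-reflexive e))) (Standard.positive s c l)

-- The list `vs` is kept apart from `letters w`, so that two words with the same letters can be
-- relabelled by one and the same list.
module WordR {m : ℕ} {w vs : List ℕ} {k' : ℕ} (lw : length w ≡ suc m) (vs≡ : letters w ≡ vs) (lv : length vs ≡ suc k') where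

  private
    lx : length (st w) ≡ suc m
    lx = trans (length-map _ w) lw

    source-standard : Standard (suc k') (st w)
    source-standard = subst (λ n → Standard n (st w)) (trans (cong length vs≡) lv) (st-standard w)

  pair : PromotionPair m k' (st w) (Rst (st w))
  pair = Rst-pair lx source-standard

  word-relabel : w ≡ map (λ i → nthD vs (i ∸ 1)) (st w)
  word-relabel = trans (sym (destd-st w)) (cong (λ l → destd l (st w)) vs≡)

  -- On words of length 1, where R is the identity, Rst does nothing.
  R-relabel : R w ≡ map (λ i → nthD vs (i ∸ 1)) (Rst (st w))
  R-relabel = by-length m refl
    where
    unfold : ∀ n → length w ≡ n → R w ≡ (if n ≤ᵇ 1 then w else destd (letters w) (Rst (st w)))
    unfold n e = cong (λ n → if n ≤ᵇ 1 then w else destd (letters w) (Rst (st w))) e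
    by-length : ∀ m' → m ≡ m' → R w ≡ map (λ i → nthD vs (i ∸ 1)) (Rst (st w))
    by-length zero e = trans (unfold 1 (trans lw (cong suc e))) (trans word-relabel (cong (map (λ i → nthD vs (i ∸ 1)))
      (Standard-single (trans lx (cong suc e)) (trans (WordGrowth.size (PromotionPair.target pair)) (cong suc e))
        source-standard (WordGrowth.std (PromotionPair.target pair)))))
    by-length (suc m') e = trans (unfold (suc (suc m')) (trans lw (cong suc e))) (cong (λ l → destd l (Rst (st w))) vs≡)

module _ {m : ℕ} (w : List ℕ) (lw : length w ≡ suc m) where

  private
    lv = proj₂ (nonempty-letters-length w lw)
    module W = WordR {w = w} lw refl lv
    module Q = Relabelled {w = w} {r = R w} lw refl lv W.pair W.word-relabel W.R-relabel

  length-R : length (R w) ≡ suc m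
  length-R = Q.R-length

  ∈-R : ∀ a → (a ∈ w) ⟺ (a ∈ R w)
  ∈-R = Q.R-letters

  cid-R : w ∼cid R w
  cid-R = Q.R-cid

  rid-R : delMinShift w ∼rid deleteLetter (largest w) (R w)
  rid-R = Q.R-rid

  letters-R : letters (R w) ≡ letters w
  letters-R = sorted-unique (letters-sorted (R w)) (letters-sorted w) (λ z →
    (λ h → proj₂ (∈-letters w z) (proj₂ (∈-R z) (proj₁ (∈-letters (R w) z) h))) ,
    λ h → proj₂ (∈-letters (R w) z) (proj₁ (∈-R z) (proj₁ (∈-letters w z) h)))

-- Injectivity and surjectivity of R

R-injective : ∀ {m} u w → length u ≡ suc m → length w ≡ suc m → R u ≡ R w → u ≡ w
R-injective {m} u w lu lw e = trans U.word-relabel (trans (cong (map (λ i → nthD (letters w) (i ∸ 1))) st≡) (sym W.word-relabel))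
  where
  -- R preserves the set of letters, so equal images allow the two words to be compared in the same
  -- labels.
  vs≡ : letters u ≡ letters w
  vs≡ = trans (sym (letters-R u lu)) (trans (cong letters e) (letters-R w lw))
  lv = proj₂ (nonempty-letters-length w lw)
  module U = WordR {w = u} lu vs≡ lv
  module W = WordR {w = w} lw refl lv
  Rst≡ : Rst (st u) ≡ Rst (st w)
  Rst≡ = Letters.relabel-injective (letters-sorted w) lv (Standard-All (WordGrowth.std (PromotionPair.target U.pair)))
    (Standard-All (WordGrowth.std (PromotionPair.target W.pair))) (trans (sym U.R-relabel) (trans e W.R-relabel))
  st≡ : st u ≡ st w
  st≡ = promotion-injective U.pair (subst (PromotionPair m _ (st w)) (sym Rst≡) W.pair)

R-IsWord : ∀ {m w} → IsWord (suc m) w → IsWord (suc m) (R w)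
R-IsWord {w = w} (l , a) = length-R w l , All.tabulate (λ {z} mem → All.lookup a (proj₂ (∈-R w l z) mem))

iterate : ℕ → List ℕ → List ℕ
iterate zero w = w
iterate (suc i) w = R (iterate i w)

module _ {m : ℕ} {v : List ℕ} (word : IsWord (suc m) v) where

  iterate-IsWord : ∀ i → IsWord (suc m) (iterate i v)
  iterate-IsWord zero = word
  iterate-IsWord (suc i) = R-IsWord (iterate-IsWord i)

  iterate-∈ : ∀ i a → a ∈ iterate i v → a ∈ v
  iterate-∈ zero a mem = mem
  iterate-∈ (suc i) a mem = iterate-∈ i a (proj₂ (∈-R (iterate i v) (proj₁ (iterate-IsWord i)) a) mem)

  private
    words : List (List ℕ)
    words = allWords (maxL v) (suc m)

    -- The orbit of `v` uses the letters of `v` only, so it stays in the finite list of words on 1 ,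
    -- ... , `maxL v`.
    listed : ∀ i → iterate i v ∈ words
    listed i = subst (λ n → iterate i v ∈ allWords (maxL v) n) (proj₁ (iterate-IsWord i))
      (∈-allWords⁺ (maxL v) (iterate i v) (All.tabulate (λ {a} mem →
        All.lookup (proj₂ (iterate-IsWord i)) mem , maxL-upper v (iterate-∈ i a mem))))

    position : Fin (suc (length words)) → Fin (length words)
    position i = Any.index (listed (toℕ i))

    position-iterate : ∀ i → lookup words (Any.index (listed i)) ≡ iterate i v
    position-iterate i = sym (AnyP.lookup-index (listed i))

    -- Injectivity strips the `i` outer applications of R from a collision in the orbit, which
    -- leaves `v` itself as a value of R.
    cancel : ∀ i d → iterate (i + suc d) v ≡ iterate i v → R (iterate d v) ≡ v
    cancel zero d e = e
    cancel (suc i) d e = cancel i d (R-injective _ _ (proj₁ (iterate-IsWord (i + suc d))) (proj₁ (iterate-IsWord i)) e)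

  R-surjective : ∃ λ w → IsWord (suc m) w × R w ≡ v
  R-surjective = from-collision (FinP.pigeonhole ≤-refl position)
    where
    from-collision : (∃ λ i → ∃ λ j → i Fin.< j × position i ≡ position j) → ∃ λ w → IsWord (suc m) w × R w ≡ v
    from-collision (i , j , i<j , e) = iterate d v , iterate-IsWord d , cancel a d (trans (cong (λ n → iterate n v) (trans (+-suc a d) (m+[n∸m]≡n i<j)))
        (trans (sym (position-iterate b)) (trans (cong (lookup words) (sym e)) (position-iterate a))))
      where
      a = toℕ i
      b = toℕ j
      d = b ∸ suc a

theorem3p1 : (n : ℕ) → 1 ≤ n →
    ((w : List ℕ) → IsWord n w → IsWord n (R w))
    × ((u w : List ℕ) → IsWord n u → IsWord n w → R u ≡ R w → u ≡ w)
    × ((v : List ℕ) → IsWord n v → ∃ (λ w → IsWord n w × R w ≡ v))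
    × ((w : List ℕ) → IsWord n w →
    (w ∼cid R w)
    × (delMinShift w ∼rid deleteLetter (largest w) (R w))
    × ((a : ℕ) → (a ∈ w) ⇔ (a ∈ R w)))
theorem3p1 (suc m) _ =
  (λ w → R-IsWord) ,
  (λ u w p q → R-injective u w (proj₁ p) (proj₁ q)) ,
  (λ v → R-surjective) ,
  λ w p → cid-R w (proj₁ p) , rid-R w (proj₁ p) , λ a → mk⇔ (proj₁ (∈-R w (proj₁ p) a)) (proj₂ (∈-R w (proj₁ p) a))
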